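{- Let $s\ge 3$ and let $L(x_1,\dots,x_s)=c_1x_1+\dots+c_sx_s$ be a translation-invariant linear form (that is, $c_i\in\mathbb{Z}\setminus\{0\}$ and $c_1+\dots+c_s=0$) that is primitive. Then there is $\varepsilon_L>0$ such that \[ r_L(N)=\Omega_L\left(N^{\frac{1}{s-1}+\varepsilon_L}\right), \] i.e. there is a constant $C>0$ depending only on $L$ such that $r_L(N)\ge C\,N^{\frac1{s-1}+\varepsilon_L}$ for all integers $N\ge1$.
   Context: A form $L(x_1,\dots,x_s)=\sum_i c_ix_i$ with $c_i\in\mathbb{Z}\setminus\{0\}$, $\sum_i c_i=0$, is primitive if, among the partitions $\mathcal T$ of $[s]=\{1,\dots,s\}$ satisfying $\sum_{i\in T}c_i=0$ for all $T\in\mathcal T$, there is a unique finest one (i.e. a unique one minimal under refinement; equivalently, one that refines all the others). For a solution $(x_1,\dots,x_s)\in\mathbb{Z}^s$ to $L=0$, let $\mathcal T$ be the partition of $[s]$ in which $i,j$ lie in the same block if and only if $x_i=x_j$. The solution is trivial if $\sum_{i\in T}c_i=0$ for all $T\in\mathcal T$, and nontrivial otherwise. A set $A\subseteq\mathbb{Z}$ is $L$-free if all solutions in $A^s$ to $L=0$ are trivial. Define $r_L(N)=\max\{|A| : A\subseteq\{1,\dots,N\} \text{ is } L\text{ -free}\}$. -}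

module Defs where

open import Algebra.Properties.CommutativeMonoid.Sum using (sum-cong-≗)
open import Data.Bool.Base using (if_then_else_)
open import Data.Empty using (⊥-elim)
open import Data.Fin.Base using (Fin; toℕ)
open import Data.Fin.Properties using (all?)
open import Data.Fin.Subset using (Subset; inside; outside; _∈_; ∣_∣; ⊥)
open import Data.Fin.Subset.Properties using (_∈?_; ∉⊥; ∣⊥∣≡0)
open import Data.Integer.Base as ℤ using (ℤ; 0ℤ; +_; -[1+_])
import Data.Integer.Properties as ℤ
open import Data.List.Base using (List; []; _∷_; _++_; map; filter)
open import Data.List.Extrema.Nat using (max; argmax-sel; xs≤max)
import Data.List.Membership.Propositional as List
open import Data.List.Membership.Propositional.Properties using (∈-map⁺; ∈-map⁻; ∈-filter⁺; ∈-filter⁻; ∈-++⁺ˡ; ∈-++⁺ʳ)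
import Data.List.Relation.Unary.All as All
open import Data.List.Relation.Unary.Any using (here)
open import Data.Nat.Base using (ℕ; zero; suc; _≤_; s≤s)
open import Data.Product.Base using (∃; _×_; _,_; proj₁; proj₂)
open import Data.Product using (∃!)
open import Data.Rational.Unnormalised.Base as ℚᵘ using (ℚᵘ; mkℚᵘ; _/_)
open import Data.Sum.Base using (inj₁; inj₂)
open import Data.Vec.Base using (Vec; []; _∷_; lookup; tabulate)
open import Data.Vec.Functional using (Vector)
open import Data.Vec.Properties using (lookup∘tabulate)
open import Level using (0ℓ)
open import Relation.Binary.Core using (Rel)
open import Relation.Binary.PropositionalEquality using (_≡_; _≢_; _≗_; refl; sym; trans; cong; cong₂; subst)
open import Relation.Binary.PropositionalEquality.Properties using (isDecEquivalence)
open import Relation.Binary.Structures using (IsDecEquivalence)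
import Relation.Binary.Construct.On as On
open import Relation.Nullary.Decidable using (Dec; does; map′; _→-dec_)
open import Relation.Unary using (Pred)

open import Algebra.Definitions.RawMonoid ℤ.+-0-rawMonoid using (sum)
open import Algebra.Definitions.RawSemiring ℚᵘ.+-*-rawSemiring using () renaming (_^_ to _^ℚ_)

private
  variable
    s N : ℕ

record TranslationInvariantForm (s : ℕ) : Set where
  field
    c      : Vector ℤ s
    c≢0    : ∀ i → c i ≢ 0ℤ
    sum≡0  : sum c ≡ 0ℤ

  ⟦_⟧ : Vector ℤ s → ℤ
  ⟦ x ⟧ = sum (λ i → c i ℤ.* x i)

open TranslationInvariantForm public using (c)

-- A partition of [s] is the set of classes of a decidable equivalence relation;
-- its blocks are the classes {i | i ~ j}, for j in [s].
record Partition (s : ℕ) : Set₁ where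
  field
    _~_   : Rel (Fin s) 0ℓ
    isDec : IsDecEquivalence _~_

  open IsDecEquivalence isDec public using () renaming (_≟_ to _~?_)

-- 𝒯 ⊑ 𝒰: 𝒯 refines 𝒰.
_⊑_ : Rel (Partition s) 0ℓ
𝒯 ⊑ 𝒰 = ∀ {i j} → Partition._~_ 𝒯 i j → Partition._~_ 𝒰 i j

_≈ₚ_ : Rel (Partition s) 0ℓ
𝒯 ≈ₚ 𝒰 = 𝒯 ⊑ 𝒰 × 𝒰 ⊑ 𝒯

blockSum : TranslationInvariantForm s → Partition s → Fin s → ℤ
blockSum L 𝒯 j = sum (λ i → if does (i ~? j) then c L i else 0ℤ)
  where open Partition 𝒯

-- Every block sum of coefficients vanishes.
Balanced : TranslationInvariantForm s → Pred (Partition s) 0ℓ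
Balanced L 𝒯 = ∀ j → blockSum L 𝒯 j ≡ 0ℤ

Finest : TranslationInvariantForm s → Partition s → Set₁
Finest L 𝒯 = Balanced L 𝒯 × (∀ 𝒰 → Balanced L 𝒰 → 𝒰 ⊑ 𝒯 → 𝒯 ⊑ 𝒰)

Primitive : TranslationInvariantForm s → Set₁
Primitive L = ∃! _≈ₚ_ (Finest L)

levelPartition : Vector ℤ s → Partition s
levelPartition x = record
  { _~_   = λ i j → x i ≡ x j
  ; isDec = On.isDecEquivalence x (isDecEquivalence ℤ._≟_)
  }

Trivial : TranslationInvariantForm s → Pred (Vector ℤ s) 0ℓ
Trivial L x = Balanced L (levelPartition x)

Free : TranslationInvariantForm s → Pred ℤ 0ℓ → Set
Free L A = ∀ x → (∀ i → A (x i)) → ⟦ x ⟧ ≡ 0ℤ → Trivial L x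
  where open TranslationInvariantForm L using (⟦_⟧)

-- A subset of {1,…,N} is encoded as a Subset N, the index k standing for the
-- integer 1 + k.
elem : Fin N → ℤ
elem k = + suc (toℕ k)

⟪_⟫ : Subset N → Pred ℤ 0ℓ
⟪ S ⟫ z = ∃ λ k → k ∈ S × elem k ≡ z

private
  allVec? : ∀ {n} {P : Pred (Vec (Fin N) n) 0ℓ} → (∀ v → Dec (P v)) → Dec (∀ v → P v)
  allVec? {n = zero}  P? = map′ (λ { p [] → p }) (λ f → f []) (P? [])
  allVec? {n = suc _} P? =
    map′ (λ { f (k ∷ v) → f k v }) (λ f k v → f (k ∷ v))
         (all? (λ k → allVec? (λ v → P? (k ∷ v))))

  sum-cong : {f g : Vector ℤ s} → f ≗ g → sum f ≡ sum g
  sum-cong = sum-cong-≗ ℤ.+-0-commutativeMonoid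

module _ (L : TranslationInvariantForm s) where

  open TranslationInvariantForm L using (⟦_⟧)

  private
    ⟦⟧-cong : ∀ {x y} → x ≗ y → ⟦ x ⟧ ≡ ⟦ y ⟧
    ⟦⟧-cong x≗y = sum-cong (λ i → cong (c L i ℤ.*_) (x≗y i))

    Trivial-resp : ∀ {x y} → x ≗ y → Trivial L x → Trivial L y
    Trivial-resp x≗y triv j = trans
      (sum-cong (λ i → cong₂ (λ a b → if does (a ℤ.≟ b) then c L i else 0ℤ)
                             (sym (x≗y i)) (sym (x≗y j))))
      (triv j)

    point : Vec (Fin N) s → Vector ℤ s
    point v i = elem (lookup v i)

    FreeVec : Subset N → Set
    FreeVec S = ∀ v → (∀ i → lookup v i ∈ S) → ⟦ point v ⟧ ≡ 0ℤ → Trivial L (point v)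

    FreeVec? : (S : Subset N) → Dec (FreeVec S)
    FreeVec? S = allVec? λ v →
      all? (λ i → lookup v i ∈? S) →-dec
      ((⟦ point v ⟧ ℤ.≟ 0ℤ) →-dec
       all? (λ j → blockSum L (levelPartition (point v)) j ℤ.≟ 0ℤ))

    vec⇒free : (S : Subset N) → FreeVec S → Free L ⟪ S ⟫
    vec⇒free S free x x∈S Lx≡0 =
      Trivial-resp v≗x (free v v∈S (trans (⟦⟧-cong v≗x) Lx≡0))
      where
      v = tabulate (λ i → proj₁ (x∈S i))
      v≗x : point v ≗ x
      v≗x i = trans (cong elem (lookup∘tabulate _ i)) (proj₂ (proj₂ (x∈S i)))
      v∈S : ∀ i → lookup v i ∈ S
      v∈S i = subst (_∈ S) (sym (lookup∘tabulate _ i)) (proj₁ (proj₂ (x∈S i)))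

    free⇒vec : (S : Subset N) → Free L ⟪ S ⟫ → FreeVec S
    free⇒vec S free v v∈S = free (point v) (λ i → lookup v i , v∈S i , refl)

  free? : (S : Subset N) → Dec (Free L ⟪ S ⟫)
  free? S = map′ (vec⇒free S) (free⇒vec S) (FreeVec? S)

subsets : ∀ N → List (Subset N)
subsets zero    = [] ∷ []
subsets (suc N) = map (inside ∷_) (subsets N) ++ map (outside ∷_) (subsets N)

r : TranslationInvariantForm s → ℕ → ℕ
r L N = max 0 (map ∣_∣ (filter (free? L) (subsets N)))

∈-subsets : (S : Subset N) → S List.∈ subsets N
∈-subsets []            = here refl
∈-subsets (inside  ∷ S) = ∈-++⁺ˡ (∈-map⁺ (inside ∷_) (∈-subsets S))
∈-subsets {suc N} (outside ∷ S) =
  ∈-++⁺ʳ (map (inside ∷_) (subsets N)) (∈-map⁺ (outside ∷_) (∈-subsets S))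

r-upper : (L : TranslationInvariantForm s) (S : Subset N) → Free L ⟪ S ⟫ → ∣ S ∣ ≤ r L N
r-upper L S free =
  All.lookup (xs≤max 0 _) (∈-map⁺ ∣_∣ (∈-filter⁺ (free? L) (∈-subsets S) free))

∅-free : (L : TranslationInvariantForm s) → Free L ⟪ ⊥ {N} ⟫
∅-free L x x∈∅ _ j = ⊥-elim (∉⊥ (proj₁ (proj₂ (x∈∅ j))))

r-attained : (L : TranslationInvariantForm s) (N : ℕ) →
             ∃ λ (S : Subset N) → Free L ⟪ S ⟫ × ∣ S ∣ ≡ r L N
r-attained L N with argmax-sel (λ n → n) 0 (map ∣_∣ (filter (free? L) (subsets N)))
... | inj₁ r≡0 = ⊥ , ∅-free L , trans (∣⊥∣≡0 N) (sym r≡0)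
... | inj₂ r∈  with S , S∈ , r≡∣S∣ ← ∈-map⁻ ∣_∣ r∈ =
  S , proj₂ (∈-filter⁻ (free? L) {xs = subsets N} S∈) , sym r≡∣S∣

fromℕ : ℕ → ℚᵘ
fromℕ n = + n / 1

-- m ≥ C·N^e for rational C ≥ 0, N ≥ 1 and rational e = ±p/q, with the root
-- cleared: both sides are nonnegative reals, so the inequality is equivalent
-- to the one between their q-th powers, C^q · N^{±p} ≤ m^q.
_≥[_·_^_] : ℕ → ℚᵘ → ℕ → ℚᵘ → Set
m ≥[ C · N ^ mkℚᵘ (+ p)    q-1 ] =
  (C ^ℚ suc q-1) ℚᵘ.* (fromℕ N ^ℚ p) ℚᵘ.≤ fromℕ m ^ℚ suc q-1
m ≥[ C · N ^ mkℚᵘ -[1+ p ] q-1 ] =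
  C ^ℚ suc q-1 ℚᵘ.≤ (fromℕ m ^ℚ suc q-1) ℚᵘ.* (fromℕ N ^ℚ suc p)

1/[s-1] : (s : ℕ) → 3 ≤ s → ℚᵘ
1/[s-1] (suc (suc t)) (s≤s (s≤s _)) = + 1 / suc t

{-# OPTIONS --safe #-}
module Submission where

-- Because L is primitive, its finest balanced partition refines every balanced partition.  Hence words whose
-- letters run over an L-free alphabet are L-free again: a solution gives a balanced partition in each position,
-- and the common refinement of these is coarser than the finest one, so it is balanced.  Written as digits without
-- carries, such words reduce the theorem to one finite L-free set of m points in a box of Q points with m^(s−1) > Q.
--
-- Let K be a quadratic extension of a finite field k of large characteristic and N : K → k a form of degree s − 1
-- without nontrivial zeros.  The alphabet is x ↦ (x, x², …, x^(s−2), N(x)), with |K| points in K^(s−2) × k.  If some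
-- of the x_i in a solution coincide, the Vandermonde determinant shows that it is trivial.  Otherwise x_i = α + β λ_i,
-- where λ is normalised by λ₁ = 0 and λ₂ = 1 and all moments Σ c_i λ_i^j with j ≤ s − 2 vanish.  The number of such
-- shapes λ is bounded independently of the field, so along a tower of quadratic extensions some step K/k adds no new
-- shape.  Then every λ_i lies in k, so 0 = Σ c_i N(x_i) = N(β) Σ c_i λ_i^(s−1), and Vandermonde gives a contradiction.

open import Algebra.Bundles using (CommutativeRing)
open import Algebra.Core using (Op₁; Op₂)
import Algebra.Properties.CommutativeMonoid.Sum as CommutativeMonoidSum
import Algebra.Properties.CommutativeSemiring.Exp as CommutativeSemiringExp
import Algebra.Properties.Ring as RingProperties
import Algebra.Properties.Semiring.Sum as SemiringSum
import Algebra.Solver.Ring as RingSolver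
import Algebra.Solver.Ring.AlmostCommutativeRing as ACR
open import Algebra.Structures using (IsCommutativeRing)
open import Data.Bool.Base using (Bool; true; false; if_then_else_)
open import Data.Empty using (⊥; ⊥-elim)
open import Data.Fin.Base as Fin using (Fin; toℕ)
import Data.Fin.Properties as Fin
open import Data.Fin.Subset as Subset using (Subset; ⁅_⁆; _∪_; ∣_∣) renaming (_∈_ to _∈ₛ_)
import Data.Fin.Subset.Properties as Subset
open import Data.Integer.Base as ℤ using (ℤ; 0ℤ; 1ℤ; +_)
open import Data.Integer.Divisibility.Signed as ℤ using (divides) renaming (_∣_ to _∣ℤ_)
import Data.Integer.DivMod as ℤ
import Data.Integer.Properties as ℤ
open import Data.Integer.Solver using () renaming (module +-*-Solver to ℤ-Solver)
open import Data.List.Base as List using (List; []; _∷_; length)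
open import Data.List.Membership.Propositional using (_∈_)
open import Data.List.Membership.Propositional.Properties using (∈-filter⁺; ∈-filter⁻; ∈-tabulate⁺; ∈-tabulate⁻)
import Data.List.Properties as List
open import Data.List.Relation.Unary.All using ([]; _∷_)
open import Data.List.Relation.Unary.Any using (here; there)
open import Data.Maybe.Base using (Maybe; just; nothing)
open import Data.Nat.Base as ℕ using (ℕ; zero; suc; z≤n; s≤s; _!)
import Data.Nat.Divisibility as ℕ
import Data.Nat.DivMod as ℕ
open import Data.Nat.Primality using (Prime; euclidsLemma; prime⇒nonZero; prime⇒nonTrivial)
open import Data.Nat.Primality.Factorisation using (factorise)
open import Data.Nat.ListAction using (product)
import Data.Nat.Properties as ℕ
open import Data.Nat.Solver using () renaming (module +-*-Solver to ℕ-Solver)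
open import Data.Product.Base using (∃; ∃₂; _×_; _,_; proj₁; proj₂)
open import Data.Rational.Unnormalised.Base as ℚᵘ using (ℚᵘ; mkℚᵘ; 0ℚᵘ)
open import Data.Sum.Base as Sum using (_⊎_; inj₁; inj₂; [_,_]′; reduce)
open import Data.Unit.Base using (⊤; tt)
open import Data.Vec.Base as Vec using (Vec; []; _∷_)
import Data.Vec.Functional as Vector
import Data.Vec.Functional.Properties as Vector
import Data.Vec.Properties as Vec
import Defs
open import Defs hiding (r)
open import Function.Base using (_∘_; id)
open import Function.Bundles using (mk⇔)
open import Function.Definitions using (Injective)
open import Level using (0ℓ)
import Relation.Binary.Construct.On as On
open import Relation.Binary.Definitions using (DecidableEquality)
open import Relation.Binary.PropositionalEquality
import Relation.Binary.PropositionalEquality.Properties as ≡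
open import Relation.Binary.Structures using (IsDecEquivalence)
open import Relation.Nullary using (Dec; yes; no; ¬_; contradiction)
open import Relation.Nullary.Decidable using (map′; ¬?; _×-dec_; _→-dec_; does; dec-true; dec-false; does-⇔)
open import Algebra.Definitions.RawMonoid ℤ.+-0-rawMonoid using () renaming (sum to sumℤ)
open import Algebra.Definitions.RawSemiring ℚᵘ.+-*-rawSemiring using () renaming (_^_ to _^ℚ_)

-- The full moment curve x ↦ (x, ..., x^(s-1)) over K puts |K| points in a box of |K|^(s-1), which
-- yields the exponent 1/(s-1) and nothing more. The gain comes from the last coordinate: a value in
-- k in place of one in K leaves a spare factor |k| in m^(s-1)/Q. Digits cost part of it. To add
-- without carries they are read in base Sp with S = Σ|c_i|, not in base p, which loses S^(2s-3) per
-- dimension of k over the prime field; so p is taken above S^(2s-3), and the gain then survives at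
-- every level of the tower.
--
-- The price of the cheap coordinate is that the form controls solutions only on lines over k, while
-- the moments of order at most s - 2 leave room for others. Forcing solutions onto such lines is
-- the purpose of the tower. Since p is fixed before the level is known at which the tower stops,
-- the bound on the number of shapes, and the degrees in its proof, may depend on s only. These
-- degrees must stay below p, because integers below p are the evaluation points for functions of
-- bounded degree.

Fin-injective⇒surjective : ∀ {n} (f : Fin n → Fin n) → Injective _≡_ _≡_ f → ∀ y → ∃ λ x → f x ≡ y
Fin-injective⇒surjective {suc n} f inj y with Fin.any? (λ x → f x Fin.≟ y)
... | yes hit = hit
... | no ¬hit with i , j , i<j , eq ← Fin.pigeonhole (ℕ.n<1+n n)
    (λ x → Fin.punchOut {i = y} (λ y≡fx → ¬hit (x , sym y≡fx)))
  = ⊥-elim (Fin.<⇒≢ i<j (inj (Fin.punchOut-injective {i = y} _ _ eq)))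

-- Finite fields

module _ {A : Set} {_+_ _*_ : Op₂ A} { -_ : Op₁ A} {0# 1# : A} where

  open import Algebra.Definitions {A = A} _≡_

  isCommutativeRing-≡ : Associative _+_ → Commutative _+_ → LeftIdentity 0# _+_ → LeftInverse 0# -_ _+_ →
    Associative _*_ → Commutative _*_ → LeftIdentity 1# _*_ → _*_ DistributesOverˡ _+_ →
    IsCommutativeRing _≡_ _+_ _*_ -_ 0# 1#
  isCommutativeRing-≡ +-assoc +-comm +-idˡ +-invˡ *-assoc *-comm *-idˡ distribˡ = record
    { isRing = record
      { +-isAbelianGroup = record
        { isGroup = record
          { isMonoid = record
            { isSemigroup = record
              { isMagma = record { isEquivalence = isEquivalence ; ∙-cong = cong₂ _+_ }
              ; assoc = +-assoc }
            ; identity = +-idˡ , λ x → trans (+-comm x 0#) (+-idˡ x) }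
          ; inverse = +-invˡ , λ x → trans (+-comm x _) (+-invˡ x)
          ; ⁻¹-cong = cong -_ }
        ; comm = +-comm }
      ; *-cong = cong₂ _*_
      ; *-assoc = *-assoc
      ; *-identity = *-idˡ , λ x → trans (*-comm x 1#) (*-idˡ x)
      ; distrib = distribˡ , λ x y z → trans (*-comm _ x)
          (trans (distribˡ x y z) (cong₂ _+_ (*-comm x y) (*-comm x z))) }
    ; *-comm = *-comm }

-- Large characteristic is expressed by `ι≢0`. The coordinates are natural numbers below `p`, ready
-- to serve as digits; `expand` carries integer relations between them back to the field. Inverses
-- follow from finiteness and `noZeroDivisors`.
record FiniteField (p : ℕ) : Set₁ where
  infixl 6 _+_
  infixl 7 _*_
  infix 8 -_
  field
    Carrier           : Set
    _+_ _*_           : Op₂ Carrier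
    -_                : Op₁ Carrier
    0# 1#             : Carrier
    isCommutativeRing : IsCommutativeRing _≡_ _+_ _*_ -_ 0# 1#
    noZeroDivisors    : ∀ {x y} → x * y ≡ 0# → x ≡ 0# ⊎ y ≡ 0#
    ι                 : ℤ → Carrier
    ι-+               : ∀ m n → ι (m ℤ.+ n) ≡ ι m + ι n
    ι-*               : ∀ m n → ι (m ℤ.* n) ≡ ι m * ι n
    ι-1               : ι 1ℤ ≡ 1#
    ι≢0               : ∀ {n} → n ≢ 0ℤ → ℤ.∣ n ∣ ℕ.< p → ι n ≢ 0#

  commutativeRing : CommutativeRing 0ℓ 0ℓ
  commutativeRing = record { isCommutativeRing = isCommutativeRing }

  open SemiringSum (CommutativeRing.semiring commutativeRing) using (sum) public

  field
    dim    : ℕ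
    coord  : Carrier → Fin dim → ℕ
    coord< : ∀ x l → coord x l ℕ.< p
    basis  : Fin dim → Carrier
    expand : ∀ x → x ≡ sum (λ l → ι (+ coord x l) * basis l)
    size          : ℕ
    size≡p^dim    : size ≡ p ℕ.^ dim
    index         : Carrier → Fin size
    element       : Fin size → Carrier
    element∘index : ∀ x → element (index x) ≡ x
    index∘element : ∀ i → index (element i) ≡ i

module FieldTheory {p : ℕ} (F : FiniteField p) where

  open FiniteField F public
  open CommutativeRing commutativeRing public using
    (_-_; semiring; ring; +-assoc; +-comm; *-assoc; *-comm; +-identityˡ; +-identityʳ; *-identityˡ; *-identityʳ;
        zeroˡ; zeroʳ; distribˡ; distribʳ; -‿inverseˡ; -‿inverseʳ)
  open SemiringSum semiring public using (sum-cong-≗; *-distribˡ-sum; *-distribʳ-sum; ∑-distrib-+; ∑-comm;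
      sum-replicate-zero)
  open CommutativeSemiringExp (CommutativeRing.commutativeSemiring commutativeRing) public using
      (_^_; ^-homo-*; ^-distrib-*)
  open RingProperties ring public using (+-cancelˡ; +-cancelʳ; x+x≈x⇒x≈0)

  ι-0 : ι 0ℤ ≡ 0#
  ι-0 = x+x≈x⇒x≈0 _ (sym (ι-+ 0ℤ 0ℤ))

  ι-neg : ∀ n → ι (ℤ.- n) ≡ - ι n
  ι-neg n = +-cancelˡ (ι n) _ _ (trans (sym (ι-+ n (ℤ.- n)))
      (trans (cong ι (ℤ.+-inverseʳ n)) (trans ι-0 (sym (-‿inverseʳ _)))))

  private
    almostRing = ACR.fromCommutativeRing commutativeRing

    ℤ-morphism : ℤ.+-*-rawRing ACR.-Raw-AlmostCommutative⟶ almostRing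
    ℤ-morphism = record
      { ⟦_⟧ = ι ; +-homo = ι-+ ; *-homo = ι-* ; -‿homo = ι-neg ; 0-homo = ι-0 ; 1-homo = ι-1 }

    _coeff≟_ : ∀ m n → Maybe (ι m ≡ ι n)
    m coeff≟ n with m ℤ.≟ n
    ... | yes m≡n = just (cong ι m≡n)
    ... | no  _   = nothing

  open RingSolver ℤ.+-*-rawRing almostRing ℤ-morphism _coeff≟_ public using (solve; _:=_; _:+_; _:*_; _:-_; :-_; con)

  index-injective : Injective _≡_ _≡_ index
  index-injective {x} {y} eq = trans (sym (element∘index x)) (trans (cong element eq) (element∘index y))

  element-injective : Injective _≡_ _≡_ element
  element-injective {i} {j} eq = trans (sym (index∘element i)) (trans (cong index eq) (index∘element j))

  infix 4 _≟_
  _≟_ : DecidableEquality Carrier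
  x ≟ y = map′ index-injective (cong index) (index x Fin.≟ index y)

  zero-or-not : ∀ x → x ≢ 0# ⊎ x ≡ 0#
  zero-or-not x with x ≟ 0#
  ... | no  x≢0 = inj₁ x≢0
  ... | yes x≡0 = inj₂ x≡0

  injective⇒surjective : (f : Carrier → Carrier) → Injective _≡_ _≡_ f → ∀ y → ∃ λ x → f x ≡ y
  injective⇒surjective f inj y
    with i , eq ← Fin-injective⇒surjective (index ∘ f ∘ element) (element-injective ∘ inj ∘ index-injective) (index y)
    = element i , index-injective eq

  -- If every value were taken, a choice of preimages would be an injective section, hence onto by
  -- finiteness, and `f` would be its inverse. Two existence statements rest on this: a nonsquare,
  -- and a form without nontrivial zeros.
  notInjective⇒misses : (f : Carrier → Carrier) {a b : Carrier} → a ≢ b → f a ≡ f b → ∃ λ y → ∀ x → f x ≢ y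
  notInjective⇒misses f {a} {b} a≢b fa≡fb with Fin.any? (λ i → Fin.all? (λ j → ¬? (f (element j) ≟ element i)))
  ... | yes (i , miss) = element i , λ x fx≡y → miss (index x) (trans (cong f (element∘index x)) fx≡y)
  ... | no ¬miss = contradiction (preimage-unique a b fa≡fb) a≢b
    where
    preimage : ∀ i → ∃ λ j → f (element j) ≡ element i
    preimage i with Fin.any? (λ j → f (element j) ≟ element i)
    ... | yes hit = hit
    ... | no ¬hit = ⊥-elim (¬miss (i , λ j eq → ¬hit (j , eq)))
    section = proj₁ ∘ preimage
    section-injective : Injective _≡_ _≡_ section
    section-injective {i} {j} eq = element-injective
      (trans (sym (proj₂ (preimage i))) (trans (cong (f ∘ element) eq) (proj₂ (preimage j))))
    retract : ∀ x → element (section (index (f x))) ≡ x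
    retract x with k , eq ← Fin-injective⇒surjective section section-injective (index x) =
      trans (cong (element ∘ section ∘ index) fx≡)
          (trans (cong (element ∘ section) (index∘element k)) (trans (cong element eq) (element∘index x)))
      where
      fx≡ : f x ≡ element k
      fx≡ = trans (cong f (sym (trans (cong element eq) (element∘index x)))) (proj₂ (preimage k))
    preimage-unique : ∀ x y → f x ≡ f y → x ≡ y
    preimage-unique x y eq = trans (sym (retract x)) (trans (cong (element ∘ section ∘ index) eq) (retract y))

  1≢0 : 1 ℕ.< p → 1# ≢ 0#
  1≢0 1<p 1≡0 = ι≢0 {1ℤ} (λ ()) 1<p (trans ι-1 1≡0)

  x-y≡0⇒x≡y : ∀ {x y} → x - y ≡ 0# → x ≡ y
  x-y≡0⇒x≡y {x} {y} eq = trans (solve 2 (λ a b → a := (a :- b) :+ b) refl x y) (trans (cong (_+ y) eq) (+-identityˡ y))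

  *-cancelˡ : ∀ {a x y} → a ≢ 0# → a * x ≡ a * y → x ≡ y
  *-cancelˡ {a} {x} {y} a≢0 eq = [ (λ a≡0 → contradiction a≡0 a≢0) , x-y≡0⇒x≡y ]′ (noZeroDivisors
    (trans (solve 3 (λ a b c → a :* (b :- c) := a :* b :- a :* c) refl a x y)
        (trans (cong (_- a * y) eq) (-‿inverseʳ _))))

  *≢0 : ∀ {x y} → x ≢ 0# → y ≢ 0# → x * y ≢ 0#
  *≢0 x≢0 y≢0 eq with noZeroDivisors eq
  ... | inj₁ x≡0 = x≢0 x≡0
  ... | inj₂ y≡0 = y≢0 y≡0

  inverse : ∀ {x} → x ≢ 0# → ∃ λ y → x * y ≡ 1#
  inverse {x} x≢0 = injective⇒surjective (x *_) (*-cancelˡ x≢0) 1#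

  1^ : ∀ n → 1# ^ n ≡ 1#
  1^ zero    = refl
  1^ (suc n) = trans (*-identityˡ _) (1^ n)

  ^≢0 : 1 ℕ.< p → ∀ {x} n → x ≢ 0# → x ^ n ≢ 0#
  ^≢0 1<p zero    x≢0 = 1≢0 1<p
  ^≢0 1<p (suc n) x≢0 = *≢0 x≢0 (^≢0 1<p n x≢0)

  ι-injective : ∀ {m n} → m ℕ.< p → n ℕ.< p → ι (+ m) ≡ ι (+ n) → m ≡ n
  ι-injective {m} {n} m<p n<p eq with m ℕ.≟ n
  ... | yes m≡n = m≡n
  ... | no  m≢n = ⊥-elim (ι≢0 {+ m ℤ.- + n} (m≢n ∘ ℤ.+-injective ∘ ℤ.i-j≡0⇒i≡j (+ m) (+ n)) bound
      (trans (ι-+ (+ m) (ℤ.- + n)) (trans (cong (λ u → ι (+ m) + u) (ι-neg (+ n)))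
          (trans (cong (_- ι (+ n)) eq) (-‿inverseʳ _)))))
    where
    bound : ℤ.∣ + m ℤ.- + n ∣ ℕ.< p
    bound = ℕ.≤-<-trans (ℕ.≤-trans (ℕ.≤-reflexive (cong ℤ.∣_∣ (ℤ.m-n≡m⊖n m n))) (ℤ.∣m⊝n∣≤m⊔n m n)) (ℕ.⊔-pres-<m m<p n<p)

  sum-zero : ∀ {n} {f : Fin n → Carrier} → (∀ i → f i ≡ 0#) → sum f ≡ 0#
  sum-zero {n} f≗0 = trans (sum-cong-≗ f≗0) (sum-replicate-zero n)

  sum-++ : ∀ m {n} (f : Fin (m ℕ.+ n) → Carrier) → sum f ≡ sum (λ i → f (i Fin.↑ˡ n)) + sum (λ i → f (m Fin.↑ʳ i))
  sum-++ zero    f = sym (+-identityˡ _)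
  sum-++ (suc m) f = trans (cong (λ u → f Fin.zero + u) (sum-++ m (f ∘ Fin.suc))) (sym (+-assoc _ _ _))

  ι-sum : ∀ {n} (f : Fin n → ℤ) → ι (sumℤ f) ≡ sum (ι ∘ f)
  ι-sum {zero}  f = ι-0
  ι-sum {suc n} f = trans (ι-+ _ _) (cong (λ u → ι (f Fin.zero) + u) (ι-sum (f ∘ Fin.suc)))

multiple<⇒≡0 : ∀ {p z} → + p ∣ℤ z → ℤ.∣ z ∣ ℕ.< p → z ≡ 0ℤ
multiple<⇒≡0 {p} {z} p∣z z<p with ℤ.∣ z ∣ in eq | ℤ.∣⇒∣ᵤ p∣z
... | zero  | _    = ℤ.∣i∣≡0⇒i≡0 eq
... | suc _ | p∣∣z∣ = contradiction (ℕ.∣⇒≤ p∣∣z∣) (ℕ.<⇒≱ z<p)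

module PrimeField (p : ℕ) (p-prime : Prime p) where

  private
    instance
      p≢0 = prime⇒nonZero p-prime

    ι : ℤ → Fin p
    ι n = Fin.fromℕ< (ℤ.n%ℕd<d n p)

    τ : Fin p → ℤ
    τ a = + toℕ a

    ι-rem : ∀ n → + p ∣ℤ n ℤ.- τ (ι n)
    ι-rem n = divides (n ℤ./ℕ p) (begin
      n ℤ.- τ (ι n)                                     ≡⟨ cong (λ u → n ℤ.- + u) (Fin.toℕ-fromℕ< (ℤ.n%ℕd<d n p)) ⟩
      n ℤ.- + (n ℤ.%ℕ p)                                ≡⟨ cong (ℤ._- + (n ℤ.%ℕ p)) (ℤ.a≡a%ℕn+[a/ℕn]*n n p) ⟩
      + (n ℤ.%ℕ p) ℤ.+ (n ℤ./ℕ p) ℤ.* + p ℤ.- + (n ℤ.%ℕ p) ≡⟨ solve 2 (λ a b → a :+ b :- a := b) refl (+ (n ℤ.%ℕ p)) _ ⟩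
      (n ℤ./ℕ p) ℤ.* + p                                ∎)
      where
      open ≡-Reasoning
      open ℤ-Solver

    τ-injective-mod : ∀ {a b} → + p ∣ℤ τ a ℤ.- τ b → a ≡ b
    τ-injective-mod {a} {b} p∣ = Fin.toℕ-injective (ℤ.+-injective (ℤ.i-j≡0⇒i≡j (τ a) (τ b) (multiple<⇒≡0 p∣
      (ℕ.≤-<-trans (ℕ.≤-trans (ℕ.≤-reflexive (cong ℤ.∣_∣ (ℤ.m-n≡m⊖n (toℕ a) (toℕ b)))) (ℤ.∣m⊝n∣≤m⊔n (toℕ a) (toℕ b)))
        (ℕ.⊔-pres-<m (Fin.toℕ<n a) (Fin.toℕ<n b))))))

    ι-cong-mod : ∀ m n → + p ∣ℤ m ℤ.- n → ι m ≡ ι n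
    ι-cong-mod m n p∣ = τ-injective-mod (subst (+ p ∣ℤ_)
      (ℤ-Solver.solve 4 (λ m n a b → (m :- n) :- ((m :- a) :- (n :- b)) := a :- b) refl m n (τ (ι m)) (τ (ι n)))
      (ℤ.∣m∣n⇒∣m-n p∣ (ℤ.∣m∣n⇒∣m-n (ι-rem m) (ι-rem n))))
      where open ℤ-Solver

    ι-injective-mod : ∀ m n → ι m ≡ ι n → + p ∣ℤ m ℤ.- n
    ι-injective-mod m n eq = subst (+ p ∣ℤ_)
      (trans (cong (λ a → (m ℤ.- τ (ι m)) ℤ.- (n ℤ.- τ a)) (sym eq))
        (ℤ-Solver.solve 3 (λ m n a → (m :- a) :- (n :- a) := m :- n) refl m n (τ (ι m))))
      (ℤ.∣m∣n⇒∣m-n (ι-rem m) (ι-rem n))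
      where open ℤ-Solver

    ι∘τ : ∀ a → ι (τ a) ≡ a
    ι∘τ a = sym (τ-injective-mod (ι-rem (τ a)))

    infixl 6 _+_
    infixl 7 _*_
    _+_ _*_ : Op₂ (Fin p)
    a + b = ι (τ a ℤ.+ τ b)
    a * b = ι (τ a ℤ.* τ b)

    -_ : Op₁ (Fin p)
    - a = ι (ℤ.- τ a)

    ι-+ : ∀ m n → ι (m ℤ.+ n) ≡ ι m + ι n
    ι-+ m n = ι-cong-mod (m ℤ.+ n) (τ (ι m) ℤ.+ τ (ι n)) (subst (+ p ∣ℤ_)
      (ℤ-Solver.solve 4 (λ m n a b → (m :- a) :+ (n :- b) := (m :+ n) :- (a :+ b)) refl m n (τ (ι m)) (τ (ι n)))
      (ℤ.∣m∣n⇒∣m+n (ι-rem m) (ι-rem n)))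
      where open ℤ-Solver

    ι-* : ∀ m n → ι (m ℤ.* n) ≡ ι m * ι n
    ι-* m n = ι-cong-mod (m ℤ.* n) (τ (ι m) ℤ.* τ (ι n)) (subst (+ p ∣ℤ_)
      (ℤ-Solver.solve 4 (λ m n a b → n :* (m :- a) :+ a :* (n :- b) := (m :* n) :- (a :* b)) refl m n (τ (ι m))
          (τ (ι n)))
      (ℤ.∣m∣n⇒∣m+n (ℤ.∣n⇒∣m*n n (ι-rem m)) (ℤ.∣n⇒∣m*n (τ (ι m)) (ι-rem n))))
      where open ℤ-Solver

    ι-neg : ∀ m → ι (ℤ.- m) ≡ - ι m
    ι-neg m = ι-cong-mod (ℤ.- m) (ℤ.- τ (ι m)) (subst (+ p ∣ℤ_)
      (ℤ-Solver.solve 2 (λ m a → :- (m :- a) := (:- m) :- (:- a)) refl m (τ (ι m)))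
      (ℤ.∣m⇒∣-m (ι-rem m)))
      where open ℤ-Solver

    -- Every element is the residue of an integer, so a ring law need only be checked on residues,
    -- where it is a law of the integers.
    lift₁ : {P : Fin p → Set} → (∀ x → P (ι x)) → ∀ a → P a
    lift₁ {P} h a = subst P (ι∘τ a) (h (τ a))

    lift₂ : {P : Fin p → Fin p → Set} → (∀ x y → P (ι x) (ι y)) → ∀ a b → P a b
    lift₂ h = lift₁ (λ x → lift₁ (h x))

    lift₃ : {P : Fin p → Fin p → Fin p → Set} → (∀ x y z → P (ι x) (ι y) (ι z)) → ∀ a b c → P a b c
    lift₃ h = lift₁ (λ x → lift₂ (h x))

    +-assoc : ∀ a b c → (a + b) + c ≡ a + (b + c)
    +-assoc = lift₃ λ x y z → begin
      ι x + ι y + ι z       ≡⟨ cong (_+ ι z) (ι-+ x y) ⟨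
      ι (x ℤ.+ y) + ι z     ≡⟨ ι-+ (x ℤ.+ y) z ⟨
      ι (x ℤ.+ y ℤ.+ z)     ≡⟨ cong ι (ℤ.+-assoc x y z) ⟩
      ι (x ℤ.+ (y ℤ.+ z))   ≡⟨ ι-+ x (y ℤ.+ z) ⟩
      ι x + ι (y ℤ.+ z)     ≡⟨ cong (λ u → ι x + u) (ι-+ y z) ⟩
      ι x + (ι y + ι z)     ∎
      where open ≡-Reasoning

    *-assoc : ∀ a b c → (a * b) * c ≡ a * (b * c)
    *-assoc = lift₃ λ x y z → begin
      ι x * ι y * ι z       ≡⟨ cong (_* ι z) (ι-* x y) ⟨
      ι (x ℤ.* y) * ι z     ≡⟨ ι-* (x ℤ.* y) z ⟨
      ι (x ℤ.* y ℤ.* z)     ≡⟨ cong ι (ℤ.*-assoc x y z) ⟩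
      ι (x ℤ.* (y ℤ.* z))   ≡⟨ ι-* x (y ℤ.* z) ⟩
      ι x * ι (y ℤ.* z)     ≡⟨ cong (ι x *_) (ι-* y z) ⟩
      ι x * (ι y * ι z)     ∎
      where open ≡-Reasoning

    distribˡ : ∀ a b c → a * (b + c) ≡ a * b + a * c
    distribˡ = lift₃ λ x y z → begin
      ι x * (ι y + ι z)             ≡⟨ cong (ι x *_) (ι-+ y z) ⟨
      ι x * ι (y ℤ.+ z)             ≡⟨ ι-* x (y ℤ.+ z) ⟨
      ι (x ℤ.* (y ℤ.+ z))           ≡⟨ cong ι (ℤ.*-distribˡ-+ x y z) ⟩
      ι (x ℤ.* y ℤ.+ x ℤ.* z)       ≡⟨ ι-+ (x ℤ.* y) (x ℤ.* z) ⟩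
      ι (x ℤ.* y) + ι (x ℤ.* z)     ≡⟨ cong₂ _+_ (ι-* x y) (ι-* x z) ⟩
      ι x * ι y + ι x * ι z         ∎
      where open ≡-Reasoning

    ι≡0⇒∣ : ∀ m → ι m ≡ ι 0ℤ → + p ∣ℤ m
    ι≡0⇒∣ m eq = subst (+ p ∣ℤ_) (ℤ.+-identityʳ m) (ι-injective-mod m 0ℤ eq)

    ∣⇒≡0 : ∀ a → p ℕ.∣ toℕ a → a ≡ ι 0ℤ
    ∣⇒≡0 a p∣a = trans (sym (ι∘τ a)) (ι-cong-mod (τ a) 0ℤ (subst (+ p ∣ℤ_) (sym (ℤ.+-identityʳ (τ a))) (ℤ.∣ᵤ⇒∣ p∣a)))

    noZeroDivisors : ∀ {a b} → a * b ≡ ι 0ℤ → a ≡ ι 0ℤ ⊎ b ≡ ι 0ℤ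
    noZeroDivisors {a} {b} eq = Sum.map (∣⇒≡0 a) (∣⇒≡0 b) (euclidsLemma (toℕ a) (toℕ b) p-prime
      (subst (p ℕ.∣_) (ℤ.abs-* (τ a) (τ b)) (ℤ.∣⇒∣ᵤ (ι≡0⇒∣ (τ a ℤ.* τ b) eq))))

    isCommutativeRing : IsCommutativeRing _≡_ _+_ _*_ -_ (ι 0ℤ) (ι 1ℤ)
    isCommutativeRing = isCommutativeRing-≡
      +-assoc
      (λ a b → cong ι (ℤ.+-comm (τ a) (τ b)))
      (lift₁ λ x → trans (sym (ι-+ 0ℤ x)) (cong ι (ℤ.+-identityˡ x)))
      (lift₁ λ x → trans (cong (_+ ι x) (sym (ι-neg x))) (trans (sym (ι-+ (ℤ.- x) x)) (cong ι (ℤ.+-inverseˡ x))))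
      *-assoc
      (λ a b → cong ι (ℤ.*-comm (τ a) (τ b)))
      (lift₁ λ x → trans (sym (ι-* 1ℤ x)) (cong ι (ℤ.*-identityˡ x)))
      distribˡ

  primeField : FiniteField p
  primeField = record
    { isCommutativeRing = isCommutativeRing
    ; noZeroDivisors = noZeroDivisors
    ; ι = ι
    ; ι-+ = ι-+
    ; ι-* = ι-*
    ; ι-1 = refl
    ; ι≢0 = λ {n} n≢0 ∣n∣<p ιn≡0 → n≢0 (multiple<⇒≡0 (ι≡0⇒∣ n ιn≡0) ∣n∣<p)
    ; dim = 1
    ; coord = λ a _ → toℕ a
    ; coord< = λ a _ → Fin.toℕ<n a
    ; basis = λ _ → ι 1ℤ
    ; expand = λ a → sym (trans (+-identityʳ _) (trans (*-identityʳ _) (ι∘τ a)))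
    ; size = p
    ; size≡p^dim = sym (ℕ.*-identityʳ p)
    ; index = id
    ; element = id
    ; element∘index = λ _ → refl
    ; index∘element = λ _ → refl
    }
    where open IsCommutativeRing isCommutativeRing using (+-identityʳ; *-identityʳ)

-- Quadratic extensions

record QuadraticExtension {p : ℕ} (k : FiniteField p) : Set₁ where
  private module k = FieldTheory k
  field
    K : FiniteField p
  private module K = FieldTheory K
  field
    embed           : k.Carrier → K.Carrier
    embed-+         : ∀ a b → embed (a k.+ b) ≡ embed a K.+ embed b
    embed-*         : ∀ a b → embed (a k.* b) ≡ embed a K.* embed b
    embed-ι         : ∀ n → embed (k.ι n) ≡ K.ι n
    re im           : K.Carrier → k.Carrier
    re-embed        : ∀ a → re (embed a) ≡ a
    im-embed        : ∀ a → im (embed a) ≡ k.0#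
    re-affine       : ∀ x t y → re (x K.+ embed t K.* y) ≡ re x k.+ t k.* re y
    im-affine       : ∀ x t y → im (x K.+ embed t K.* y) ≡ im x k.+ t k.* im y
    re-im-injective : ∀ {x y} → re x ≡ re y → im x ≡ im y → x ≡ y
    dim-K           : K.dim ≡ k.dim ℕ.+ k.dim

  embed-0 : embed k.0# ≡ K.0#
  embed-0 = trans (cong embed (sym k.ι-0)) (trans (embed-ι 0ℤ) K.ι-0)

  embed-^ : ∀ a j → embed (a k.^ j) ≡ embed a K.^ j
  embed-^ a zero    = trans (cong embed (sym k.ι-1)) (trans (embed-ι 1ℤ) K.ι-1)
  embed-^ a (suc j) = trans (embed-* a (a k.^ j)) (cong (embed a K.*_) (embed-^ a j))

  embed-sum : ∀ {m} (f : Fin m → k.Carrier) → embed (k.sum f) ≡ K.sum (embed ∘ f)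
  embed-sum {zero}  f = embed-0
  embed-sum {suc m} f = trans (embed-+ _ _) (cong (λ u → embed (f Fin.zero) K.+ u) (embed-sum (f ∘ Fin.suc)))

  embed-injective : ∀ {a b} → embed a ≡ embed b → a ≡ b
  embed-injective {a} {b} eq = trans (sym (re-embed a)) (trans (cong re eq) (re-embed b))

  im≡0⇒embed-re : ∀ {x} → im x ≡ k.0# → x ≡ embed (re x)
  im≡0⇒embed-re {x} im≡0 = re-im-injective (sym (re-embed (re x))) (trans im≡0 (sym (im-embed (re x))))

  re≡0,im≡0⇒≡0 : ∀ {x} → re x ≡ k.0# → im x ≡ k.0# → x ≡ K.0#
  re≡0,im≡0⇒≡0 re≡0 im≡0 = trans (im≡0⇒embed-re im≡0) (trans (cong embed re≡0) embed-0)

module Quadratic {p : ℕ} (2<p : 2 ℕ.< p) (F : FiniteField p) where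

  open FieldTheory F

  private
    embed : Carrier → Carrier × Carrier
    embed a = a , 0#

    1≢-1 : 1# ≢ - 1#
    1≢-1 eq = ι≢0 {+ 2} (λ ()) 2<p (trans (ι-+ 1ℤ 1ℤ) (trans (cong₂ _+_ ι-1 (trans ι-1 eq)) (-‿inverseʳ 1#)))

    -- As 2 < p, the distinct elements 1 and -1 have the same square, so squaring is not onto.
    nonSquare : ∃ λ n → ∀ x → x * x ≢ n
    nonSquare = notInjective⇒misses (λ x → x * x) 1≢-1 (solve 1 (λ a → a :* a := (:- a) :* (:- a)) refl 1#)

    n = proj₁ nonSquare

    Carrier² = Carrier × Carrier

    infixl 6 _⊕_
    infixl 7 _⊗_
    _⊕_ _⊗_ : Op₂ Carrier²
    (a , b) ⊕ (c , d) = a + c , b + d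
    (a , b) ⊗ (c , d) = a * c + n * (b * d) , a * d + b * c

    ⊖_ : Op₁ Carrier²
    ⊖ (a , b) = - a , - b

    isCommutativeRing² : IsCommutativeRing _≡_ _⊕_ _⊗_ ⊖_ (embed 0#) (embed 1#)
    isCommutativeRing² = isCommutativeRing-≡
      (λ _ _ _ → cong₂ _,_ (+-assoc _ _ _) (+-assoc _ _ _))
      (λ _ _ → cong₂ _,_ (+-comm _ _) (+-comm _ _))
      (λ _ → cong₂ _,_ (+-identityˡ _) (+-identityˡ _))
      (λ _ → cong₂ _,_ (-‿inverseˡ _) (-‿inverseˡ _))
      (λ (a , b) (c , d) (e , f) → cong₂ _,_
        (solve 7 (λ n a b c d e f → (a :* c :+ n :* (b :* d)) :* e :+ n :* ((a :* d :+ b :* c) :* f)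
                   := a :* (c :* e :+ n :* (d :* f)) :+ n :* (b :* (c :* f :+ d :* e))) refl n a b c d e f)
        (solve 7 (λ n a b c d e f → (a :* c :+ n :* (b :* d)) :* f :+ (a :* d :+ b :* c) :* e
                   := a :* (c :* f :+ d :* e) :+ b :* (c :* e :+ n :* (d :* f))) refl n a b c d e f))
      (λ (a , b) (c , d) → cong₂ _,_
        (solve 5 (λ n a b c d → a :* c :+ n :* (b :* d) := c :* a :+ n :* (d :* b)) refl n a b c d)
        (solve 5 (λ n a b c d → a :* d :+ b :* c := c :* b :+ d :* a) refl n a b c d))
      (λ (a , b) → cong₂ _,_
        (trans (cong₂ _+_ (*-identityˡ a) (trans (cong (n *_) (zeroˡ b)) (zeroʳ n))) (+-identityʳ a))
        (trans (cong₂ _+_ (*-identityˡ b) (zeroˡ a)) (+-identityʳ b)))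
      (λ (a , b) (c , d) (e , f) → cong₂ _,_
        (solve 7 (λ n a b c d e f → a :* (c :+ e) :+ n :* (b :* (d :+ f))
                   := (a :* c :+ n :* (b :* d)) :+ (a :* e :+ n :* (b :* f))) refl n a b c d e f)
        (solve 7 (λ n a b c d e f → a :* (d :+ f) :+ b :* (c :+ e)
                   := (a :* d :+ b :* c) :+ (a :* f :+ b :* e)) refl n a b c d e f))

    zero-lemma : ∀ u v w → u * 0# - v * (w * 0#) ≡ 0#
    zero-lemma u v w = trans (cong (λ z → u * z - v * (w * z)) (sym ι-0))
      (trans (solve 3 (λ u v w → u :* con 0ℤ :- v :* (w :* con 0ℤ) := con 0ℤ) refl u v w) ι-0)

    square-free : ∀ a b → b ≢ 0# → a * a - n * (b * b) ≢ 0#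
    square-free a b b≢0 eq = proj₂ nonSquare (a * b⁻¹) (begin
      (a * b⁻¹) * (a * b⁻¹)
        ≡⟨ solve 4 (λ n a b c → (a :* c) :* (a :* c) := (a :* a :- n :* (b :* b)) :* (c :* c) :+ n :*
            ((b :* c) :* (b :* c))) refl n a b b⁻¹ ⟩
      (a * a - n * (b * b)) * (b⁻¹ * b⁻¹) + n * ((b * b⁻¹) * (b * b⁻¹))
        ≡⟨ cong₂ _+_ (trans (cong (_* (b⁻¹ * b⁻¹)) eq) (zeroˡ _))
            (cong (n *_) (trans (cong₂ _*_ bb⁻¹≡1 bb⁻¹≡1) (*-identityˡ 1#))) ⟩
      0# + n * 1# ≡⟨ trans (+-identityˡ _) (*-identityʳ n) ⟩
      n ∎)
      where
      open ≡-Reasoning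
      b⁻¹ = proj₁ (inverse b≢0)
      bb⁻¹≡1 = proj₂ (inverse b≢0)

    norm≡0 : ∀ a b → a * a - n * (b * b) ≡ 0# → (a , b) ≡ embed 0#
    norm≡0 a b eq = [ (λ b≢0 → contradiction eq (square-free a b b≢0)) ,
        (λ b≡0 → cong₂ _,_ (reduce (noZeroDivisors (a*a≡0 b≡0))) b≡0) ]′ (zero-or-not b)
      where
      a*a≡0 : b ≡ 0# → a * a ≡ 0#
      a*a≡0 b≡0 = begin
        a * a
            ≡⟨ solve 3 (λ n a b → a :* a := (a :* a :- n :* (b :* b)) :+ n :* (b :* b)) refl n a b ⟩
        (a * a - n * (b * b)) + n * (b * b)       ≡⟨ cong₂ _+_ eq (cong (λ z → n * (b * z)) b≡0) ⟩
        0# + n * (b * 0#)                         ≡⟨ trans (+-identityˡ _) (trans (cong (n *_) (zeroʳ b)) (zeroʳ n)) ⟩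
        0#                                        ∎
        where open ≡-Reasoning

    conjugate₁ : ∀ a b c d → (a * a - n * (b * b)) * c ≡ a * (a * c + n * (b * d)) - n * (b * (a * d + b * c))
    conjugate₁ = solve 5 (λ n a b c d → (a :* a :- n :* (b :* b)) :* c := a :* (a :* c :+ n :* (b :* d)) :- n :*
        (b :* (a :* d :+ b :* c))) refl n

    conjugate₂ : ∀ a b c d → (a * a - n * (b * b)) * d ≡ a * (a * d + b * c) - 1# * (b * (a * c + n * (b * d)))
    conjugate₂ a b c d = trans (solve 5 (λ n a b c d → (a :* a :- n :* (b :* b)) :* d := a :* (a :* d :+ b :* c) :-
        b :* (a :* c :+ n :* (b :* d))) refl n a b c d)
      (cong (λ u → a * (a * d + b * c) - u) (sym (*-identityˡ _)))

    -- Multiplication by the conjugate a − b√n.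
    noZeroDivisors² : ∀ {x y} → x ⊗ y ≡ embed 0# → x ≡ embed 0# ⊎ y ≡ embed 0#
    noZeroDivisors² {a , b} {c , d} eq = [ inj₂ ∘ y≡0 , inj₁ ∘ norm≡0 a b ]′ (zero-or-not (a * a - n * (b * b)))
      where
      y≡0 : a * a - n * (b * b) ≢ 0# → (c , d) ≡ embed 0#
      y≡0 N≢0 = cong₂ _,_
        (cancel (trans (conjugate₁ a b c d) (trans
            (cong₂ (λ u v → a * u - n * (b * v)) (cong proj₁ eq) (cong proj₂ eq)) (zero-lemma a n b))))
        (cancel (trans (conjugate₂ a b c d) (trans
            (cong₂ (λ u v → a * v - 1# * (b * u)) (cong proj₁ eq) (cong proj₂ eq)) (zero-lemma a 1# b))))
        where
        cancel : ∀ {z} → (a * a - n * (b * b)) * z ≡ 0# → z ≡ 0#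
        cancel Nz≡0 = [ (λ N≡0 → contradiction N≡0 N≢0) , id ]′ (noZeroDivisors Nz≡0)

    commutativeRing² : CommutativeRing 0ℓ 0ℓ
    commutativeRing² = record { isCommutativeRing = isCommutativeRing² }

    open SemiringSum (CommutativeRing.semiring commutativeRing²) using () renaming (sum to sum²)

    proj₁-sum : ∀ {m} (f : Fin m → Carrier²) → proj₁ (sum² f) ≡ sum (proj₁ ∘ f)
    proj₁-sum {zero}  f = refl
    proj₁-sum {suc m} f = cong (λ u → proj₁ (f Fin.zero) + u) (proj₁-sum (f ∘ Fin.suc))

    proj₂-sum : ∀ {m} (f : Fin m → Carrier²) → proj₂ (sum² f) ≡ sum (proj₂ ∘ f)
    proj₂-sum {zero}  f = refl
    proj₂-sum {suc m} f = cong (λ u → proj₂ (f Fin.zero) + u) (proj₂-sum (f ∘ Fin.suc))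

    coord² : Carrier² → Fin (dim ℕ.+ dim) → ℕ
    coord² (a , b) = coord a Vector.++ coord b

    basis² : Fin (dim ℕ.+ dim) → Carrier²
    basis² = (λ l → basis l , 0#) Vector.++ (λ l → 0# , basis l)

    coord²< : ∀ x l → coord² x l ℕ.< p
    coord²< (a , b) l with Fin.splitAt dim l
    ... | inj₁ l′ = coord< a l′
    ... | inj₂ l′ = coord< b l′

    expand² : ∀ x → x ≡ sum² (λ l → embed (ι (+ coord² x l)) ⊗ basis² l)
    expand² x@(a , b) = cong₂ _,_
      (trans (expand a) (sym (trans (proj₁-sum f) (trans (sum-++ dim (proj₁ ∘ f))
        (trans (cong₂ _+_ (sum-cong-≗ left₁) (sum-zero right₁)) (+-identityʳ _))))))
      (trans (expand b) (sym (trans (proj₂-sum f) (trans (sum-++ dim (proj₂ ∘ f))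
        (trans (cong₂ _+_ (sum-zero left₂) (sum-cong-≗ right₂)) (+-identityˡ _))))))
      where
      f : Fin (dim ℕ.+ dim) → Carrier²
      f l = embed (ι (+ coord² x l)) ⊗ basis² l
      fˡ : ∀ l → f (l Fin.↑ˡ dim) ≡ embed (ι (+ coord a l)) ⊗ (basis l , 0#)
      fˡ l = cong₂ (λ u v → embed (ι (+ u)) ⊗ v) (Vector.lookup-++ˡ (coord a) (coord b) l)
          (Vector.lookup-++ˡ (λ l → basis l , 0#) (λ l → 0# , basis l) l)
      fʳ : ∀ l → f (dim Fin.↑ʳ l) ≡ embed (ι (+ coord b l)) ⊗ (0# , basis l)
      fʳ l = cong₂ (λ u v → embed (ι (+ u)) ⊗ v) (Vector.lookup-++ʳ (coord a) (coord b) l)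
          (Vector.lookup-++ʳ (λ l → basis l , 0#) (λ l → 0# , basis l) l)
      n0 : ∀ u → n * (0# * u) ≡ 0#
      n0 u = trans (cong (n *_) (zeroˡ u)) (zeroʳ n)
      left₁ : ∀ l → proj₁ (f (l Fin.↑ˡ dim)) ≡ ι (+ coord a l) * basis l
      left₁ l = trans (cong proj₁ (fˡ l)) (trans (cong (λ u → ι (+ coord a l) * basis l + u) (n0 0#)) (+-identityʳ _))
      left₂ : ∀ l → proj₂ (f (l Fin.↑ˡ dim)) ≡ 0#
      left₂ l = trans (cong proj₂ (fˡ l)) (trans (cong₂ _+_ (zeroʳ _) (zeroˡ _)) (+-identityˡ 0#))
      right₁ : ∀ l → proj₁ (f (dim Fin.↑ʳ l)) ≡ 0#
      right₁ l = trans (cong proj₁ (fʳ l)) (trans (cong₂ _+_ (zeroʳ _) (n0 _)) (+-identityˡ 0#))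
      right₂ : ∀ l → proj₂ (f (dim Fin.↑ʳ l)) ≡ ι (+ coord b l) * basis l
      right₂ l = trans (cong proj₂ (fʳ l)) (trans (cong (λ u → ι (+ coord b l) * basis l + u) (zeroˡ 0#))
          (+-identityʳ _))

    embed-⊗ : ∀ t a b → embed t ⊗ (a , b) ≡ (t * a , t * b)
    embed-⊗ t a b = cong₂ _,_
      (trans (cong (λ u → t * a + u) (trans (cong (n *_) (zeroˡ b)) (zeroʳ n))) (+-identityʳ _))
      (trans (cong (λ u → t * b + u) (zeroˡ a)) (+-identityʳ _))

    embed-⊗-embed : ∀ a b → embed (a * b) ≡ embed a ⊗ embed b
    embed-⊗-embed a b = sym (trans (embed-⊗ a b 0#) (cong (a * b ,_) (zeroʳ a)))

    extension : FiniteField p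
    extension = record
      { Carrier = Carrier²
      ; isCommutativeRing = isCommutativeRing²
      ; noZeroDivisors = noZeroDivisors²
      ; ι = embed ∘ ι
      ; ι-+ = λ m n → cong₂ _,_ (ι-+ m n) (sym (+-identityˡ 0#))
      ; ι-* = λ m n → trans (cong embed (ι-* m n)) (embed-⊗-embed _ _)
      ; ι-1 = cong embed ι-1
      ; ι≢0 = λ m≢0 ∣m∣<p eq → ι≢0 m≢0 ∣m∣<p (cong proj₁ eq)
      ; dim = dim ℕ.+ dim
      ; coord = coord²
      ; coord< = coord²<
      ; basis = basis²
      ; expand = expand²
      ; size = size ℕ.* size
      ; size≡p^dim = trans (cong₂ ℕ._*_ size≡p^dim size≡p^dim) (sym (ℕ.^-distribˡ-+-* p dim dim))
      ; index = λ (a , b) → Fin.combine (index a) (index b)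
      ; element = λ i → element (proj₁ (Fin.remQuot {size} size i)) , element (proj₂ (Fin.remQuot {size} size i))
      ; element∘index = λ (a , b) → trans (cong (λ ij → element (proj₁ ij) , element (proj₂ ij))
          (Fin.remQuot-combine (index a) (index b)))
          (cong₂ _,_ (element∘index a) (element∘index b))
      ; index∘element = λ i → trans (cong₂ Fin.combine (index∘element _) (index∘element _))
          (Fin.combine-remQuot {size} size i)
      }

  quadraticExtension : QuadraticExtension F
  quadraticExtension = record
    { K = extension
    ; embed = embed
    ; embed-+ = λ a b → cong (a + b ,_) (sym (+-identityˡ 0#))
    ; embed-* = embed-⊗-embed
    ; embed-ι = λ _ → refl
    ; re = proj₁
    ; im = proj₂
    ; re-embed = λ _ → refl
    ; im-embed = λ _ → refl
    ; re-affine = λ x t y → cong (λ u → proj₁ x + proj₁ u) (embed-⊗ t (proj₁ y) (proj₂ y))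
    ; im-affine = λ x t y → cong (λ u → proj₂ x + proj₂ u) (embed-⊗ t (proj₁ y) (proj₂ y))
    ; re-im-injective = cong₂ _,_
    ; dim-K = refl
    }

-- Polynomial functions and linear algebra

module Polynomials {p : ℕ} (F : FiniteField p) where

  open FieldTheory F public

  -- Poly n c φ: φ is a polynomial function of degree at most n whose coefficient of tⁿ is c.
  data Poly : ℕ → Carrier → (Carrier → Carrier) → Set where
    constant : ∀ {c φ} → (∀ t → φ t ≡ c) → Poly 0 c φ
    horner   : ∀ {n c φ} a ψ → Poly n c ψ → (∀ t → φ t ≡ a + t * ψ t) → Poly (suc n) c φ

  Deg≤ : ℕ → (Carrier → Carrier) → Set
  Deg≤ n φ = ∃ λ c → Poly n c φ

  poly-cong : ∀ {n c d φ ψ} → c ≡ d → (∀ t → φ t ≡ ψ t) → Poly n c φ → Poly n d ψ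
  poly-cong refl φ≗ψ (constant eq)     = constant (λ t → trans (sym (φ≗ψ t)) (eq t))
  poly-cong refl φ≗ψ (horner a ψ P eq) = horner a ψ P (λ t → trans (sym (φ≗ψ t)) (eq t))

  poly-raise : ∀ {n c φ} → Poly n c φ → Poly (suc n) 0# φ
  poly-raise (constant {c} eq) = horner c (λ _ → 0#) (constant λ _ → refl)
    (λ t → trans (eq t) (sym (trans (cong (λ u → c + u) (zeroʳ t)) (+-identityʳ c))))
  poly-raise (horner a ψ P eq) = horner a ψ (poly-raise P) eq

  poly-raise⁺ : ∀ {n c φ} k → Poly n c φ → Poly (suc k ℕ.+ n) 0# φ
  poly-raise⁺ zero    P = poly-raise P
  poly-raise⁺ (suc k) P = poly-raise (poly-raise⁺ k P)

  poly-+ : ∀ {n c d φ ψ} → Poly n c φ → Poly n d ψ → Poly n (c + d) (λ t → φ t + ψ t)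
  poly-+ (constant eq) (constant eq′) = constant (λ t → cong₂ _+_ (eq t) (eq′ t))
  poly-+ (horner a φ P eq) (horner b ψ Q eq′) = horner (a + b) (λ t → φ t + ψ t) (poly-+ P Q)
    (λ t → trans (cong₂ _+_ (eq t) (eq′ t)) (solve 5
        (λ a b t u v → (a :+ t :* u) :+ (b :+ t :* v) := (a :+ b) :+ t :* (u :+ v)) refl a b t (φ t) (ψ t)))

  poly-scale : ∀ {n c φ} a → Poly n c φ → Poly n (a * c) (λ t → a * φ t)
  poly-scale a (constant eq) = constant (λ t → cong (a *_) (eq t))
  poly-scale a (horner b ψ P eq) = horner (a * b) (λ t → a * ψ t) (poly-scale a P)
    (λ t → trans (cong (a *_) (eq t)) (solve 4 (λ a b t u → a :* (b :+ t :* u) := a :* b :+ t :* (a :* u)) refl a b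
        t (ψ t)))

  poly-* : ∀ {m n c d φ ψ} → Poly m c φ → Poly n d ψ → Poly (m ℕ.+ n) (c * d) (λ t → φ t * ψ t)
  poly-* {ψ = ψ} (constant {c} eq) Q = poly-cong refl (λ t → cong (_* ψ t) (sym (eq t))) (poly-scale c Q)
  poly-* {suc m} {ψ = ψ} (horner a χ P eq) Q = poly-cong (+-identityˡ _)
    (λ t → sym (trans (cong (_* ψ t) (eq t)) (solve 4
        (λ a t u v → (a :+ t :* u) :* v := a :* v :+ (con 0ℤ :+ t :* (u :* v))) refl a t (χ t) (ψ t))))
    (poly-+ (poly-raise⁺ m (poly-scale a Q)) (horner (ι 0ℤ) (λ t → χ t * ψ t) (poly-* P Q) (λ t → refl)))

  poly-affine : ∀ a b → Poly 1 b (λ t → a + t * b)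
  poly-affine a b = horner a (λ _ → b) (constant (λ _ → refl)) (λ _ → refl)

  poly-id : Poly 1 1# id
  poly-id = horner 0# (λ _ → 1#) (constant (λ _ → refl)) (λ t → sym (trans (+-identityˡ _) (*-identityʳ t)))

  poly-^ : ∀ {n c φ} k → Poly n c φ → Poly (k ℕ.* n) (c ^ k) (λ t → φ t ^ k)
  poly-^ zero    P = constant (λ _ → refl)
  poly-^ (suc k) P = poly-* P (poly-^ k P)

  deg-constant : ∀ n a → Deg≤ n (λ _ → a)
  deg-constant zero    a = a , constant (λ _ → refl)
  deg-constant (suc n) a = 0# , poly-raise (proj₂ (deg-constant n a))

  deg-weaken : ∀ {m n φ} → m ℕ.≤ n → Deg≤ m φ → Deg≤ n φ
  deg-weaken {m} {n} m≤n D with ℕ.≤⇒≤′ m≤n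
  ... | ℕ.≤′-reflexive refl = D
  ... | ℕ.≤′-step m≤′n = 0# , poly-raise (proj₂ (deg-weaken (ℕ.≤′⇒≤ m≤′n) D))

  deg-+ : ∀ {n φ ψ} → Deg≤ n φ → Deg≤ n ψ → Deg≤ n (λ t → φ t + ψ t)
  deg-+ (_ , P) (_ , Q) = _ , poly-+ P Q

  deg-* : ∀ {m n φ ψ} → Deg≤ m φ → Deg≤ n ψ → Deg≤ (m ℕ.+ n) (λ t → φ t * ψ t)
  deg-* (_ , P) (_ , Q) = _ , poly-* P Q

  deg-scale : ∀ {n φ} a → Deg≤ n φ → Deg≤ n (λ t → a * φ t)
  deg-scale a (_ , P) = _ , poly-scale a P

  deg-^ : ∀ {n φ} k → Deg≤ n φ → Deg≤ (k ℕ.* n) (λ t → φ t ^ k)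
  deg-^ k (_ , P) = _ , poly-^ k P

  deg-sum : ∀ {n m} {φ : Fin m → Carrier → Carrier} → (∀ i → Deg≤ n (φ i)) → Deg≤ n (λ t → sum (λ i → φ i t))
  deg-sum {n} {zero}  D = deg-constant n 0#
  deg-sum {n} {suc m} D = deg-+ (D Fin.zero) (deg-sum (D ∘ Fin.suc))

  -- Synthetic division by t - a: if χ is the quotient of the Horner tail ψ, then ψ + aχ is the
  -- quotient of b + tψ, with the same leading coefficient.
  poly-factor : ∀ {n c φ} → Poly (suc n) c φ → ∀ a → ∃ λ χ → Poly n c χ × (∀ t → φ t ≡ φ a + (t - a) * χ t)
  poly-factor {zero} {c} {φ} (horner b ψ (constant ψ≗c) eq) a = (λ _ → c) , constant (λ _ → refl) , λ t → begin
    φ t                           ≡⟨ trans (eq t) (cong (λ u → b + t * u) (ψ≗c t)) ⟩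
    b + t * c                     ≡⟨ solve 4 (λ a b c t → b :+ t :* c := (b :+ a :* c) :+ (t :- a) :* c) refl a b c t ⟩
    (b + a * c) + (t - a) * c     ≡⟨ cong (_+ (t - a) * c) (trans (eq a) (cong (λ u → b + a * u) (ψ≗c a))) ⟨
    φ a + (t - a) * c             ∎
    where open ≡-Reasoning
  poly-factor {suc n} {c} {φ} (horner b ψ P eq) a with χ , Q , ψ≗ ← poly-factor P a =
    (λ t → ψ t + a * χ t) , poly-cong (+-identityʳ c) (λ _ → refl) (poly-+ P (poly-raise (poly-scale a Q))) , λ t →
        begin
    φ t                                         ≡⟨ eq t ⟩
    b + t * ψ t
        ≡⟨ solve 4 (λ a b t u → b :+ t :* u := b :+ (t :- a) :* u :+ a :* u) refl a b t (ψ t) ⟩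
    b + (t - a) * ψ t + a * ψ t                 ≡⟨ cong (λ u → b + (t - a) * ψ t + a * u) (ψ≗ t) ⟩
    b + (t - a) * ψ t + a * (ψ a + (t - a) * χ t)
        ≡⟨ solve 6 (λ a b t u v w → b :+ (t :- a) :* u :+ a :* (v :+ (t :- a) :* w) := (b :+ a :* v) :+ (t :- a) :*
        (u :+ a :* w)) refl a b t (ψ t) (ψ a) (χ t) ⟩
    (b + a * ψ a) + (t - a) * (ψ t + a * χ t)   ≡⟨ cong (_+ (t - a) * (ψ t + a * χ t)) (eq a) ⟨
    φ a + (t - a) * (ψ t + a * χ t)             ∎
    where open ≡-Reasoning

  roots⇒zero : ∀ {n φ} → Deg≤ n φ → (e : ℕ → Carrier) → (∀ {i j} → i ℕ.< j → j ℕ.≤ n → e i ≢ e j) →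
               (∀ {i} → i ℕ.≤ n → φ (e i) ≡ 0#) → ∀ t → φ t ≡ 0#
  roots⇒zero {zero}  (c , constant eq) e e≢ root t = trans (eq t) (trans (sym (eq (e 0))) (root z≤n))
  roots⇒zero {suc n} {φ} (c , P) e e≢ root t with χ , Q , φ≗ ← poly-factor P (e (suc n)) =
    trans (φ≗ t) (trans (cong₂ _+_ (root ℕ.≤-refl) (trans (cong ((t - e (suc n)) *_) χt≡0) (zeroʳ _))) (+-identityˡ 0#))
    where
    χe≡0 : ∀ {i} → i ℕ.≤ n → χ (e i) ≡ 0#
    χe≡0 {i} i≤n = [ (λ d≡0 → contradiction (x-y≡0⇒x≡y d≡0) (e≢ (s≤s i≤n) ℕ.≤-refl)) , id ]′ (noZeroDivisors
      (trans (sym (+-identityˡ _)) (trans (cong (_+ _) (sym (root ℕ.≤-refl)))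
          (trans (sym (φ≗ (e i))) (root (ℕ.m≤n⇒m≤1+n i≤n))))))
    χt≡0 : χ t ≡ 0#
    χt≡0 = roots⇒zero (c , Q) e (λ i<j j≤n → e≢ i<j (ℕ.m≤n⇒m≤1+n j≤n)) χe≡0 t

  -- The integers 1, ..., n + 1 are distinct nonzero roots in the field. This replaces the
  -- cancellation of a power of t in a polynomial identity: after dividing at t ≠ 0, the quotient
  -- may still be evaluated at t = 0.
  zeroOffOrigin⇒zero : ∀ {n φ} → suc n ℕ.< p → Deg≤ n φ → (∀ t → t ≢ 0# → φ t ≡ 0#) → ∀ t → φ t ≡ 0#
  zeroOffOrigin⇒zero n<p D root = roots⇒zero D (λ i → ι (+ suc i))
    (λ i<j j≤n eq → ℕ.<⇒≢ i<j (ℕ.suc-injective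
        (ι-injective (ℕ.<-≤-trans (s≤s i<j) (ℕ.≤-trans (s≤s j≤n) (ℕ.<⇒≤ n<p))) (ℕ.≤-<-trans (s≤s j≤n) n<p) eq)))
    (λ i≤n → root _ (ι≢0 (λ ()) (ℕ.≤-<-trans (s≤s i≤n) n<p)))

  -- Only the leading term of φ survives, since the moments of lower order kill the others. This is
  -- why `Poly` records the leading coefficient; Vandermonde, the normalisation of solutions and the
  -- evaluation of the form on a line are all instances.
  poly-annihilate : ∀ {m n c φ} (w x : Fin m → Carrier) → Poly n c φ →
      (∀ j → j ℕ.< n → sum (λ i → w i * x i ^ j) ≡ 0#) →
                    sum (λ i → w i * φ (x i)) ≡ c * sum (λ i → w i * x i ^ n)
  poly-annihilate {m} {c = c} w x (constant eq) _ = trans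
    (sum-cong-≗ {m} (λ i → trans (cong (w i *_) (eq (x i)))
        (solve 2 (λ c w → w :* c := c :* (w :* con 1ℤ)) refl c (w i))))
    (trans (sym (*-distribˡ-sum {m} c _)) (cong (c *_) (sum-cong-≗ {m} (λ i → cong (w i *_) ι-1))))
  poly-annihilate {m} {suc n} {c} {φ} w x (horner a ψ P eq) power = begin
    sum (λ i → w i * φ (x i))
      ≡⟨ sum-cong-≗ {m} (λ i → trans (cong (w i *_) (eq (x i)))
          (solve 4 (λ a w x u → w :* (a :+ x :* u) := a :* (w :* con 1ℤ) :+ (w :* x) :* u) refl a (w i) (x i)
          (ψ (x i)))) ⟩
    sum (λ i → a * (w i * ι 1ℤ) + (w i * x i) * ψ (x i))
      ≡⟨ ∑-distrib-+ {m} _ _ ⟩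
    sum (λ i → a * (w i * ι 1ℤ)) + sum (λ i → (w i * x i) * ψ (x i))
      ≡⟨ cong₂ _+_ (trans (sym (*-distribˡ-sum {m} a _))
          (trans (cong (a *_) (trans (sum-cong-≗ {m} (λ i → cong (w i *_) ι-1)) (power 0 (s≤s z≤n)))) (zeroʳ a)))
           -- The factor t of Horner's scheme is absorbed into the weights, which shifts the order
           -- of every moment by one.
           (poly-annihilate (λ i → w i * x i) x P
               (λ j j<n → trans (sum-cong-≗ {m} (λ i → *-assoc (w i) (x i) (x i ^ j))) (power (suc j) (s≤s j<n)))) ⟩
    0# + c * sum (λ i → (w i * x i) * x i ^ n)
      ≡⟨ trans (+-identityˡ _) (cong (c *_) (sum-cong-≗ {m} (λ i → *-assoc (w i) (x i) (x i ^ n)))) ⟩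
    c * sum (λ i → w i * x i ^ suc n) ∎
    where open ≡-Reasoning

  vanishingAt : List Carrier → Carrier → Carrier
  vanishingAt []       t = 1#
  vanishingAt (x ∷ xs) t = (- x + t * 1#) * vanishingAt xs t

  poly-vanishingAt : ∀ xs → Deg≤ (length xs) (vanishingAt xs)
  poly-vanishingAt []       = 1# , constant (λ _ → refl)
  poly-vanishingAt (x ∷ xs) = deg-* (1# , poly-affine (- x) 1#) (poly-vanishingAt xs)

  private
    -x+t1≡t-x : ∀ x t → - x + t * 1# ≡ t - x
    -x+t1≡t-x x t = trans (+-comm _ _) (cong (_- x) (*-identityʳ t))

  vanishingAt-∈ : ∀ {xs t} → t ∈ xs → vanishingAt xs t ≡ 0#
  vanishingAt-∈ {x ∷ xs} (here refl) = trans (cong (_* vanishingAt xs x) (trans (-x+t1≡t-x x x) (-‿inverseʳ x)))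
      (zeroˡ _)
  vanishingAt-∈ {x ∷ xs} (there t∈)  = trans (cong (_ *_) (vanishingAt-∈ t∈)) (zeroʳ _)

  vanishingAt-∉ : 1 ℕ.< p → ∀ {xs t} → ¬ t ∈ xs → vanishingAt xs t ≢ 0#
  vanishingAt-∉ 1<p {[]}         _  = 1≢0 1<p
  vanishingAt-∉ 1<p {x ∷ xs} {t} t∉ = *≢0 (λ eq → t∉ (here (x-y≡0⇒x≡y (trans (sym (-x+t1≡t-x x t)) eq))))
      (vanishingAt-∉ 1<p (t∉ ∘ there))

funToFin-cong : ∀ {m n} {f g : Fin m → Fin n} → (∀ i → f i ≡ g i) → Fin.funToFin f ≡ Fin.funToFin g
funToFin-cong {zero}  f≗g = refl
funToFin-cong {suc m} f≗g = cong₂ Fin.combine (f≗g Fin.zero) (funToFin-cong (f≗g ∘ Fin.suc))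

finToFun-injective : ∀ {m n} {i j : Fin (n ℕ.^ m)} → (∀ k → Fin.finToFun {n} {m} i k ≡ Fin.finToFun j k) → i ≡ j
finToFun-injective {m} {n} {i} {j} eq =
  trans (sym (Fin.funToFin-finToFin {m} {n} i)) (trans (funToFin-cong eq) (Fin.funToFin-finToFin {m} {n} j))

module LinearAlgebra {p : ℕ} (1<p : 1 ℕ.< p) (F : FiniteField p) where

  open Polynomials F public

  sum-combine : ∀ m {n} (f : Fin (m ℕ.* n) → Carrier) → sum f ≡ sum
      (λ (i : Fin m) → sum (λ (j : Fin n) → f (Fin.combine i j)))
  sum-combine zero    {n} f = refl
  sum-combine (suc m) {n} f = trans (sum-++ n f)
      (cong (λ u → sum (λ (j : Fin n) → f (j Fin.↑ˡ (m ℕ.* n))) + u) (sum-combine m {n} (λ i → f (n Fin.↑ʳ i))))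

  sum-single : ∀ {n} (f : Fin n → Carrier) i → (∀ j → j ≢ i → f j ≡ 0#) → sum f ≡ f i
  sum-single {suc n} f i rest = trans (SemiringSum.sum-remove semiring {n} {i} f)
    (trans (cong (λ u → f i + u) (sum-zero {n} (λ j → rest (Fin.punchIn i j) (Fin.punchInᵢ≢i i j)))) (+-identityʳ _))

  2≤size : 2 ℕ.≤ size
  2≤size = Fin.injective⇒≤ {f = λ i → index (ι (+ toℕ i))}
    (λ {i} {j} eq → Fin.toℕ-injective (ι-injective (ℕ.<-≤-trans (Fin.toℕ<n i) 1<p) (ℕ.<-≤-trans (Fin.toℕ<n j) 1<p)
        (index-injective eq)))

  -- By counting: there are more vectors of length n than images of length m, and the difference of
  -- two vectors with the same image lies in the kernel.
  nontrivialKernel : ∀ {m n} → m ℕ.< n → (M : Fin m → Fin n → Carrier) →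
    ∃ λ (κ : Fin n → Carrier) → (∃ λ i → κ i ≢ 0#) × (∀ l → sum (λ i → κ i * M l i) ≡ 0#)
  nontrivialKernel {m} {n} m<n M = κ , κ≢0 , Mκ≡0
    where
    vector : Fin (size ℕ.^ n) → Fin n → Carrier
    vector i = element ∘ Fin.finToFun i
    image : Fin (size ℕ.^ n) → Fin (size ℕ.^ m)
    image i = Fin.funToFin (λ l → index (sum (λ k → vector i k * M l k)))
    collision = Fin.pigeonhole (ℕ.^-monoʳ-< size 2≤size m<n) image
    i = proj₁ collision
    j = proj₁ (proj₂ collision)
    i<j = proj₁ (proj₂ (proj₂ collision))
    κ : Fin n → Carrier
    κ k = vector i k - vector j k
    κ≢0 : ∃ λ k → κ k ≢ 0#
    κ≢0 with Fin.any? (λ k → ¬? (κ k ≟ 0#))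
    ... | yes k = k
    ... | no ¬k = ⊥-elim (Fin.<⇒≢ i<j (finToFun-injective {n} {size} λ k → element-injective (x-y≡0⇒x≡y (decided k))))
      where
      decided : ∀ k → κ k ≡ 0#
      decided k with κ k ≟ 0#
      ... | yes eq = eq
      ... | no neq = ⊥-elim (¬k (k , neq))
    Mκ≡0 : ∀ l → sum (λ k → κ k * M l k) ≡ 0#
    Mκ≡0 l = +-cancelʳ (sum (λ k → vector j k * M l k)) _ _ (begin
      sum (λ k → κ k * M l k) + sum (λ k → vector j k * M l k)
        ≡⟨ ∑-distrib-+ {n} (λ k → κ k * M l k) (λ k → vector j k * M l k) ⟨
      sum (λ k → κ k * M l k + vector j k * M l k)
        ≡⟨ sum-cong-≗ {n} (λ k → solve 3 (λ u v x → (u :- v) :* x :+ v :* x := u :* x) refl (vector i k)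
            (vector j k) (M l k)) ⟩
      sum (λ k → vector i k * M l k)
        ≡⟨ index-injective (trans (sym (Fin.finToFun-funToFin _ l))
            (trans (cong (λ c → Fin.finToFun c l) (proj₂ (proj₂ (proj₂ collision)))) (Fin.finToFun-funToFin _ l))) ⟩
      sum (λ k → vector j k * M l k)
        ≡⟨ +-identityˡ _ ⟨
      0# + sum (λ k → vector j k * M l k) ∎)
      where open ≡-Reasoning

  -- Testing the weights against the polynomial that vanishes at every node except z i isolates w i.
  vandermonde : ∀ {n} (w z : Fin n → Carrier) → Injective _≡_ _≡_ z →
    (∀ j → j ℕ.< n → sum (λ i → w i * z i ^ j) ≡ 0#) → ∀ i → w i ≡ 0#
  vandermonde {suc n} w z z-inj powers i = [ id , (λ φz≡0 → contradiction φz≡0 (vanishingAt-∉ 1<p zi∉)) ]′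
      (noZeroDivisors (begin
    w i * φ (z i)                       ≡⟨ sum-single (λ l → w l * φ (z l)) i
        (λ l l≢i → trans (cong (w l *_) (vanishingAt-∈ (zl∈ l l≢i))) (zeroʳ _)) ⟨
    sum (λ l → w l * φ (z l))           ≡⟨ poly-annihilate w z (proj₂ φ-poly)
        (λ j j<n → powers j (ℕ.m≤n⇒m≤1+n (ℕ.<-≤-trans j<n length≤))) ⟩
    proj₁ φ-poly * sum (λ l → w l * z l ^ length nodes)
        ≡⟨ cong (proj₁ φ-poly *_) (powers (length nodes) (s≤s length≤)) ⟩
    proj₁ φ-poly * 0#                   ≡⟨ zeroʳ _ ⟩
    0#                                  ∎))
    where
    open ≡-Reasoning
    nodes = List.tabulate (z ∘ Fin.punchIn i)
    φ = vanishingAt nodes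
    φ-poly = poly-vanishingAt nodes
    length≤ : length nodes ℕ.≤ n
    length≤ = ℕ.≤-reflexive (List.length-tabulate (z ∘ Fin.punchIn i))
    zi∉ : ¬ z i ∈ nodes
    zi∉ zi∈ with l , eq ← ∈-tabulate⁻ zi∈ = Fin.punchInᵢ≢i i l (sym (z-inj eq))
    zl∈ : ∀ l → l ≢ i → z l ∈ nodes
    zl∈ l l≢i = subst (λ k → z k ∈ nodes) (Fin.punchIn-punchOut (l≢i ∘ sym))
        (∈-tabulate⁺ {f = z ∘ Fin.punchIn i} (Fin.punchOut (l≢i ∘ sym)))

  -- The digits of i in base A are the exponents of a monomial in r variables.
  mono : ∀ A r → Fin (A ℕ.^ r) → (Fin r → Carrier) → Carrier
  mono A zero    i e = 1#
  mono A (suc r) i e = e Fin.zero ^ toℕ (proj₁ (Fin.remQuot {A} (A ℕ.^ r) i)) * mono A r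
      (proj₂ (Fin.remQuot {A} (A ℕ.^ r) i)) (e ∘ Fin.suc)

  tdeg : ∀ A r → Fin (A ℕ.^ r) → ℕ
  tdeg A zero    i = 0
  tdeg A (suc r) i = toℕ (proj₁ (Fin.remQuot {A} (A ℕ.^ r) i)) ℕ.+ tdeg A r (proj₂ (Fin.remQuot {A} (A ℕ.^ r) i))

  tdeg≤ : ∀ A r (i : Fin (A ℕ.^ r)) → tdeg A r i ℕ.≤ r ℕ.* A
  tdeg≤ A zero    i = z≤n
  tdeg≤ A (suc r) i = ℕ.+-mono-≤ (ℕ.<⇒≤ (Fin.toℕ<n (proj₁ (Fin.remQuot {A} (A ℕ.^ r) i)))) (tdeg≤ A r _)

  mono-cong : ∀ A r (i : Fin (A ℕ.^ r)) {e e′ : Fin r → Carrier} → (∀ j → e j ≡ e′ j) → mono A r i e ≡ mono A r i e′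
  mono-cong A zero    i eq = refl
  mono-cong A (suc r) i eq = cong₂ (λ u v → u ^ toℕ (proj₁ (Fin.remQuot {A} (A ℕ.^ r) i)) * v) (eq Fin.zero)
      (mono-cong A r _ (eq ∘ Fin.suc))

  -- Homogeneity. Along a line through a common zero of the moments each moment acquires a factor t,
  -- so `tdeg` measures the order of vanishing of a monomial in them.
  mono-scale : ∀ A r (i : Fin (A ℕ.^ r)) t e → mono A r i (λ j → t * e j) ≡ t ^ tdeg A r i * mono A r i e
  mono-scale A zero    i t e = sym (*-identityˡ 1#)
  mono-scale A (suc r) i t e = begin
    (t * e₀) ^ a * mono A r b (λ j → t * e (Fin.suc j))
        ≡⟨ cong₂ _*_ (^-distrib-* t e₀ a) (mono-scale A r b t (e ∘ Fin.suc)) ⟩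
    t ^ a * e₀ ^ a * (t ^ tdeg A r b * mono A r b (e ∘ Fin.suc))
        ≡⟨ solve 4 (λ x y u v → x :* y :* (u :* v) := x :* u :* (y :* v)) refl (t ^ a) (e₀ ^ a) (t ^ tdeg A r b) _ ⟩
    t ^ a * t ^ tdeg A r b * (e₀ ^ a * mono A r b (e ∘ Fin.suc))
        ≡⟨ cong (_* (e₀ ^ a * mono A r b (e ∘ Fin.suc))) (^-homo-* t a (tdeg A r b)) ⟨
    t ^ (a ℕ.+ tdeg A r b) * (e₀ ^ a * mono A r b (e ∘ Fin.suc))   ∎
    where
    open ≡-Reasoning
    e₀ = e Fin.zero
    a = toℕ (proj₁ (Fin.remQuot {A} (A ℕ.^ r) i))
    b = proj₂ (Fin.remQuot {A} (A ℕ.^ r) i)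

  mono-combine : ∀ A r (a : Fin A) (b : Fin (A ℕ.^ r)) e → mono A (suc r) (Fin.combine a b) e ≡ e Fin.zero ^ toℕ a *
      mono A r b (e ∘ Fin.suc)
  mono-combine A r a b e = cong (λ ab → e Fin.zero ^ toℕ (proj₁ ab) * mono A r (proj₂ ab) (e ∘ Fin.suc))
      (Fin.remQuot-combine {A} a b)

  deg-mono : ∀ A {d} r (i : Fin (A ℕ.^ r)) {e : Fin r → Carrier → Carrier} → (∀ j → Deg≤ d (e j)) →
             Deg≤ (r ℕ.* (A ℕ.* d)) (λ t → mono A r i (λ j → e j t))
  deg-mono A     zero    i D = deg-constant 0 1#
  deg-mono A {d} (suc r) i D = deg-*
    (deg-weaken (ℕ.*-monoˡ-≤ d (ℕ.<⇒≤ (Fin.toℕ<n (proj₁ (Fin.remQuot {A} (A ℕ.^ r) i)))))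
        (deg-^ (toℕ (proj₁ (Fin.remQuot {A} (A ℕ.^ r) i))) (D Fin.zero)))
    (deg-mono A r _ (D ∘ Fin.suc))

  deg-power : ∀ {n} k → k ℕ.≤ n → Deg≤ n (_^ k)
  deg-power k k≤n = deg-weaken (ℕ.≤-trans (ℕ.≤-reflexive (ℕ.*-identityʳ k)) k≤n) (deg-^ k (1# , poly-id))

  coefficients≡0₁ : ∀ {A} → A ℕ.< p → (κ : Fin A → Carrier) → (∀ t → sum (λ a → κ a * t ^ toℕ a) ≡ 0#) → ∀ a → κ a ≡ 0#
  coefficients≡0₁ {suc A} A<p κ zero-fn = λ { Fin.zero → κ₀≡0 ; (Fin.suc a) → coefficients≡0₁
      (ℕ.<-trans (ℕ.n<1+n A) A<p) (κ ∘ Fin.suc) tail≡0 a }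
    where
    tail : Carrier → Carrier
    tail t = sum (λ a → κ (Fin.suc a) * t ^ toℕ a)
    split : ∀ t → κ Fin.zero * 1# + t * tail t ≡ 0#
    split t = trans (cong (λ u → κ Fin.zero * 1# + u) (trans (*-distribˡ-sum {A} t _)
      (sum-cong-≗ {A} λ a → solve 3 (λ t k u → t :* (k :* u) := k :* (t :* u)) refl t (κ (Fin.suc a)) (t ^ toℕ a))))
          (zero-fn t)
    κ₀≡0 : κ Fin.zero ≡ 0#
    κ₀≡0 = trans (sym (*-identityʳ _)) (trans (sym (+-identityʳ _))
        (trans (cong (λ u → κ Fin.zero * 1# + u) (sym (zeroˡ (tail 0#)))) (split 0#)))
    -- The product t · `tail` t vanishes, which says nothing about `tail` at t = 0; its low degree
    -- closes this gap.
    tail≡0 : ∀ t → tail t ≡ 0#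
    tail≡0 = zeroOffOrigin⇒zero A<p (deg-sum (λ a → deg-scale (κ (Fin.suc a))
        (deg-power (toℕ a) (ℕ.<⇒≤ (Fin.toℕ<n a)))))
      (λ t t≢0 → [ (λ t≡0 → contradiction t≡0 t≢0) , id ]′ (noZeroDivisors
        (trans (sym (+-identityˡ _)) (trans (cong (_+ t * tail t) (sym (trans (cong (_* 1#) κ₀≡0) (zeroˡ 1#))))
            (split t)))))

  coefficients≡0 : ∀ A → A ℕ.< p → ∀ r (κ : Fin (A ℕ.^ r) → Carrier) → (∀ e → sum (λ i → κ i * mono A r i e) ≡ 0#) →
      ∀ i → κ i ≡ 0#
  coefficients≡0 A A<p zero κ zero-fn Fin.zero = trans (sym (*-identityʳ _))
      (trans (sym (+-identityʳ _)) (zero-fn (λ ())))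
  coefficients≡0 A A<p (suc r) κ zero-fn i = trans (cong κ (sym (Fin.combine-remQuot {A} (A ℕ.^ r) i)))
    (coefficients≡0 A A<p r (λ b → κ (Fin.combine (proj₁ ab) b))
      (λ e → coefficients≡0₁ A<p (λ a → sum (λ (b : Fin (A ℕ.^ r)) → κ (Fin.combine a b) * mono A r b e))
          (λ t → inner t e) (proj₁ ab)) (proj₂ ab))
    where
    ab = Fin.remQuot {A} (A ℕ.^ r) i
    inner : ∀ t e → sum (λ (a : Fin A) → sum (λ (b : Fin (A ℕ.^ r)) → κ (Fin.combine a b) * mono A r b e) * t ^ toℕ
        a) ≡ 0#
    inner t e = trans (sum-cong-≗ {A} (λ a → trans (*-distribʳ-sum {A ℕ.^ r} (t ^ toℕ a) _) (sum-cong-≗ {A ℕ.^ r} (λ b →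
        trans (solve 3 (λ k m u → k :* m :* u := k :* (u :* m)) refl (κ (Fin.combine a b)) (mono A r b e) (t ^ toℕ a))
          (cong (κ (Fin.combine a b) *_) (sym (mono-combine A r a b (t Vector.∷ e))))))))
      (trans (sym (sum-combine A {A ℕ.^ r} (λ i → κ i * mono A (suc r) i (t Vector.∷ e)))) (zero-fn (t Vector.∷ e)))

-- Shapes

module SeparateDegree {p : ℕ} (1<p : 1 ℕ.< p) (F : FiniteField p) where

  open LinearAlgebra 1<p F public

  -- Degree at most d in each variable separately, the others being fixed. Such a function is
  -- determined by (d + 1)^r values, and this is the dimension count behind the bound on the number
  -- of shapes.
  SepDeg : ∀ r → ℕ → (Vec Carrier r → Carrier) → Set
  SepDeg zero    d G = ⊤
  SepDeg (suc r) d G = (∀ y → Deg≤ d (λ t → G (t ∷ y))) × (∀ t → SepDeg r d (λ y → G (t ∷ y)))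

  sep-constant : ∀ r {d} a → SepDeg r d (λ _ → a)
  sep-constant zero        a = tt
  sep-constant (suc r) {d} a = (λ _ → deg-constant d a) , (λ _ → sep-constant r a)

  sep-lookup : ∀ r (i : Fin r) → SepDeg r 1 (λ y → Vec.lookup y i)
  sep-lookup (suc r) Fin.zero    = (λ _ → 1# , poly-id) , (λ t → sep-constant r t)
  sep-lookup (suc r) (Fin.suc i) = (λ y → deg-constant 1 (Vec.lookup y i)) , (λ _ → sep-lookup r i)

  sep-weaken : ∀ r {d e G} → d ℕ.≤ e → SepDeg r d G → SepDeg r e G
  sep-weaken zero    d≤e _       = tt
  sep-weaken (suc r) d≤e (D , S) = deg-weaken d≤e ∘ D , sep-weaken r d≤e ∘ S

  sep-+ : ∀ r {d G H} → SepDeg r d G → SepDeg r d H → SepDeg r d (λ y → G y + H y)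
  sep-+ zero    _       _       = tt
  sep-+ (suc r) (D , S) (E , T) = (λ y → deg-+ (D y) (E y)) , (λ t → sep-+ r (S t) (T t))

  sep-* : ∀ r {d e G H} → SepDeg r d G → SepDeg r e H → SepDeg r (d ℕ.+ e) (λ y → G y * H y)
  sep-* zero    _       _       = tt
  sep-* (suc r) (D , S) (E , T) = (λ y → deg-* (D y) (E y)) , (λ t → sep-* r (S t) (T t))

  sep-scale : ∀ r {d G} a → SepDeg r d G → SepDeg r d (λ y → a * G y)
  sep-scale r a S = sep-* r {0} (sep-constant r a) S

  sep-sum : ∀ r {d n} {G : Fin n → Vec Carrier r → Carrier} → (∀ i → SepDeg r d (G i)) → SepDeg r d
      (λ y → sum (λ i → G i y))
  sep-sum r {n = zero}  S = sep-constant r 0#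
  sep-sum r {n = suc n} S = sep-+ r (S Fin.zero) (sep-sum r (S ∘ Fin.suc))

  sep-^ : ∀ r {d G} k → SepDeg r d G → SepDeg r (k ℕ.* d) (λ y → G y ^ k)
  sep-^ r zero    S = sep-constant r 1#
  sep-^ r (suc k) S = sep-* r S (sep-^ r k S)

  sep-mono : ∀ r A {d} n (i : Fin (A ℕ.^ n)) {e : Fin n → Vec Carrier r → Carrier} → (∀ j → SepDeg r d (e j)) →
             SepDeg r (n ℕ.* (A ℕ.* d)) (λ y → mono A n i (λ j → e j y))
  sep-mono r A     zero    i S = sep-constant r 1#
  sep-mono r A {d} (suc n) i S = sep-* r
    (sep-weaken r (ℕ.*-monoˡ-≤ d (ℕ.<⇒≤ (Fin.toℕ<n a))) (sep-^ r (toℕ a) (S Fin.zero)))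
    (sep-mono r A n (proj₂ (Fin.remQuot {A} (A ℕ.^ n) i)) (S ∘ Fin.suc))
    where a = proj₁ (Fin.remQuot {A} (A ℕ.^ n) i)

  prod : ∀ {n} → (Fin n → Carrier) → Carrier
  prod {zero}  f = 1#
  prod {suc n} f = f Fin.zero * prod (f ∘ Fin.suc)

  prod≢0 : ∀ {n} {f : Fin n → Carrier} → (∀ i → f i ≢ 0#) → prod f ≢ 0#
  prod≢0 {zero}  f≢0 = 1≢0 1<p
  prod≢0 {suc n} f≢0 = *≢0 (f≢0 Fin.zero) (prod≢0 (f≢0 ∘ Fin.suc))

  prod≡0 : ∀ {n} {f : Fin n → Carrier} i → f i ≡ 0# → prod f ≡ 0#
  prod≡0 {suc n} {f} Fin.zero    eq = trans (cong (_* prod (f ∘ Fin.suc)) eq) (zeroˡ _)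
  prod≡0 {suc n} {f} (Fin.suc i) eq = trans (cong (f Fin.zero *_) (prod≡0 i eq)) (zeroʳ _)

  sep-prod : ∀ r {d n} {G : Fin n → Vec Carrier r → Carrier} → (∀ i → SepDeg r d (G i)) → SepDeg r (n ℕ.* d)
      (λ y → prod (λ i → G i y))
  sep-prod r {n = zero}  S = sep-constant r 1#
  sep-prod r {n = suc n} S = sep-* r (S Fin.zero) (sep-prod r (S ∘ Fin.suc))

  deg-prod : ∀ {d n} {G : Fin n → Carrier → Carrier} → (∀ i → Deg≤ d (G i)) → Deg≤ (n ℕ.* d) (λ t → prod (λ i → G i t))
  deg-prod {n = zero}  D = deg-constant 0 1#
  deg-prod {n = suc n} D = deg-* (D Fin.zero) (deg-prod (D ∘ Fin.suc))

  gridPoint : ∀ d r → Fin (d ℕ.^ r) → Vec Carrier r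
  gridPoint d zero    i = []
  gridPoint d (suc r) i = ι (+ toℕ (proj₁ (Fin.remQuot {d} (d ℕ.^ r) i))) ∷ gridPoint d r
      (proj₂ (Fin.remQuot {d} (d ℕ.^ r) i))

  -- One variable at a time: above a grid point of the remaining variables the first variable has
  -- the d + 1 roots 0, ..., d. They are distinct because d < p.
  zeroOnGrid⇒zero : ∀ {d} → d ℕ.< p → ∀ r {G} → SepDeg r d G → (∀ i → G (gridPoint (suc d) r i) ≡ 0#) → ∀ y → G y ≡ 0#
  zeroOnGrid⇒zero     d<p zero    S       grid []      = grid Fin.zero
  zeroOnGrid⇒zero {d} d<p (suc r) {G} (D , S) grid (t ∷ y) = zeroOnGrid⇒zero d<p r (S t)
    (λ b → roots⇒zero (D (gridPoint (suc d) r b)) (λ i → ι (+ i))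
      (λ i<j j≤d eq → ℕ.<⇒≢ i<j (ι-injective (ℕ.<-≤-trans i<j (ℕ.≤-trans j≤d (ℕ.<⇒≤ d<p))) (ℕ.≤-<-trans j≤d d<p) eq))
      (λ {i} i≤d → subst (λ k → G (ι (+ k) ∷ gridPoint (suc d) r b) ≡ 0#) (Fin.toℕ-fromℕ< (s≤s i≤d))
        (subst (λ ab → G (ι (+ toℕ (proj₁ ab)) ∷ gridPoint (suc d) r (proj₂ ab)) ≡ 0#)
          (Fin.remQuot-combine {suc d} (Fin.fromℕ< (s≤s i≤d)) b)
          (grid (Fin.combine {suc d} (Fin.fromℕ< (s≤s i≤d)) b))))
      t) y

Vec-differ : ∀ {A : Set} (_≟_ : DecidableEquality A) {n} (x y : Vec A n) → x ≢ y → ∃ λ i → Vec.lookup x i ≢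
    Vec.lookup y i
Vec-differ _≟_ []      []      x≢y = contradiction refl x≢y
Vec-differ _≟_ (a ∷ x) (b ∷ y) x≢y with a ≟ b
... | no a≢b   = Fin.zero , a≢b
... | yes refl with i , neq ← Vec-differ _≟_ x y (x≢y ∘ cong (a ∷_)) = Fin.suc i , neq

-- A shape y stands for the nodes (0, 1, y₁, …, y_r) with weights c₁, …, c_s, where a = c₂ and b = (c₃, …, c_s):
-- all moments of order 1, …, r vanish.  At distinct nodes the Jacobian of these r equations is a Vandermonde
-- matrix, so near N such zeros the products of an interpolation polynomial with monomials in the equations are
-- independent; as they lie in a space of polynomials of bounded degree, N is bounded independently of the field.
module Bezout {p : ℕ} (1<p : 1 ℕ.< p) (F : FiniteField p) (r : ℕ) (r<p : r ℕ.< p)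
  (a : FiniteField.Carrier F) (b : Fin r → FiniteField.Carrier F) (b≢0 : ∀ i → b i ≢ FiniteField.0# F) where

  open SeparateDegree 1<p F

  -- The order is j + 1. At positive order the node 0 contributes nothing and the node 1 contributes
  -- its weight a.
  moment : ℕ → Vec Carrier r → Carrier
  moment j y = a + sum (λ i → b i * Vec.lookup y i ^ suc j)

  -- The Jacobian of the moments has the entries (j + 1) b_i y_i^j, a Vandermonde matrix in the free
  -- nodes y_i up to nonzero factors; distinctness is asked of these.
  IsShape : Vec Carrier r → Set
  IsShape y = Injective _≡_ _≡_ (Vec.lookup y) × (∀ (j : Fin r) → moment (toℕ j) y ≡ 0#)

  private
    line : Vec Carrier r → (Fin r → Carrier) → Carrier → Vec Carrier r
    line z v t = Vec.tabulate (λ i → Vec.lookup z i + t * v i)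

    lookup-line : ∀ z v t i → Vec.lookup (line z v t) i ≡ Vec.lookup z i + t * v i
    lookup-line z v t i = Vec.lookup∘tabulate _ i

    line-0 : ∀ z v → line z v 0# ≡ z
    line-0 z v = trans (Vec.tabulate-cong (λ i → trans (cong (λ u → Vec.lookup z i + u) (zeroˡ (v i)))
        (+-identityʳ _))) (Vec.tabulate∘lookup z)

    -- The difference quotient ((z + tv)^n - z^n)/t, written as a polynomial in t so that t = 0 is
    -- allowed; there it is the derivative in direction v.
    quotient : ℕ → Carrier → Carrier → Carrier → Carrier
    quotient zero    z v t = 0#
    quotient (suc n) z v t = (z + t * v) * quotient n z v t + v * z ^ n

    ^-quotient : ∀ n z v t → (z + t * v) ^ n ≡ z ^ n + t * quotient n z v t
    ^-quotient zero    z v t = sym (trans (cong (λ u → 1# + u) (zeroʳ t)) (+-identityʳ 1#))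
    ^-quotient (suc n) z v t = trans (cong ((z + t * v) *_) (^-quotient n z v t))
      (solve 5 (λ z v t u q → (z :+ t :* v) :* (u :+ t :* q) := z :* u :+ t :* ((z :+ t :* v) :* q :+ v :* u)) refl
          z v t (z ^ n) (quotient n z v t))

    quotient-0 : ∀ n z v → quotient (suc n) z v 0# ≡ ι (+ suc n) * (v * z ^ n)
    quotient-0 zero    z v = trans (trans (cong (_+ v * 1#) (zeroʳ _)) (+-identityˡ _))
        (trans (sym (*-identityˡ _)) (cong (_* (v * 1#)) (sym ι-1)))
    quotient-0 (suc n) z v = begin
      (z + 0# * v) * quotient (suc n) z v 0# + v * z ^ suc n
        ≡⟨ cong₂ (λ u w → u * w + v * z ^ suc n) (trans (cong (λ u → z + u) (zeroˡ v)) (+-identityʳ z))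
            (quotient-0 n z v) ⟩
      z * (ι (+ suc n) * (v * z ^ n)) + v * (z * z ^ n)
        ≡⟨ solve 4 (λ z v u k → z :* (k :* (v :* u)) :+ v :* (z :* u) := (con 1ℤ :+ k) :* (v :* (z :* u))) refl z v
            (z ^ n) (ι (+ suc n)) ⟩
      (ι 1ℤ + ι (+ suc n)) * (v * (z * z ^ n))
        ≡⟨ cong (_* (v * (z * z ^ n))) (ι-+ 1ℤ (+ suc n)) ⟨
      ι (+ suc (suc n)) * (v * (z * z ^ n)) ∎
      where open ≡-Reasoning

    deg-quotient : ∀ n z v → Deg≤ n (quotient n z v)
    deg-quotient zero    z v = deg-constant 0 0#
    deg-quotient (suc n) z v = deg-+ (deg-* (v , poly-affine z v) (deg-quotient n z v)) (deg-constant (suc n) _)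

    -- Difference quotient of a moment along a line. Its value at t = 0 is the directional
    -- derivative, which is the `jacobian` below.
    slope : Vec Carrier r → (Fin r → Carrier) → ℕ → Carrier → Carrier
    slope z v j t = sum (λ i → b i * quotient (suc j) (Vec.lookup z i) (v i) t)

    moment-line : ∀ z v j t → moment j (line z v t) ≡ moment j z + t * slope z v j t
    moment-line z v j t = begin
      a + sum (λ i → b i * Vec.lookup (line z v t) i ^ suc j)
        ≡⟨ cong (λ u → a + u) (sum-cong-≗ {r} λ i → trans (cong (λ u → b i * u ^ suc j) (lookup-line z v t i))
            (trans (cong (b i *_) (^-quotient (suc j) (Vec.lookup z i) (v i) t))
             (solve 4 (λ b u t q → b :* (u :+ t :* q) := b :* u :+ t :* (b :* q)) refl (b i)
                 (Vec.lookup z i ^ suc j) t (quotient (suc j) (Vec.lookup z i) (v i) t)))) ⟩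
      a + sum (λ i → b i * Vec.lookup z i ^ suc j + t * (b i * quotient (suc j) (Vec.lookup z i) (v i) t))
        ≡⟨ cong (λ u → a + u) (trans (∑-distrib-+ {r} _ _)
            (cong (λ u → sum (λ i → b i * Vec.lookup z i ^ suc j) + u) (sym (*-distribˡ-sum {r} t _)))) ⟩
      a + (sum (λ i → b i * Vec.lookup z i ^ suc j) + t * slope z v j t)
        ≡⟨ +-assoc _ _ _ ⟨
      moment j z + t * slope z v j t ∎
      where open ≡-Reasoning

    deg-slope : ∀ z v (j : Fin r) → Deg≤ r (slope z v (toℕ j))
    deg-slope z v j = deg-sum (λ i → deg-scale (b i) (deg-weaken (Fin.toℕ<n j) (deg-quotient (suc (toℕ j)) _ _)))

    jacobian : Vec Carrier r → (Fin r → Carrier) → Fin r → Carrier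
    jacobian z v j = slope z v (toℕ j) 0#

    jacobian≡ : ∀ z v j → jacobian z v j ≡ ι (+ suc (toℕ j)) * sum (λ i → (b i * v i) * Vec.lookup z i ^ toℕ j)
    jacobian≡ z v j = trans (sum-cong-≗ {r} λ i → trans (cong (b i *_) (quotient-0 (toℕ j) (Vec.lookup z i) (v i)))
        (solve 4 (λ b k v u → b :* (k :* (v :* u)) := k :* ((b :* v) :* u)) refl (b i) (ι (+ suc (toℕ j))) (v i)
            (Vec.lookup z i ^ toℕ j)))
      (sym (*-distribˡ-sum {r} (ι (+ suc (toℕ j))) _))

    -- The factors j + 1 ≤ r are nonzero since r < p. Vandermonde at the distinct nodes of z then
    -- kills the weights b_i (v_i - v′_i), and b_i ≠ 0.
    jacobian-injective : ∀ z → Injective _≡_ _≡_ (Vec.lookup z) → ∀ v v′ →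
        (∀ j → jacobian z v j ≡ jacobian z v′ j) → ∀ i → v i ≡ v′ i
    jacobian-injective z z-inj v v′ eq i = x-y≡0⇒x≡y ([ (λ b≡0 → contradiction b≡0 (b≢0 i)) , id ]′ (noZeroDivisors
      (vandermonde (λ i → b i * (v i - v′ i)) (Vec.lookup z) z-inj powers i)))
      where
      Σ[_] : (Fin r → Carrier) → ℕ → Carrier
      Σ[ v ] j = sum (λ i → (b i * v i) * Vec.lookup z i ^ j)
      Σ-eq : ∀ (j : Fin r) → Σ[ v ] (toℕ j) ≡ Σ[ v′ ] (toℕ j)
      Σ-eq j = *-cancelˡ (ι≢0 {+ suc (toℕ j)}
          (λ ()) (ℕ.≤-<-trans (Fin.toℕ<n j) r<p)) (trans (sym (jacobian≡ z v j)) (trans (eq j) (jacobian≡ z v′ j)))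
      powers : ∀ j → j ℕ.< r → sum (λ i → (b i * (v i - v′ i)) * Vec.lookup z i ^ j) ≡ 0#
      powers j j<r = +-cancelʳ (Σ[ v′ ] j) _ _ (trans (sym (∑-distrib-+ {r} _ _)) (trans (sum-cong-≗ {r} λ i →
          solve 4 (λ b v w u → (b :* (v :- w)) :* u :+ (b :* w) :* u := (b :* v) :* u) refl (b i) (v i) (v′ i)
              (Vec.lookup z i ^ j))
        (trans (subst (λ k → Σ[ v ] k ≡ Σ[ v′ ] k) (Fin.toℕ-fromℕ< j<r) (Σ-eq (Fin.fromℕ< j<r)))
            (sym (+-identityˡ _)))))

    -- An injective self-map of the finite set of vectors of length r is onto. Hence a form that
    -- vanishes on all values of the Jacobian vanishes everywhere.
    jacobian-surjective : ∀ z → Injective _≡_ _≡_ (Vec.lookup z) → ∀ (e : Fin r → Carrier) → ∃ λ v → ∀ j → jacobian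
        z v j ≡ e j
    jacobian-surjective z z-inj e = direction (proj₁ hit) , λ j → index-injective
        (trans (sym (Fin.finToFun-funToFin _ j))
        (trans (cong (λ k → Fin.finToFun k j) (proj₂ hit)) (Fin.finToFun-funToFin _ j)))
      where
      direction : Fin (size ℕ.^ r) → Fin r → Carrier
      direction k = element ∘ Fin.finToFun k
      image : Fin (size ℕ.^ r) → Fin (size ℕ.^ r)
      image k = Fin.funToFin (λ j → index (jacobian z (direction k) j))
      image-injective : Injective _≡_ _≡_ image
      image-injective {k} {l} eq = finToFun-injective {r} {size}
          (λ i → element-injective (jacobian-injective z z-inj (direction k) (direction l)
        (λ j → index-injective (trans (sym (Fin.finToFun-funToFin _ j))
            (trans (cong (λ k → Fin.finToFun k j) eq) (Fin.finToFun-funToFin _ j)))) i))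
      hit = Fin-injective⇒surjective image image-injective (Fin.funToFin (index ∘ e))

  module _ (N A : ℕ) (z : Fin N → Vec Carrier r) (shape : ∀ k → IsShape (z k))
      (distinct : ∀ {k l} → k ≢ l → z k ≢ z l) where

    private
      -- An affine function of one coordinate in which z k and z l differ, vanishing at z l and not
      -- at z k. The product over l is an interpolation polynomial for z k of degree at most N in
      -- each variable.
      factor : ∀ k l → Dec (k ≡ l) → Vec Carrier r → Carrier
      factor k l (yes _)   y = 1#
      factor k l (no  k≢l) y = Vec.lookup y i + - Vec.lookup (z l) i
        where i = proj₁ (Vec-differ _≟_ (z k) (z l) (distinct k≢l))

      cardinal : Fin N → Vec Carrier r → Carrier
      cardinal k y = prod (λ l → factor k l (k Fin.≟ l) y)

      cardinal-≢ : ∀ {k l} → k ≢ l → cardinal k (z l) ≡ 0#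
      cardinal-≢ {k} {l} k≢l = prod≡0 l (factor≡0 (k Fin.≟ l))
        where
        factor≡0 : ∀ k≟l → factor k l k≟l (z l) ≡ 0#
        factor≡0 (yes k≡l) = contradiction k≡l k≢l
        factor≡0 (no  k≢l) = -‿inverseʳ _

      cardinal-≡ : ∀ k → cardinal k (z k) ≢ 0#
      cardinal-≡ k = prod≢0 (λ l → factor≢0 l (k Fin.≟ l))
        where
        factor≢0 : ∀ l k≟l → factor k l k≟l (z k) ≢ 0#
        factor≢0 l (yes _)   = 1≢0 1<p
        factor≢0 l (no  k≢l) eq = proj₂ (Vec-differ _≟_ (z k) (z l) (distinct k≢l)) (x-y≡0⇒x≡y eq)

      sep-cardinal : ∀ k → SepDeg r N (cardinal k)
      sep-cardinal k = sep-weaken r (ℕ.≤-reflexive (ℕ.*-identityʳ N)) (sep-prod r (λ l → sep-factor l (k Fin.≟ l)))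
        where
        sep-factor : ∀ l k≟l → SepDeg r 1 (factor k l k≟l)
        sep-factor l (yes _) = sep-constant r 1#
        sep-factor l (no  _) = sep-+ r (sep-lookup r _) (sep-constant r _)

      deg-cardinal : ∀ k x v → Deg≤ N (λ t → cardinal k (line x v t))
      deg-cardinal k x v = deg-weaken (ℕ.≤-reflexive (ℕ.*-identityʳ N)) (deg-prod (λ l → deg-factor l (k Fin.≟ l)))
        where
        deg-factor : ∀ l k≟l → Deg≤ 1 (λ t → factor k l k≟l (line x v t))
        deg-factor l (yes _) = deg-constant 1 1#
        deg-factor l (no k≢l) = deg-+ (v i , poly-cong refl (λ t → sym (lookup-line x v t i))
            (poly-affine (Vec.lookup x i) (v i))) (deg-constant 1 _)
          where i = proj₁ (Vec-differ _≟_ (z k) (z l) (distinct k≢l))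

      moments : Vec Carrier r → Fin r → Carrier
      moments y j = moment (toℕ j) y

      sep-moment : ∀ j → SepDeg r r (λ y → moments y j)
      sep-moment j = sep-+ r (sep-constant r a) (sep-sum r (λ i → sep-scale r (b i)
        (sep-weaken r (ℕ.≤-trans (ℕ.≤-reflexive (ℕ.*-identityʳ _)) (Fin.toℕ<n j))
            (sep-^ r (suc (toℕ j)) (sep-lookup r i)))))

      -- In each variable the interpolation polynomial has degree at most N, and each of the r
      -- moments has degree at most r and exponent below A. This gives the value of `degree`.
      term : Fin N → Fin (A ℕ.^ r) → Vec Carrier r → Carrier
      term k i y = cardinal k y * mono A r i (moments y)

      degree = N ℕ.+ r ℕ.* (A ℕ.* r)

      sep-term : ∀ k i → SepDeg r degree (term k i)
      sep-term k i = sep-* r (sep-cardinal k) (sep-mono r A r i sep-moment)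

      point = Fin.remQuot {N} (A ℕ.^ r)

      combination : (Fin (N ℕ.* A ℕ.^ r) → Carrier) → Vec Carrier r → Carrier
      combination κ y = sum (λ q → κ q * term (proj₁ (point q)) (proj₂ (point q)) y)

      order : Fin (N ℕ.* A ℕ.^ r) → ℕ
      order q = tdeg A r (proj₂ (point q))

      -- Lowest-order analysis of a vanishing combination along the line through z k in direction v.
      -- All moments vanish at z k, so a term of order o carries the factor t^o. With the
      -- coefficients below order m already known to be zero, t^m can be divided out; truncated
      -- subtraction in `reduced` does no harm for the same reason.
      module Local (κ : Fin (N ℕ.* A ℕ.^ r) → Carrier) (vanish : ∀ y → combination κ y ≡ 0#)
        (m : ℕ) (below : ∀ q → order q ℕ.< m → κ q ≡ 0#) (k : Fin N) (v : Fin r → Carrier) where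

        reduced : Fin (N ℕ.* A ℕ.^ r) → Carrier → Carrier
        reduced q t = κ q * (cardinal (proj₁ (point q)) (line (z k) v t) *
            (t ^ (order q ℕ.∸ m) * mono A r (proj₂ (point q)) (λ j → slope (z k) v (toℕ j) t)))

        term-line : ∀ q t → κ q * term (proj₁ (point q)) (proj₂ (point q)) (line (z k) v t) ≡ t ^ m * reduced q t
        term-line q t = [ low , high ]′ (ℕ.<-≤-connex (order q) m)
          where
          open ≡-Reasoning
          i = proj₂ (point q)
          C = cardinal (proj₁ (point q)) (line (z k) v t)
          M = mono A r i (λ j → slope (z k) v (toℕ j) t)
          low : order q ℕ.< m → κ q * term (proj₁ (point q)) i (line (z k) v t) ≡ t ^ m * reduced q t
          low o<m = trans (trans (cong (_* term (proj₁ (point q)) i (line (z k) v t)) (below q o<m)) (zeroˡ _))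
            (sym (trans (cong (t ^ m *_) (trans (cong (_* (C * (t ^ (order q ℕ.∸ m) * M))) (below q o<m))
                (zeroˡ _))) (zeroʳ _)))
          high : m ℕ.≤ order q → κ q * term (proj₁ (point q)) i (line (z k) v t) ≡ t ^ m * reduced q t
          high m≤o = begin
            κ q * (C * mono A r i (moments (line (z k) v t)))
              ≡⟨ cong (λ u → κ q * (C * u)) (mono-cong A r i
                  (λ j → trans (moment-line (z k) v (toℕ j) t)
                  (trans (cong (_+ t * slope (z k) v (toℕ j) t) (proj₂ (shape k) j)) (+-identityˡ _)))) ⟩
            κ q * (C * mono A r i (λ j → t * slope (z k) v (toℕ j) t))
              ≡⟨ cong (λ u → κ q * (C * u)) (mono-scale A r i t (λ j → slope (z k) v (toℕ j) t)) ⟩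
            κ q * (C * (t ^ order q * M))
              ≡⟨ cong (λ o → κ q * (C * (t ^ o * M))) (ℕ.m+[n∸m]≡n m≤o) ⟨
            κ q * (C * (t ^ (m ℕ.+ (order q ℕ.∸ m)) * M))
              ≡⟨ cong (λ u → κ q * (C * (u * M))) (^-homo-* t m (order q ℕ.∸ m)) ⟩
            κ q * (C * (t ^ m * t ^ (order q ℕ.∸ m) * M))
              ≡⟨ solve 5 (λ k c u w m → k :* (c :* (u :* w :* m)) := u :* (k :* (c :* (w :* m)))) refl (κ q) C
                  (t ^ m) (t ^ (order q ℕ.∸ m)) M ⟩
            t ^ m * reduced q t ∎

        total : Carrier → Carrier
        total t = sum (λ q → reduced q t)

        total-off-origin : ∀ t → t ≢ 0# → total t ≡ 0#
        total-off-origin t t≢0 = [ (λ t^m≡0 → contradiction t^m≡0 (^≢0 1<p m t≢0)) , id ]′ (noZeroDivisors (trans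
          (*-distribˡ-sum {N ℕ.* A ℕ.^ r} (t ^ m) (λ q → reduced q t))
              (trans (sym (sum-cong-≗ {N ℕ.* A ℕ.^ r} (λ q → term-line q t))) (vanish (line (z k) v t)))))

        deg-total : Deg≤ (N ℕ.+ (r ℕ.* A ℕ.+ r ℕ.* (A ℕ.* r))) total
        deg-total = deg-sum (λ q → deg-scale (κ q) (deg-* (deg-cardinal (proj₁ (point q)) (z k) v)
          (deg-* (deg-power (order q ℕ.∸ m) (ℕ.≤-trans (ℕ.m∸n≤m (order q) m) (tdeg≤ A r (proj₂ (point q)))))
              (deg-mono A r (proj₂ (point q)) (deg-slope (z k) v)))))

        -- Evaluation of the divided combination at t = 0. The interpolation factors remove all
        -- points but z k. The factor `0# ^ (tdeg A r i ℕ.∸ m)` selects the terms of order exactly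
        -- m: it is 1 at exponent 0 and 0 above, and lower orders have coefficient zero.
        initialForm : suc (N ℕ.+ (r ℕ.* A ℕ.+ r ℕ.* (A ℕ.* r))) ℕ.< p →
          sum (λ i → (κ (Fin.combine k i) * 0# ^ (tdeg A r i ℕ.∸ m)) * mono A r i (jacobian (z k) v)) ≡ 0#
        initialForm bound = [ (λ C≡0 → contradiction C≡0 (cardinal-≡ k)) , id ]′ (noZeroDivisors (begin
          cardinal k (z k) * sum (λ i → (κ (Fin.combine k i) * 0# ^ (tdeg A r i ℕ.∸ m)) * mono A r i (jacobian (z k) v))
            ≡⟨ *-distribˡ-sum {A ℕ.^ r} (cardinal k (z k)) _ ⟩
          sum (λ i → cardinal k (z k) * ((κ (Fin.combine k i) * 0# ^ (tdeg A r i ℕ.∸ m)) * mono A r i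
              (jacobian (z k) v)))
            ≡⟨ sum-cong-≗ {A ℕ.^ r} (λ i → trans
                (solve 4 (λ c k w m → c :* ((k :* w) :* m) := k :* (c :* (w :* m))) refl (cardinal k (z k))
                (κ (Fin.combine k i)) (0# ^ (tdeg A r i ℕ.∸ m)) (mono A r i (jacobian (z k) v)))
                 (sym (reduced-combine k i))) ⟩
          sum (λ i → reduced (Fin.combine k i) 0#)
            ≡⟨ sum-single (λ (l : Fin N) → sum (λ (i : Fin (A ℕ.^ r)) → reduced (Fin.combine l i) 0#)) k
                (λ l l≢k → sum-zero {A ℕ.^ r} (λ i → trans (reduced-combine l i)
                 (trans (cong (κ (Fin.combine l i) *_) (trans (cong (_* _) (cardinal-≢ l≢k)) (zeroˡ _))) (zeroʳ _)))) ⟨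
          sum (λ (l : Fin N) → sum (λ (i : Fin (A ℕ.^ r)) → reduced (Fin.combine l i) 0#))
            ≡⟨ sum-combine N {A ℕ.^ r} (λ q → reduced q 0#) ⟨
          total 0#
            ≡⟨ zeroOffOrigin⇒zero bound deg-total total-off-origin 0# ⟩
          0# ∎))
          where
          open ≡-Reasoning
          reduced-combine : ∀ l i → reduced (Fin.combine l i) 0# ≡ κ (Fin.combine l i) *
              (cardinal l (z k) * (0# ^ (tdeg A r i ℕ.∸ m) * mono A r i (jacobian (z k) v)))
          reduced-combine l i = cong₂ (λ li x → κ (Fin.combine l i) *
              (cardinal (proj₁ li) x * (0# ^ (tdeg A r (proj₂ li) ℕ.∸ m) * mono A r (proj₂ li) (jacobian (z k) v))))
            (Fin.remQuot-combine {N} {A ℕ.^ r} l i) (line-0 (z k) v)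

      -- Induction on the order m. The form of degree m at z k vanishes on the values of the
      -- Jacobian, so everywhere, so its coefficients are zero.
      κ≡0 : A ℕ.< p → suc (N ℕ.+ (r ℕ.* A ℕ.+ r ℕ.* (A ℕ.* r))) ℕ.< p →
        ∀ κ → (∀ y → combination κ y ≡ 0#) → ∀ m q → order q ℕ.< m → κ q ≡ 0#
      κ≡0 A<p bound κ vanish (suc m) q o<sm = [ κ≡0 A<p bound κ vanish m q , initial ]′ (ℕ.m≤n⇒m<n∨m≡n (ℕ.≤-pred o<sm))
        where
        open ≡-Reasoning
        k = proj₁ (point q)
        i = proj₂ (point q)
        form : ∀ e → sum (λ i → (κ (Fin.combine k i) * 0# ^ (tdeg A r i ℕ.∸ m)) * mono A r i e) ≡ 0#
        form e = trans (sum-cong-≗ {A ℕ.^ r} (λ i → cong ((κ (Fin.combine k i) * 0# ^ (tdeg A r i ℕ.∸ m)) *_)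
            (mono-cong A r i (λ j → sym (proj₂ v j)))))
            (Local.initialForm κ vanish m (κ≡0 A<p bound κ vanish m) k (proj₁ v) bound)
          where v = jacobian-surjective (z k) (proj₁ (shape k)) e
        initial : order q ≡ m → κ q ≡ 0#
        initial o≡m = begin
          κ q                                    ≡⟨ cong κ (sym (Fin.combine-remQuot {N} (A ℕ.^ r) q)) ⟩
          κ (Fin.combine k i)                    ≡⟨ *-identityʳ _ ⟨
          κ (Fin.combine k i) * 1#
              ≡⟨ cong (λ o → κ (Fin.combine k i) * 0# ^ o) (trans (cong (ℕ._∸ m) o≡m) (ℕ.n∸n≡0 m)) ⟨
          κ (Fin.combine k i) * 0# ^ (order q ℕ.∸ m)
              ≡⟨ coefficients≡0 A A<p r (λ i → κ (Fin.combine k i) * 0# ^ (tdeg A r i ℕ.∸ m)) form i ⟩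
          0# ∎

    -- With more products than grid points, linear algebra gives a nontrivial combination that
    -- vanishes on the grid. By its degree it vanishes identically, against the independence just
    -- shown.
    bezout : A ℕ.< p → suc (N ℕ.+ (r ℕ.* A ℕ.+ r ℕ.* (A ℕ.* r))) ℕ.< p → ¬ suc (N ℕ.+ r ℕ.* (A ℕ.* r)) ℕ.^ r ℕ.< N
        ℕ.* A ℕ.^ r
    bezout A<p bound few = proj₂ (proj₁ (proj₂ kernel)) (κ≡0 A<p bound κ
        (zeroOnGrid⇒zero degree<p r (sep-sum r
            (λ q → sep-scale r (κ q) (sep-term (proj₁ (point q)) (proj₂ (point q))))) (proj₂ (proj₂ kernel)))
            (suc (order _)) _ ℕ.≤-refl)
      where
      kernel = nontrivialKernel few (λ l q → term (proj₁ (point q)) (proj₂ (point q)) (gridPoint (suc degree) r l))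
      κ = proj₁ kernel
      degree<p : degree ℕ.< p
      degree<p = ℕ.≤-trans (s≤s (ℕ.+-monoʳ-≤ N (ℕ.m≤n+m _ (r ℕ.* A)))) (ℕ.<⇒≤ bound)

-- Shapes along a tower of quadratic extensions

module Tower {p : ℕ} (2<p : 2 ℕ.< p) (r : ℕ) (r<p : r ℕ.< p)
  (c : Fin (suc (suc r)) → ℤ) (c≢0 : ∀ i → c i ≢ 0ℤ) (∣c∣<p : ∀ i → ℤ.∣ c i ∣ ℕ.< p) where

  1<p : 1 ℕ.< p
  1<p = ℕ.<-trans ℕ.≤-refl 2<p

  module ShapesIn (F : FiniteField p) where
    open FieldTheory F
    open Bezout 1<p F r r<p (ι (c (Fin.suc Fin.zero))) (λ i → ι (c (Fin.suc (Fin.suc i))))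
        (λ i → ι≢0 (c≢0 _) (∣c∣<p _)) public

    anyVec? : ∀ {P : Vec Carrier r → Set} → (∀ y → Dec (P y)) → Dec (∃ P)
    anyVec? {P} P? = map′ (λ (k , Pk) → vector k , Pk) (λ (y , Py) → code y , subst P (sym (vector-code y)) Py)
        (Fin.any? (P? ∘ vector))
      where
      vector : Fin (size ℕ.^ r) → Vec Carrier r
      vector k = Vec.tabulate (element ∘ Fin.finToFun k)
      code : Vec Carrier r → Fin (size ℕ.^ r)
      code y = Fin.funToFin (index ∘ Vec.lookup y)
      vector-code : ∀ y → vector (code y) ≡ y
      vector-code y = trans (Vec.tabulate-cong
          (λ i → trans (cong element (Fin.finToFun-funToFin (index ∘ Vec.lookup y) i)) (element∘index _)))
          (Vec.tabulate∘lookup y)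

    isShape? : ∀ y → Dec (IsShape y)
    isShape? y = map′ (λ inj {i} {l} → inj i l) (λ inj i l → inj {i} {l})
        (Fin.all? λ i → Fin.all? λ l → (Vec.lookup y i ≟ Vec.lookup y l) →-dec (i Fin.≟ l))
      ×-dec Fin.all? λ j → moment (toℕ j) y ≟ 0#

  module _ {F : FiniteField p} (E : QuadraticExtension F) where
    open QuadraticExtension E
    private
      module k = FieldTheory F
      module K = FieldTheory K
      module k-shapes = ShapesIn F
      module K-shapes = ShapesIn K

    -- Every shape over the extension is already defined over the field below.
    Saturated : Set
    Saturated = ∀ y → K-shapes.IsShape y → ∀ i → im (Vec.lookup y i) ≡ k.0#

    NewShape : Set
    NewShape = ∃ λ y → K-shapes.IsShape y × ∃ λ i → im (Vec.lookup y i) ≢ k.0#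

    newShape? : Dec NewShape
    newShape? = K-shapes.anyVec? (λ y → K-shapes.isShape? y ×-dec Fin.any? (λ i → ¬? (im (Vec.lookup y i) k.≟ k.0#)))

    saturated : ¬ NewShape → Saturated
    saturated ¬new y y-shape i = [ (λ neq → contradiction (y , y-shape , i , neq) ¬new) , id ]′ (k.zero-or-not _)

    embed-shape : ∀ y → k-shapes.IsShape y → K-shapes.IsShape (Vec.map embed y)
    embed-shape y (inj , moments≡0) =
      (λ {i} {l} eq → inj (embed-injective (trans (sym (Vec.lookup-map i embed y))
          (trans eq (Vec.lookup-map l embed y))))) ,
      (λ j → trans (sym (embed-moment (toℕ j))) (trans (cong embed (moments≡0 j)) embed-0))
      where
      embed-moment : ∀ j → embed (k-shapes.moment j y) ≡ K-shapes.moment j (Vec.map embed y)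
      embed-moment j = trans (embed-+ _ _) (cong₂ K._+_ (embed-ι _) (trans (embed-sum {r} _) (K.sum-cong-≗ {r} λ i →
        trans (embed-* _ _) (cong₂ K._*_ (embed-ι _)
            (trans (embed-^ _ (suc j)) (cong (K._^ suc j) (sym (Vec.lookup-map i embed y))))))))

  ShapeFamily : FiniteField p → ℕ → Set
  ShapeFamily F N = ∃ λ (z : Fin N → Vec (FiniteField.Carrier F) r) → (∀ l → ShapesIn.IsShape F (z l)) ×
      (∀ {l m} → l ≢ m → z l ≢ z m)

  enlarge : ∀ {F} (E : QuadraticExtension F) {N} → ShapeFamily F N → NewShape E → ShapeFamily
      (QuadraticExtension.K E) (suc N)
  enlarge E {N} (z , z-shape , z-distinct) (y , y-shape , i , y∉k) = z′ , z′-shape , z′-distinct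
    where
    open QuadraticExtension E
    z′ : Fin (suc N) → Vec (FiniteField.Carrier K) r
    z′ Fin.zero    = y
    z′ (Fin.suc l) = Vec.map embed (z l)
    z′-shape : ∀ l → ShapesIn.IsShape K (z′ l)
    z′-shape Fin.zero    = y-shape
    z′-shape (Fin.suc l) = embed-shape E (z l) (z-shape l)
    y≢ : ∀ l → y ≢ Vec.map embed (z l)
    y≢ l eq = y∉k (trans (cong (λ x → im (Vec.lookup x i)) eq)
        (trans (cong im (Vec.lookup-map i embed (z l))) (im-embed _)))
    unembed : ∀ l → Vec.map re (Vec.map embed (z l)) ≡ z l
    unembed l = trans (sym (Vec.map-∘ re embed (z l))) (trans (Vec.map-cong re-embed (z l)) (Vec.map-id (z l)))
    z′-distinct : ∀ {l m} → l ≢ m → z′ l ≢ z′ m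
    z′-distinct {Fin.zero}  {Fin.zero}  l≢m = contradiction refl l≢m
    z′-distinct {Fin.zero}  {Fin.suc m} l≢m = y≢ m
    z′-distinct {Fin.suc l} {Fin.zero}  l≢m = y≢ l ∘ sym
    z′-distinct {Fin.suc l} {Fin.suc m} l≢m eq = z-distinct (l≢m ∘ cong Fin.suc)
        (trans (sym (unembed l)) (trans (cong (Vec.map re) eq) (unembed m)))

  SaturatedPair : Set₁
  SaturatedPair = ∃ λ F → ∃ λ (E : QuadraticExtension F) → Saturated E

  -- Each step either is saturated or adds a shape with a coordinate outside the field below, hence
  -- distinct from all embedded ones. Without a saturated step, N steps therefore produce N shapes.
  climb : FiniteField p → ∀ N → SaturatedPair ⊎ (∃ λ F → ShapeFamily F N)
  climb F₀ zero    = inj₂ (F₀ , (λ ()) , (λ ()) , λ {})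
  climb F₀ (suc N) = [ inj₁ , (λ (F , family) → extend (Quadratic.quadraticExtension 2<p F) family) ]′ (climb F₀ N)
    where
    extend : ∀ {F} (E : QuadraticExtension F) → ShapeFamily F N → SaturatedPair ⊎ (∃ λ F → ShapeFamily F (suc N))
    extend E family with newShape? E
    ... | yes new = inj₂ (QuadraticExtension.K E , enlarge E family new)
    ... | no ¬new = inj₁ (_ , E , saturated E ¬new)

  saturatedPair : FiniteField p → ∀ N A → A ℕ.< p → suc (N ℕ.+ (r ℕ.* A ℕ.+ r ℕ.* (A ℕ.* r))) ℕ.< p →
    suc (N ℕ.+ r ℕ.* (A ℕ.* r)) ℕ.^ r ℕ.< N ℕ.* A ℕ.^ r → SaturatedPair
  saturatedPair F₀ N A A<p bound few = [ id ,
      (λ (F , z , z-shape , z-distinct) → ⊥-elim (ShapesIn.bezout F N A z z-shape z-distinct A<p bound few)) ]′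
      (climb F₀ N)

-- The L-free alphabet

module BlockSums {p : ℕ} (1<p : 1 ℕ.< p) (F : FiniteField p) where

  open LinearAlgebra 1<p F

  -- Take the polynomial φ that vanishes at all values other than x j. The moments kill Σ w_i
  -- φ(x_i), which is φ(x j) times the block sum.
  blockSum≡0 : ∀ {n m} (w x : Fin n → Carrier) j nodes → (∀ l → l ℕ.≤ m → sum (λ i → w i * x i ^ l) ≡ 0#) → length
      nodes ℕ.≤ m →
    ¬ x j ∈ nodes → (∀ i → x i ≢ x j → x i ∈ nodes) → sum (λ i → if does (x i ≟ x j) then w i else 0#) ≡ 0#
  blockSum≡0 {n} w x j nodes powers length≤m xj∉ x∈ = [ (λ φ≡0 → contradiction φ≡0 (vanishingAt-∉ 1<p xj∉)) , id ]′
      (noZeroDivisors (begin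
    φ (x j) * sum (λ i → if does (x i ≟ x j) then w i else 0#)      ≡⟨ *-distribˡ-sum {n} (φ (x j)) _ ⟩
    sum (λ i → φ (x j) * (if does (x i ≟ x j) then w i else 0#))    ≡⟨ sum-cong-≗ {n} (λ i → select i (x i ≟ x j)) ⟩
    sum (λ i → w i * φ (x i))
        ≡⟨ poly-annihilate w x (proj₂ φ-poly) (λ l l< → powers l (ℕ.≤-trans (ℕ.<⇒≤ l<) length≤m)) ⟩
    proj₁ φ-poly * sum (λ i → w i * x i ^ length nodes)
        ≡⟨ cong (proj₁ φ-poly *_) (powers (length nodes) length≤m) ⟩
    proj₁ φ-poly * 0#                                              ≡⟨ zeroʳ _ ⟩
    0#                                                             ∎))
    where
    open ≡-Reasoning
    φ = vanishingAt nodes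
    φ-poly = poly-vanishingAt nodes
    select : ∀ i (d : Dec (x i ≡ x j)) → φ (x j) * (if does d then w i else 0#) ≡ w i * φ (x i)
    select i (yes eq) = trans (*-comm _ _) (cong (λ t → w i * φ t) (sym eq))
    select i (no neq) = trans (zeroʳ _) (sym (trans (cong (w i *_) (vanishingAt-∈ (x∈ i neq))) (zeroʳ _)))

  -- A repeated node lowers the number of distinct values, so that the moments of order at most s − 2 suffice.
  repeated⇒blockSum≡0 : ∀ {r} (w x : Fin (suc (suc r)) → Carrier) → (∀ l → l ℕ.≤ r → sum (λ i → w i * x i ^ l) ≡ 0#) →
    ∀ {a a′} → a ≢ a′ → x a ≡ x a′ → ∀ j → sum (λ i → if does (x i ≟ x j) then w i else 0#) ≡ 0#
  repeated⇒blockSum≡0 {r} w x powers {a} {a′} a≢a′ xa≡xa′ j = result (a Fin.≟ j)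
    where
    -- The list `others` omits the indices a and b and so has r entries. The value at a still occurs
    -- at a′, and the value at b is the one to be excluded, so every value other than x j is listed.
    -- Below, b is a′ if a = j, and j otherwise.
    module _ (b : Fin (suc (suc r))) (a≢b : a ≢ b) (xb≡xj : x b ≡ x j) where
      others : Fin r → Carrier
      others l = x (Fin.punchIn a (Fin.punchIn (Fin.punchOut a≢b) l))
      nodes = List.filter (λ t → ¬? (t ≟ x j)) (List.tabulate others)
      listed : ∀ i → i ≢ a → i ≢ b → x i ≢ x j → x i ∈ nodes
      listed i i≢a i≢b neq = ∈-filter⁺ (λ t → ¬? (t ≟ x j))
          (subst (λ k → x k ∈ List.tabulate others) found (∈-tabulate⁺ {f = others} _)) neq
        where
        b≢i : Fin.punchOut a≢b ≢ Fin.punchOut (i≢a ∘ sym)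
        b≢i eq = i≢b (sym (Fin.punchOut-injective {i = a} a≢b (i≢a ∘ sym) eq))
        found : Fin.punchIn a (Fin.punchIn (Fin.punchOut a≢b) (Fin.punchOut b≢i)) ≡ i
        found = trans (cong (Fin.punchIn a) (Fin.punchIn-punchOut b≢i)) (Fin.punchIn-punchOut (i≢a ∘ sym))
      complete : ∀ i → Dec (i ≡ a) → x i ≢ x j → x i ∈ nodes
      complete i (yes refl) neq = subst (_∈ nodes) (sym xa≡xa′)
          (listed a′ (a≢a′ ∘ sym) (λ a′≡b → neq (trans xa≡xa′ (trans (cong x a′≡b) xb≡xj))) (neq ∘ trans xa≡xa′))
      complete i (no i≢a)   neq = listed i i≢a (λ i≡b → neq (trans (cong x i≡b) xb≡xj)) neq
      conclusion : sum (λ i → if does (x i ≟ x j) then w i else 0#) ≡ 0#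
      conclusion = blockSum≡0 w x j nodes powers
        (ℕ.≤-trans (List.length-filter (λ t → ¬? (t ≟ x j)) (List.tabulate others))
            (ℕ.≤-reflexive (List.length-tabulate others)))
        (λ xj∈ → proj₂ (∈-filter⁻ (λ t → ¬? (t ≟ x j)) {xs = List.tabulate others} xj∈) refl)
        (λ i → complete i (i Fin.≟ a))
    result : Dec (a ≡ j) → sum (λ i → if does (x i ≟ x j) then w i else 0#) ≡ 0#
    result (yes refl) = conclusion a′ a≢a′ (sym xa≡xa′)
    result (no a≢j)   = conclusion j a≢j refl

  module RootlessForm (r : ℕ) (r≥1 : 1 ℕ.≤ r) where

    private
      -- Chosen because it is 0 at both 0 and 1, over any field; hence it misses some w.
      value : Carrier → Carrier
      value t = t ^ suc r - t ^ r

      0^ : ∀ n → 1 ℕ.≤ n → 0# ^ n ≡ 0#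
      0^ (suc n) _ = zeroˡ _

      missed : ∃ λ w → ∀ t → value t ≢ w
      missed = notInjective⇒misses value (1≢0 1<p ∘ sym)
        (trans (cong₂ _-_ (0^ (suc r) (s≤s z≤n)) (0^ r r≥1))
            (trans (-‿inverseʳ 0#) (sym (trans (cong₂ _-_ (1^ (suc r)) (1^ r)) (-‿inverseʳ 1#)))))

      w = proj₁ missed

    -- Homogenisation of t^(r+1) - t^r - w. A zero with v ≠ 0 would make u/v a preimage of the
    -- missed value w, and for v = 0 only u^(r+1) remains.
    form : Carrier → Carrier → Carrier
    form u v = (u ^ suc r - u ^ r * v) - w * v ^ suc r

    form≡0 : ∀ u v → form u v ≡ 0# → u ≡ 0# × v ≡ 0#
    form≡0 u v eq = [ (λ v≢0 → contradiction eq (form≢0 v≢0)) , (λ v≡0 → u≡0 v≡0 , v≡0) ]′ (zero-or-not v)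
      where
      form≢0 : v ≢ 0# → form u v ≢ 0#
      form≢0 v≢0 eq = [ ^≢0 1<p (suc r) v≢0 , (λ d≡0 → proj₂ missed t (x-y≡0⇒x≡y d≡0)) ]′ (noZeroDivisors (begin
        v ^ suc r * (value t - w)
          ≡⟨ solve 6 (λ v p q t a w → v :* q :* ((t :* a :- a) :- w) := ((t :* v) :* (a :* q) :- (a :* q) :* v) :- w
              :* (v :* q)) refl v (v ^ suc r) (v ^ r) t (t ^ r) w ⟩
        ((t * v) * (t ^ r * v ^ r) - (t ^ r * v ^ r) * v) - w * v ^ suc r
          ≡⟨ cong (λ a → ((t * v) * a - a * v) - w * v ^ suc r) (^-distrib-* t v r) ⟨
        form (t * v) v
          ≡⟨ cong (λ a → form a v) tv≡u ⟩
        form u v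
          ≡⟨ eq ⟩
        0# ∎))
        where
        open ≡-Reasoning
        v⁻¹ = proj₁ (inverse v≢0)
        t = u * v⁻¹
        tv≡u : t * v ≡ u
        tv≡u = trans (solve 3 (λ u i v → u :* i :* v := u :* (v :* i)) refl u v⁻¹ v)
            (trans (cong (u *_) (proj₂ (inverse v≢0))) (*-identityʳ u))
      u≡0 : v ≡ 0# → u ≡ 0#
      u≡0 v≡0 = [ (λ u≢0 → contradiction u^≡0 (^≢0 1<p (suc r) u≢0)) , id ]′ (zero-or-not u)
        where
        u^≡0 : u ^ suc r ≡ 0#
        u^≡0 = begin
          u ^ suc r ≡⟨ solve 3 (λ a b c → a := (a :- b :* con 0ℤ) :- c :* con 0ℤ) refl (u ^ suc r) (u ^ r) w ⟩
          (u ^ suc r - u ^ r * ι 0ℤ) - w * ι 0ℤ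
              ≡⟨ cong₂ (λ a b → (u ^ suc r - u ^ r * a) - w * b) (trans ι-0 (sym v≡0))
              (trans ι-0 (sym (trans (cong (_* v ^ r) v≡0) (zeroˡ _)))) ⟩
          form u v  ≡⟨ eq ⟩
          0# ∎
          where open ≡-Reasoning

    -- On a line a form of degree r + 1 has its value at the direction as the coefficient of
    -- t^(r+1). As the form has no nontrivial zeros, this coefficient is nonzero.
    poly-form : ∀ a₁ a₂ b₁ b₂ → Poly (suc r) (form b₁ b₂) (λ t → form (a₁ + t * b₁) (a₂ + t * b₂))
    poly-form a₁ a₂ b₁ b₂ = poly-minus (poly-minus (power (suc r) a₁ b₁)
        (cast (ℕ.+-comm r 1) (poly-* (power r a₁ b₁) (poly-affine a₂ b₂)))) (poly-scale w (power (suc r) a₂ b₂))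
      where
      cast : ∀ {m n c φ} → m ≡ n → Poly m c φ → Poly n c φ
      cast refl P = P
      power : ∀ n a b → Poly n (b ^ n) (λ t → (a + t * b) ^ n)
      power n a b = cast (ℕ.*-identityʳ n) (poly-^ n (poly-affine a b))
      poly-minus : ∀ {n c d φ ψ} → Poly n c φ → Poly n d ψ → Poly n (c - d) (λ t → φ t - ψ t)
      poly-minus {c = c} {d} {φ} {ψ} P Q = poly-cong (minus c d) (λ t → minus (φ t) (ψ t))
          (poly-+ P (poly-scale (ι (ℤ.- 1ℤ)) Q))
        where
        minus : ∀ a b → a + ι (ℤ.- 1ℤ) * b ≡ a - b
        minus = solve 2 (λ a b → a :+ con (ℤ.- 1ℤ) :* b := a :- b) refl

module Curve {p : ℕ} (2<p : 2 ℕ.< p) (r : ℕ) (r≥1 : 1 ℕ.≤ r) (r<p : r ℕ.< p)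
  (c : Fin (suc (suc r)) → ℤ) (c≢0 : ∀ i → c i ≢ 0ℤ) (∣c∣<p : ∀ i → ℤ.∣ c i ∣ ℕ.< p) (sum-c≡0 : sumℤ c ≡ 0ℤ)
  {F : FiniteField p} (E : QuadraticExtension F) (saturated : Tower.Saturated 2<p r r<p c c≢0 ∣c∣<p E) where

  private
    s = suc (suc r)
    1<p = ℕ.<-trans ℕ.≤-refl 2<p
    module Q = QuadraticExtension E
    module k where
      open LinearAlgebra 1<p F public
      open BlockSums 1<p F public
      open RootlessForm r r≥1 public
    module K where
      open LinearAlgebra 1<p Q.K public
      open BlockSums 1<p Q.K public
      open Tower.ShapesIn 2<p r r<p c c≢0 ∣c∣<p Q.K public using (IsShape)

  -- In general not the field norm: the binary form of degree s - 1 above, in the coordinates of K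
  -- over k. What it shares with a norm is homogeneity and the absence of nontrivial zeros.
  norm : K.Carrier → k.Carrier
  norm x = k.form (Q.re x) (Q.im x)

  module _ (x : Fin s → K.Carrier)
    (powers : ∀ (j : Fin r) → K.sum (λ i → K.ι (c i) K.* x i K.^ suc (toℕ j)) ≡ K.0#)
    (norms : k.sum (λ i → k.ι (c i) k.* norm (x i)) ≡ k.0#) where

    private
      powers′ : ∀ l → l ℕ.≤ r → K.sum (λ i → K.ι (c i) K.* x i K.^ l) ≡ K.0#
      powers′ zero    _   = trans (K.sum-cong-≗ {s} (λ i → K.*-identityʳ (K.ι (c i))))
          (trans (sym (K.ι-sum c)) (trans (cong K.ι sum-c≡0) K.ι-0))
      powers′ (suc l) l<r = subst (λ j → K.sum (λ i → K.ι (c i) K.* x i K.^ suc j) ≡ K.0#) (Fin.toℕ-fromℕ< l<r)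
          (powers (Fin.fromℕ< l<r))

      module Distinct (x-inj : Injective _≡_ _≡_ x) where

        x₀ = x Fin.zero
        β = x (Fin.suc Fin.zero) K.- x₀

        β≢0 : β ≢ K.0#
        β≢0 β≡0 with () ← x-inj (K.x-y≡0⇒x≡y β≡0)

        β⁻¹ = proj₁ (K.inverse β≢0)

        ν : Fin s → K.Carrier
        ν i = (x i K.- x₀) K.* β⁻¹

        ν₀ : ν Fin.zero ≡ K.0#
        ν₀ = trans (cong (K._* β⁻¹) (K.-‿inverseʳ x₀)) (K.zeroˡ _)

        ν₁ : ν (Fin.suc Fin.zero) ≡ K.1#
        ν₁ = proj₂ (K.inverse β≢0)

        x≡ : ∀ i → x i ≡ x₀ K.+ ν i K.* β
        x≡ i = begin
          x i                                       ≡⟨ K.solve 2 (λ a b → a K.:= b K.:+ (a K.:- b)) refl (x i) x₀ ⟩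
          x₀ K.+ (x i K.- x₀)                       ≡⟨ cong (λ u → x₀ K.+ u) (K.*-identityʳ _) ⟨
          x₀ K.+ (x i K.- x₀) K.* K.1#              ≡⟨ cong (λ u → x₀ K.+ (x i K.- x₀) K.* u) ν₁ ⟨
          x₀ K.+ (x i K.- x₀) K.* (β K.* β⁻¹)
              ≡⟨ cong (λ u → x₀ K.+ u) (K.solve 3 (λ d b i → d K.:* (b K.:* i) K.:= d K.:* i K.:* b) refl
              (x i K.- x₀) β β⁻¹) ⟩
          x₀ K.+ ν i K.* β                          ∎
          where open ≡-Reasoning

        ν-inj : Injective _≡_ _≡_ ν
        ν-inj {i} {l} eq = x-inj (trans (x≡ i) (trans (cong (λ u → x₀ K.+ u K.* β) eq) (sym (x≡ l))))

        ν-poly : ∀ l → K.Deg≤ l (λ t → ((t K.- x₀) K.* β⁻¹) K.^ l)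
        ν-poly l = K.deg-weaken (ℕ.≤-reflexive (ℕ.*-identityʳ l)) (K.deg-^ l (β⁻¹ , K.poly-cong refl
          (λ t → K.solve 3 (λ t x b → K.:- (x K.:* b) K.:+ t K.:* b K.:= (t K.:- x) K.:* b) refl t x₀ β⁻¹)
              (K.poly-affine (K.- (x₀ K.* β⁻¹)) β⁻¹)))

        -- The l-th power of an affine function is a polynomial of degree l, so an affine change of
        -- the nodes preserves the vanishing of all moments up to order r.
        ν-powers : ∀ l → l ℕ.≤ r → K.sum (λ i → K.ι (c i) K.* ν i K.^ l) ≡ K.0#
        ν-powers l l≤r = trans (K.poly-annihilate (λ i → K.ι (c i)) x (proj₂ (ν-poly l))
            (λ j j<l → powers′ j (ℕ.≤-trans (ℕ.<⇒≤ j<l) l≤r)))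
          (trans (cong (proj₁ (ν-poly l) K.*_) (powers′ l l≤r)) (K.zeroʳ _))

        y : Vec K.Carrier r
        y = Vec.tabulate (λ i → ν (Fin.suc (Fin.suc i)))

        lookup-y : ∀ i → Vec.lookup y i ≡ ν (Fin.suc (Fin.suc i))
        lookup-y i = Vec.lookup∘tabulate _ i

        y-moment : ∀ (j : Fin r) → K.ι (c (Fin.suc Fin.zero)) K.+ K.sum
            (λ i → K.ι (c (Fin.suc (Fin.suc i))) K.* Vec.lookup y i K.^ suc (toℕ j)) ≡ K.0#
        y-moment j = begin
          K.ι (c (Fin.suc Fin.zero)) K.+ K.sum (λ i → K.ι (c (Fin.suc (Fin.suc i))) K.* Vec.lookup y i K.^ n)
            ≡⟨ cong₂ K._+_ (trans (sym (K.*-identityʳ _))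
                (cong (λ u → K.ι (c (Fin.suc Fin.zero)) K.* u) (sym (trans (cong (K._^ n) ν₁) (K.1^ n)))))
                 (K.sum-cong-≗ {r} (λ i → cong (λ u → K.ι (c (Fin.suc (Fin.suc i))) K.* u K.^ n) (lookup-y i))) ⟩
          tail
            ≡⟨ K.+-identityˡ _ ⟨
          K.0# K.+ tail
            ≡⟨ cong (K._+ tail) (sym (trans (cong (K.ι (c Fin.zero) K.*_)
                (trans (cong (K._* ν Fin.zero K.^ toℕ j) ν₀) (K.zeroˡ _))) (K.zeroʳ _))) ⟩
          K.sum (λ i → K.ι (c i) K.* ν i K.^ n)
            ≡⟨ ν-powers n (Fin.toℕ<n j) ⟩
          K.0# ∎
          where
          open ≡-Reasoning
          n = suc (toℕ j)
          tail = K.ι (c (Fin.suc Fin.zero)) K.* ν (Fin.suc Fin.zero) K.^ n K.+ K.sum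
              (λ i → K.ι (c (Fin.suc (Fin.suc i))) K.* ν (Fin.suc (Fin.suc i)) K.^ n)

        y-shape : K.IsShape y
        y-shape = (λ {i} {l} eq → Fin.suc-injective
            (Fin.suc-injective (ν-inj (trans (sym (lookup-y i)) (trans eq (lookup-y l)))))) , y-moment

        μ : Fin s → k.Carrier
        μ i = Q.re (ν i)

        ν∈k : ∀ i → Q.im (ν i) ≡ k.0#
        ν∈k Fin.zero              = trans (cong Q.im (trans ν₀ (sym Q.embed-0))) (Q.im-embed _)
        ν∈k (Fin.suc Fin.zero)    = trans (cong Q.im (trans ν₁ (trans (sym K.ι-1) (sym (Q.embed-ι 1ℤ))))) (Q.im-embed _)
        ν∈k (Fin.suc (Fin.suc i)) = trans (cong Q.im (sym (lookup-y i))) (saturated y y-shape i)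

        ν≡μ : ∀ i → ν i ≡ Q.embed (μ i)
        ν≡μ i = Q.im≡0⇒embed-re (ν∈k i)

        μ-powers : ∀ l → l ℕ.≤ r → k.sum (λ i → k.ι (c i) k.* μ i k.^ l) ≡ k.0#
        μ-powers l l≤r = Q.embed-injective (trans (Q.embed-sum {s} (λ i → k.ι (c i) k.* μ i k.^ l))
            (trans (K.sum-cong-≗ {s} (λ i →
            trans (Q.embed-* _ _) (cong₂ K._*_ (Q.embed-ι (c i))
                (trans (Q.embed-^ (μ i) l) (cong (K._^ l) (sym (ν≡μ i)))))))
          (trans (ν-powers l l≤r) (sym Q.embed-0))))

        x-components : ∀ i → norm (x i) ≡ k.form (Q.re x₀ k.+ μ i k.* Q.re β) (Q.im x₀ k.+ μ i k.* Q.im β)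
        x-components i = trans (cong norm (trans (x≡ i) (cong (λ u → x₀ K.+ u K.* β) (ν≡μ i))))
            (cong₂ k.form (Q.re-affine x₀ (μ i) β) (Q.im-affine x₀ (μ i) β))

        -- All x_i lie on the line x₀ + tβ with parameters t = μ_i in k, where the form is a
        -- polynomial in t with leading coefficient `norm β`. The moments of order at most r remove
        -- its other terms.
        μ-top : k.sum (λ i → k.ι (c i) k.* μ i k.^ suc r) ≡ k.0#
        μ-top = [ (λ N≡0 → contradiction (norm≡0 N≡0) β≢0) , id ]′ (k.noZeroDivisors (begin
          norm β k.* k.sum (λ i → k.ι (c i) k.* μ i k.^ suc r)
            ≡⟨ k.poly-annihilate (λ i → k.ι (c i)) μ (k.poly-form (Q.re x₀) (Q.im x₀) (Q.re β) (Q.im β))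
                (λ j j<sr → μ-powers j (ℕ.≤-pred j<sr)) ⟨
          k.sum (λ i → k.ι (c i) k.* k.form (Q.re x₀ k.+ μ i k.* Q.re β) (Q.im x₀ k.+ μ i k.* Q.im β))
            ≡⟨ k.sum-cong-≗ {s} (λ i → cong (k.ι (c i) k.*_) (sym (x-components i))) ⟩
          k.sum (λ i → k.ι (c i) k.* norm (x i))
            ≡⟨ norms ⟩
          k.0# ∎))
          where
          open ≡-Reasoning
          norm≡0 : norm β ≡ k.0# → β ≡ K.0#
          norm≡0 eq = Q.re≡0,im≡0⇒≡0 (proj₁ (k.form≡0 _ _ eq)) (proj₂ (k.form≡0 _ _ eq))

        impossible : ⊥
        impossible = k.ι≢0 (c≢0 Fin.zero) (∣c∣<p Fin.zero) (k.vandermonde (λ i → k.ι (c i)) μ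
          (λ {i} {l} eq → ν-inj (trans (ν≡μ i) (trans (cong Q.embed eq) (sym (ν≡μ l)))))
          -- The orders 0, ..., r come from the powers and r + 1 from the form: s moments for s
          -- distinct nodes.
          (λ j j<s → [ (λ j<sr → μ-powers j (ℕ.≤-pred j<sr)) ,
              (λ j≡ → subst (λ n → k.sum (λ i → k.ι (c i) k.* μ i k.^ n) ≡ k.0#) (sym j≡) μ-top) ]′
              (ℕ.m≤n⇒m<n∨m≡n (ℕ.≤-pred j<s)))
          Fin.zero)

    blockSumsVanish : ∀ j → K.sum (λ i → if does (x i K.≟ x j) then K.ι (c i) else K.0#) ≡ K.0#
    blockSumsVanish = decide (Fin.any? (λ a → Fin.any? (λ a′ → ¬? (a Fin.≟ a′) ×-dec (x a K.≟ x a′))))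
      where
      decide : Dec (∃ λ a → ∃ λ a′ → a ≢ a′ × x a ≡ x a′) → ∀ j → K.sum
          (λ i → if does (x i K.≟ x j) then K.ι (c i) else K.0#) ≡ K.0#
      decide (yes (a , a′ , a≢a′ , eq)) = K.repeated⇒blockSum≡0 (λ i → K.ι (c i)) x powers′ a≢a′ eq
      decide (no ¬repeated) = ⊥-elim (Distinct.impossible (λ {a} {a′} eq → injective (a Fin.≟ a′) eq))
        where
        injective : ∀ {a a′} → Dec (a ≡ a′) → x a ≡ x a′ → a ≡ a′
        injective (yes a≡a′) _  = a≡a′
        injective (no a≢a′)  eq = contradiction (_ , _ , a≢a′ , eq) ¬repeated

private
  module ℤ-sum where
    open CommutativeMonoidSum ℤ.+-0-commutativeMonoid public
    open SemiringSum (CommutativeRing.semiring ℤ.+-*-commutativeRing) public using (*-distribˡ-sum; *-distribʳ-sum)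

sumℤ-zero : ∀ {n} {f : Fin n → ℤ} → (∀ i → f i ≡ 0ℤ) → sumℤ f ≡ 0ℤ
sumℤ-zero {n} f≗0 = trans (ℤ-sum.sum-cong-≗ {n} f≗0) (ℤ-sum.sum-replicate-zero n)

sumℤ-indicator : ∀ {n} (x : ℤ) (i : Fin n) → sumℤ (λ l → if does (i Fin.≟ l) then x else 0ℤ) ≡ x
sumℤ-indicator {suc n} x i = trans (ℤ-sum.sum-remove {n} {i} (λ l → if does (i Fin.≟ l) then x else 0ℤ))
  (trans (cong₂ ℤ._+_ (cong (λ b → if b then x else 0ℤ) (dec-true (i Fin.≟ i) refl))
    (sumℤ-zero {n} (λ l → cong (λ b → if b then x else 0ℤ)
        (dec-false (i Fin.≟ Fin.punchIn i l) (Fin.punchInᵢ≢i i l ∘ sym)))))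
  (ℤ.+-identityʳ x))

-- Partitions

sumℕ : ∀ {n} → (Fin n → ℕ) → ℕ
sumℕ {zero}  f = 0
sumℕ {suc n} f = f Fin.zero ℕ.+ sumℕ (f ∘ Fin.suc)

sumℕ-mono : ∀ {n} {f g : Fin n → ℕ} → (∀ i → f i ℕ.≤ g i) → sumℕ f ℕ.≤ sumℕ g
sumℕ-mono {zero}  f≤g = z≤n
sumℕ-mono {suc n} f≤g = ℕ.+-mono-≤ (f≤g Fin.zero) (sumℕ-mono (f≤g ∘ Fin.suc))

sumℕ-strict : ∀ {n} {f g : Fin n → ℕ} → (∀ i → f i ℕ.≤ g i) → ∀ i → f i ℕ.< g i → sumℕ f ℕ.< sumℕ g
sumℕ-strict f≤g Fin.zero    f<g = ℕ.+-mono-<-≤ f<g (sumℕ-mono (f≤g ∘ Fin.suc))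
sumℕ-strict f≤g (Fin.suc i) f<g = ℕ.+-mono-≤-< (f≤g Fin.zero) (sumℕ-strict (f≤g ∘ Fin.suc) i f<g)

private
  firstTrue : ∀ {n} → (Fin n → Bool) → ℕ
  firstTrue {zero}  b = 0
  firstTrue {suc n} b = if b Fin.zero then 0 else suc (firstTrue (b ∘ Fin.suc))

  firstTrue-cong : ∀ {n} {b b′ : Fin n → Bool} → (∀ i → b i ≡ b′ i) → firstTrue b ≡ firstTrue b′
  firstTrue-cong {zero}  eq = refl
  firstTrue-cong {suc n} eq = cong₂ (λ u v → if u then 0 else suc v) (eq Fin.zero) (firstTrue-cong (eq ∘ Fin.suc))

  firstTrue-found : ∀ {n} (b : Fin n → Bool) i → b i ≡ true → ∃ λ l → toℕ l ≡ firstTrue b × b l ≡ true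
  firstTrue-found {suc n} b i bi≡true with b Fin.zero in b₀
  ... | true = Fin.zero , refl , b₀
  firstTrue-found {suc n} b Fin.zero    bi≡true | false = contradiction (trans (sym bi≡true) b₀) λ ()
  firstTrue-found {suc n} b (Fin.suc i) bi≡true | false with l , eq , bl ← firstTrue-found (b ∘ Fin.suc) i bi≡true =
      Fin.suc l , cong suc eq , bl

module _ {s : ℕ} (𝒯 : Partition s) where

  open Partition 𝒯
  private module ~ = IsDecEquivalence isDec

  private
    found : ∀ i → ∃ λ l → toℕ l ≡ firstTrue (λ l → does (l ~? i)) × does (l ~? i) ≡ true
    found i = firstTrue-found (λ l → does (l ~? i)) i (dec-true (i ~? i) ~.refl)

    does⇒ : ∀ {i j} → does (i ~? j) ≡ true → i ~ j
    does⇒ {i} {j} eq with i ~? j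
    ... | yes i~j = i~j

  -- The least member of the class, which depends on the class alone.
  representative : Fin s → Fin s
  representative i = proj₁ (found i)

  representative-~ : ∀ i → representative i ~ i
  representative-~ i = does⇒ (proj₂ (proj₂ (found i)))

  representative-cong : ∀ {i j} → i ~ j → representative i ≡ representative j
  representative-cong {i} {j} i~j = Fin.toℕ-injective (trans (proj₁ (proj₂ (found i)))
    (trans (firstTrue-cong (λ l → does-⇔ (mk⇔ (λ l~i → ~.trans l~i i~j) (λ l~j → ~.trans l~j (~.sym i~j))) (l ~? i)
        (l ~? j))) (sym (proj₁ (proj₂ (found j))))))

  representative-injective : ∀ {i j} → representative i ≡ representative j → i ~ j
  representative-injective {i} {j} eq = ~.trans (~.sym (representative-~ i))
      (subst (_~ j) (sym eq) (representative-~ j))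

module _ {s : ℕ} (L : TranslationInvariantForm s) where

  -- A block of 𝒰 is a union of blocks of 𝒯. The sum over it is rearranged by 𝒯-representatives l,
  -- and each inner sum is empty, zero outside the block, or a block sum of 𝒯.
  balanced-coarsen : ∀ 𝒯 𝒰 → Balanced L 𝒯 → 𝒯 ⊑ 𝒰 → Balanced L 𝒰
  balanced-coarsen 𝒯 𝒰 balanced 𝒯⊑𝒰 j = begin
    sumℤ f
        ≡⟨ ℤ-sum.sum-cong-≗ {s} (λ i → sumℤ-indicator (f i) (rep i)) ⟨
    sumℤ (λ i → sumℤ (λ l → if does (rep i Fin.≟ l) then f i else 0ℤ))
        ≡⟨ ℤ-sum.∑-comm {s} {s} (λ i l → if does (rep i Fin.≟ l) then f i else 0ℤ) ⟩
    sumℤ (λ l → sumℤ (λ i → if does (rep i Fin.≟ l) then f i else 0ℤ))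
        ≡⟨ sumℤ-zero {s} (λ l → block≡0 l (l 𝒰.~? j) (rep l Fin.≟ l)) ⟩
    0ℤ                                                                        ∎
    where
    open ≡-Reasoning
    module 𝒯 = Partition 𝒯
    module 𝒰 = Partition 𝒰
    module ~𝒯 = IsDecEquivalence 𝒯.isDec
    module ~𝒰 = IsDecEquivalence 𝒰.isDec
    rep = representative 𝒯
    f : Fin s → ℤ
    f i = if does (i 𝒰.~? j) then c L i else 0ℤ
    rep≡⇒~𝒯 : ∀ {i l} → rep i ≡ l → i 𝒯.~ l
    rep≡⇒~𝒯 {i} refl = ~𝒯.sym (representative-~ 𝒯 i)
    block≡0 : ∀ l → Dec (l 𝒰.~ j) → Dec (rep l ≡ l) → sumℤ (λ i → if does (rep i Fin.≟ l) then f i else 0ℤ) ≡ 0ℤ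
    block≡0 l (no l≁j) _ = sumℤ-zero {s} (λ i → term≡0 i (rep i Fin.≟ l))
      where
      term≡0 : ∀ i (d : Dec (rep i ≡ l)) → (if does d then f i else 0ℤ) ≡ 0ℤ
      term≡0 i (no _)   = refl
      term≡0 i (yes eq) = cong (λ b → if b then c L i else 0ℤ)
          (dec-false (i 𝒰.~? j) (λ i~j → l≁j (~𝒰.trans (𝒯⊑𝒰 (~𝒯.sym (rep≡⇒~𝒯 eq))) i~j)))
    block≡0 l (yes _) (no rep≢) = sumℤ-zero {s}
        (λ i → cong (λ b → if b then f i else 0ℤ)
        (dec-false (rep i Fin.≟ l) (λ eq → rep≢ (trans (sym (representative-cong 𝒯 (rep≡⇒~𝒯 eq))) eq))))
    block≡0 l (yes l~j) (yes rep≡) = trans (ℤ-sum.sum-cong-≗ {s} (λ i → term i (rep i Fin.≟ l) (i 𝒯.~? l))) (balanced l)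
      where
      term : ∀ i (d : Dec (rep i ≡ l)) (e : Dec (i 𝒯.~ l)) → (if does d then f i else 0ℤ) ≡
          (if does e then c L i else 0ℤ)
      term i (yes eq) (yes i~l) = cong (λ b → if b then c L i else 0ℤ) (dec-true (i 𝒰.~? j) (~𝒰.trans (𝒯⊑𝒰 i~l) l~j))
      term i (no _)   (no _)    = refl
      term i (yes eq) (no i≁l)  = contradiction (rep≡⇒~𝒯 eq) i≁l
      term i (no neq) (yes i~l) = contradiction (trans (representative-cong 𝒯 i~l) rep≡) neq

  private
    -- Partitions are relations and cannot be searched directly. Each one is the kernel of its
    -- `representative` map, so the s^s self-maps of [s] exhaust them up to mutual refinement.
    kernel : (Fin s → Fin s) → Partition s
    kernel g = record { _~_ = λ i j → g i ≡ g j ; isDec = On.isDecEquivalence g (≡.isDecEquivalence Fin._≟_) }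

    _⊑?_ : ∀ 𝒯 𝒰 → Dec (∀ i j → Partition._~_ 𝒯 i j → Partition._~_ {s} 𝒰 i j)
    𝒯 ⊑? 𝒰 = Fin.all? (λ i → Fin.all? (λ j → Partition._~?_ 𝒯 i j →-dec Partition._~?_ 𝒰 i j))

    indicator : Bool → ℕ
    indicator b = if b then 1 else 0

    -- The number of related pairs drops under strict refinement, so descent terminates.
    pairs : Partition s → ℕ
    pairs 𝒯 = sumℕ (λ i → sumℕ (λ j → indicator (does (Partition._~?_ 𝒯 i j))))

    pairs-strict : ∀ 𝒯 𝒰 → 𝒯 ⊑ 𝒰 → ¬ (∀ i j → Partition._~_ 𝒰 i j → Partition._~_ 𝒯 i j) → pairs 𝒯 ℕ.< pairs 𝒰
    pairs-strict 𝒯 𝒰 𝒯⊑𝒰 𝒰⋢𝒯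
      with i , ¬i ← Fin.¬∀⟶∃¬ s _ (λ i → Fin.all? (λ j → Partition._~?_ 𝒰 i j →-dec Partition._~?_ 𝒯 i j)) 𝒰⋢𝒯
      with j , ¬j ← Fin.¬∀⟶∃¬ s _ (λ j → Partition._~?_ 𝒰 i j →-dec Partition._~?_ 𝒯 i j) ¬i =
      sumℕ-strict (λ i → sumℕ-mono (λ j → leq i j (𝒯._~?_ i j) (𝒰._~?_ i j))) i
        (sumℕ-strict (λ j → leq i j (𝒯._~?_ i j) (𝒰._~?_ i j)) j (strict (𝒯._~?_ i j) (𝒰._~?_ i j)))
      where
      module 𝒯 = Partition 𝒯
      module 𝒰 = Partition 𝒰
      leq : ∀ i j (d : Dec (𝒯._~_ i j)) (e : Dec (𝒰._~_ i j)) → indicator (does d) ℕ.≤ indicator (does e)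
      leq i j (no _)    _         = z≤n
      leq i j (yes _)   (yes _)   = ℕ.≤-refl
      leq i j (yes i~j) (no i≁j)  = contradiction (𝒯⊑𝒰 i~j) i≁j
      strict : (d : Dec (𝒯._~_ i j)) (e : Dec (𝒰._~_ i j)) → indicator (does d) ℕ.< indicator (does e)
      strict (yes i~j) _        = contradiction (λ _ → i~j) ¬j
      strict (no _)    (yes _)  = s≤s z≤n
      strict (no _)    (no i≁j) = contradiction (λ i~j → contradiction i~j i≁j) ¬j

    Finer : Partition s → Fin (s ℕ.^ s) → Set
    Finer 𝒰 k = Balanced L 𝒱 × (∀ i j → Partition._~_ 𝒱 i j → Partition._~_ 𝒰 i j) × ¬
        (∀ i j → Partition._~_ 𝒰 i j → Partition._~_ 𝒱 i j)
      where 𝒱 = kernel (Fin.finToFun k)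

    finer? : ∀ 𝒰 → Dec (∃ (Finer 𝒰))
    finer? 𝒰 = Fin.any? (λ k → let 𝒱 = kernel (Fin.finToFun k) in
      Fin.all? (λ j → blockSum L 𝒱 j ℤ.≟ 0ℤ) ×-dec (𝒱 ⊑? 𝒰) ×-dec ¬? (𝒰 ⊑? 𝒱))

    notFiner⇒finest : ∀ 𝒰 → Balanced L 𝒰 → ¬ ∃ (Finer 𝒰) → Finest L 𝒰
    notFiner⇒finest 𝒰 balanced ¬finer = balanced , λ 𝒱 𝒱-balanced 𝒱⊑𝒰 {i} {j} i~j → minimal 𝒱 𝒱-balanced 𝒱⊑𝒰 i j i~j
      where
      minimal : ∀ 𝒱 → Balanced L 𝒱 → 𝒱 ⊑ 𝒰 → ∀ i j → Partition._~_ 𝒰 i j → Partition._~_ 𝒱 i j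
      minimal 𝒱 𝒱-balanced 𝒱⊑𝒰 i j i~j with 𝒰 ⊑? 𝒱
      ... | yes 𝒰⊑𝒱 = 𝒰⊑𝒱 i j i~j
      ... | no 𝒰⋢𝒱 = ⊥-elim (¬finer (k , balanced-coarsen 𝒱 𝒱′ 𝒱-balanced 𝒱⊑𝒱′ , (λ i j eq → 𝒱⊑𝒰 (𝒱′⊑𝒱 eq)) ,
          (λ 𝒰⊑𝒱′ → 𝒰⋢𝒱 (λ i j i~j → 𝒱′⊑𝒱 (𝒰⊑𝒱′ i j i~j)))))
        where
        k = Fin.funToFin (representative 𝒱)
        𝒱′ = kernel (Fin.finToFun k)
        eval = Fin.finToFun-funToFin (representative 𝒱)
        𝒱⊑𝒱′ : 𝒱 ⊑ 𝒱′
        𝒱⊑𝒱′ {i} {j} i~j = trans (eval i) (trans (representative-cong 𝒱 i~j) (sym (eval j)))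
        𝒱′⊑𝒱 : 𝒱′ ⊑ 𝒱
        𝒱′⊑𝒱 {i} {j} eq = representative-injective 𝒱 (trans (sym (eval i)) (trans eq (eval j)))

    finestBelow : ∀ n 𝒰 → pairs 𝒰 ℕ.< n → Balanced L 𝒰 → ∃ λ 𝒱 → Finest L 𝒱 × 𝒱 ⊑ 𝒰
    finestBelow (suc n) 𝒰 (s≤s bound) balanced with finer? 𝒰
    ... | no ¬finer = 𝒰 , notFiner⇒finest 𝒰 balanced ¬finer , id
    ... | yes (k , 𝒱-balanced , 𝒱⊑𝒰 , 𝒰⋢𝒱)
      with 𝒲 , finest , 𝒲⊑𝒱 ← finestBelow n (kernel (Fin.finToFun k))
          (ℕ.<-≤-trans (pairs-strict (kernel (Fin.finToFun k)) 𝒰 (𝒱⊑𝒰 _ _) 𝒰⋢𝒱) bound) 𝒱-balanced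
      = 𝒲 , finest , (λ i~j → 𝒱⊑𝒰 _ _ (𝒲⊑𝒱 i~j))

  -- Descent from 𝒰 ends at a minimal balanced partition, and uniqueness identifies it with ℱ. Thus
  -- the unique minimal balanced partition is the least one.
  finest-refines : (L-primitive : Primitive L) → ∀ 𝒰 → Balanced L 𝒰 → proj₁ L-primitive ⊑ 𝒰
  finest-refines (ℱ , _ , unique) 𝒰 balanced i~j with 𝒱 , finest , 𝒱⊑𝒰 ← finestBelow (suc (pairs 𝒰)) 𝒰 ℕ.≤-refl
      balanced =
    𝒱⊑𝒰 (proj₁ (unique {𝒱} finest) i~j)

-- Words and digit expansions

imageSubset : ∀ {M N} (f : Fin M → Fin N) → Injective _≡_ _≡_ f → ∃ λ (S : Subset N) → M ℕ.≤ ∣ S ∣ ×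
    (∀ {j} → j ∈ₛ S → ∃ λ k → f k ≡ j)
imageSubset {zero}  f f-inj = Subset.⊥ , z≤n , (λ j∈⊥ → contradiction j∈⊥ Subset.∉⊥)
imageSubset {suc M} f f-inj with S , M≤∣S∣ , hit ← imageSubset (f ∘ Fin.suc) (Fin.suc-injective ∘ f-inj) =
  S ∪ ⁅ f Fin.zero ⁆ ,
  ℕ.≤-<-trans M≤∣S∣ (Subset.p⊂q⇒∣p∣<∣q∣ (Subset.p⊆p∪q _ , f Fin.zero , Subset.q⊆p∪q S _ (Subset.x∈⁅x⁆ _) , new)) ,
  λ j∈ → [ (λ j∈S → Fin.suc (proj₁ (hit j∈S)) , proj₂ (hit j∈S)) ,
      (λ j∈ → Fin.zero , sym (Subset.x∈⁅y⁆⇒x≡y _ j∈)) ]′ (Subset.x∈p∪q⁻ S _ j∈)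
  where
  new : ¬ f Fin.zero ∈ₛ S
  new f₀∈S with k , eq ← hit f₀∈S with () ← f-inj eq

∣sum∣≤sum∣∣ : ∀ {n} (f : Fin n → ℤ) → ℤ.∣ sumℤ f ∣ ℕ.≤ sumℕ (λ i → ℤ.∣ f i ∣)
∣sum∣≤sum∣∣ {zero}  f = z≤n
∣sum∣≤sum∣∣ {suc n} f = ℕ.≤-trans (ℤ.∣i+j∣≤∣i∣+∣j∣ (f Fin.zero) _)
    (ℕ.+-monoʳ-≤ ℤ.∣ f Fin.zero ∣ (∣sum∣≤sum∣∣ (f ∘ Fin.suc)))

sumℕ-*ʳ : ∀ {n} (f : Fin n → ℕ) q → sumℕ (λ i → f i ℕ.* q) ≡ sumℕ f ℕ.* q
sumℕ-*ʳ {zero}  f q = refl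
sumℕ-*ʳ {suc n} f q = trans (cong (λ u → f Fin.zero ℕ.* q ℕ.+ u) (sumℕ-*ʳ (f ∘ Fin.suc) q))
    (sym (ℕ.*-distribʳ-+ q (f Fin.zero) _))

≤sumℕ : ∀ {n} (f : Fin n → ℕ) i → f i ℕ.≤ sumℕ f
≤sumℕ f Fin.zero    = ℕ.m≤m+n _ _
≤sumℕ f (Fin.suc i) = ℕ.≤-trans (≤sumℕ (f ∘ Fin.suc) i) (ℕ.m≤n+m _ _)

module Digits (b : ℕ) .{{_ : ℕ.NonZero b}} where

  value : ∀ {n} → (Fin n → ℕ) → ℕ
  value {zero}  f = 0
  value {suc n} f = f Fin.zero ℕ.+ value (f ∘ Fin.suc) ℕ.* b

  value-cong : ∀ {n} {f g : Fin n → ℕ} → (∀ l → f l ≡ g l) → value f ≡ value g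
  value-cong {zero}  eq = refl
  value-cong {suc n} eq = cong₂ (λ u v → u ℕ.+ v ℕ.* b) (eq Fin.zero) (value-cong (eq ∘ Fin.suc))

  value< : ∀ {n} {f : Fin n → ℕ} → (∀ l → f l ℕ.< b) → value f ℕ.< b ℕ.^ n
  value< {zero}  f<b = s≤s z≤n
  value< {suc n} {f} f<b = begin-strict
    f Fin.zero ℕ.+ value (f ∘ Fin.suc) ℕ.* b  <⟨ ℕ.+-monoˡ-< _ (f<b Fin.zero) ⟩
    suc (value (f ∘ Fin.suc)) ℕ.* b           ≤⟨ ℕ.*-monoˡ-≤ b (value< (f<b ∘ Fin.suc)) ⟩
    b ℕ.^ n ℕ.* b                             ≡⟨ ℕ.*-comm (b ℕ.^ n) b ⟩
    b ℕ.^ suc n                               ∎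
    where open ℕ.≤-Reasoning

  value-injective : ∀ {n} {f g : Fin n → ℕ} → (∀ l → f l ℕ.< b) → (∀ l → g l ℕ.< b) → value f ≡ value g → ∀ l → f l
      ≡ g l
  value-injective {suc n} {f} {g} f<b g<b eq =
      λ { Fin.zero → head ; (Fin.suc l) → value-injective (f<b ∘ Fin.suc) (g<b ∘ Fin.suc) tail l }
    where
    remainder : ∀ {h : Fin (suc n) → ℕ} → (∀ l → h l ℕ.< b) → value h ℕ.% b ≡ h Fin.zero
    remainder {h} h<b = trans (ℕ.[m+kn]%n≡m%n (h Fin.zero) (value (h ∘ Fin.suc)) b) (ℕ.m<n⇒m%n≡m (h<b Fin.zero))
    head : f Fin.zero ≡ g Fin.zero
    head = trans (sym (remainder f<b)) (trans (cong (ℕ._% b) eq) (remainder g<b))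
    tail : value (f ∘ Fin.suc) ≡ value (g ∘ Fin.suc)
    tail = ℕ.*-cancelʳ-≡ _ _ b (ℕ.+-cancelˡ-≡ (f Fin.zero) _ _
        (trans eq (cong (ℕ._+ value (g ∘ Fin.suc) ℕ.* b) (sym head))))

  -- The lowest digits contribute an integer of absolute value at most S(p - 1), which is less than
  -- b, and the rest is a multiple of b; so both vanish, and the argument repeats on the rest.
  noCarry : ∀ {s p} (c : Fin s → ℤ) → 1 ℕ.≤ sumℕ (λ i → ℤ.∣ c i ∣) → sumℕ (λ i → ℤ.∣ c i ∣) ℕ.* p ℕ.≤ b →
    ∀ {n} (f : Fin s → Fin n → ℕ) → (∀ i l → f i l ℕ.< p) → sumℤ (λ i → c i ℤ.* + value (f i)) ≡ 0ℤ →
    ∀ l → sumℤ (λ i → c i ℤ.* + f i l) ≡ 0ℤ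
  noCarry {s} {p} c S≥1 Sp≤b {suc n} f f<p eq =
      λ { Fin.zero → low≡0 ; (Fin.suc l) → noCarry c S≥1 Sp≤b (λ i → f i ∘ Fin.suc) (λ i → f<p i ∘ Fin.suc) high≡0 l
      }
    where
    low = sumℤ (λ i → c i ℤ.* + f i Fin.zero)
    high = sumℤ (λ i → c i ℤ.* + value (f i ∘ Fin.suc))
    split : low ℤ.+ high ℤ.* + b ≡ 0ℤ
    split = begin
      low ℤ.+ high ℤ.* + b
        ≡⟨ cong (λ u → low ℤ.+ u) (ℤ-sum.*-distribʳ-sum {s} (+ b) (λ i → c i ℤ.* + value (f i ∘ Fin.suc))) ⟩
      low ℤ.+ sumℤ (λ i → c i ℤ.* + value (f i ∘ Fin.suc) ℤ.* + b)
        ≡⟨ ℤ-sum.∑-distrib-+ {s} (λ i → c i ℤ.* + f i Fin.zero) _ ⟨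
      sumℤ (λ i → c i ℤ.* + f i Fin.zero ℤ.+ c i ℤ.* + value (f i ∘ Fin.suc) ℤ.* + b)
        ≡⟨ ℤ-sum.sum-cong-≗ {s} (λ i → trans (cong (λ u → c i ℤ.* + f i Fin.zero ℤ.+ u) (ℤ.*-assoc (c i) _ _))
             (trans (sym (ℤ.*-distribˡ-+ (c i) (+ f i Fin.zero) (+ value (f i ∘ Fin.suc) ℤ.* + b)))
               (cong (c i ℤ.*_) (trans (cong (λ u → + f i Fin.zero ℤ.+ u) (sym (ℤ.pos-* (value (f i ∘ Fin.suc)) b)))
                   (sym (ℤ.pos-+ (f i Fin.zero) _)))))) ⟩
      sumℤ (λ i → c i ℤ.* + value (f i))
        ≡⟨ eq ⟩
      0ℤ ∎
      where open ≡-Reasoning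
    ∣low∣<b : ℤ.∣ low ∣ ℕ.< b
    ∣low∣<b = begin-strict
      ℤ.∣ low ∣                                             ≤⟨ ∣sum∣≤sum∣∣ (λ i → c i ℤ.* + f i Fin.zero) ⟩
      sumℕ (λ i → ℤ.∣ c i ℤ.* + f i Fin.zero ∣)
          ≤⟨ sumℕ-mono (λ i → ℕ.≤-trans (ℕ.≤-reflexive (ℤ.abs-* (c i) _))
          (ℕ.*-monoʳ-≤ ℤ.∣ c i ∣ (ℕ.<⇒≤pred (f<p i Fin.zero)))) ⟩
      sumℕ (λ i → ℤ.∣ c i ∣ ℕ.* ℕ.pred p)                   ≡⟨ sumℕ-*ʳ (λ i → ℤ.∣ c i ∣) (ℕ.pred p) ⟩
      sumℕ (λ i → ℤ.∣ c i ∣) ℕ.* ℕ.pred p                   <⟨ ℕ.*-monoʳ-< _ {{ℕ.>-nonZero S≥1}} (pred< p i₀<p) ⟩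
      sumℕ (λ i → ℤ.∣ c i ∣) ℕ.* p                          ≤⟨ Sp≤b ⟩
      b                                                     ∎
      where
      open ℕ.≤-Reasoning
      pred< : ∀ q → 0 ℕ.< q → ℕ.pred q ℕ.< q
      pred< (suc q) _ = ℕ.≤-refl
      positive : ∀ {m} (g : Fin m → ℕ) → 1 ℕ.≤ sumℕ g → Fin m
      positive {suc m} g _ = Fin.zero
      i₀<p : 0 ℕ.< p
      i₀<p = ℕ.≤-<-trans z≤n (f<p (positive _ S≥1) Fin.zero)
    low≡0 : low ≡ 0ℤ
    low≡0 = multiple<⇒≡0 (divides (ℤ.- high) (trans (sym (ℤ.+-identityʳ low))
        (trans (cong (λ u → low ℤ.+ u) (sym (ℤ.+-inverseʳ (high ℤ.* + b))))
      (trans (sym (ℤ.+-assoc low (high ℤ.* + b) _))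
          (trans (cong (ℤ._+ ℤ.- (high ℤ.* + b)) split) (trans (ℤ.+-identityˡ _) (ℤ.neg-distribˡ-* high (+ b))))))))
          ∣low∣<b
    high≡0 : high ≡ 0ℤ
    high≡0 = [ id , (λ b≡0 → contradiction (ℤ.+-injective b≡0) (ℕ.≢-nonZero⁻¹ b)) ]′ (ℤ.i*j≡0⇒i≡0∨j≡0 high
      (trans (sym (ℤ.+-identityˡ _)) (trans (cong (ℤ._+ high ℤ.* + b) (sym low≡0)) split)))

module Coordinates {p : ℕ} (F : FiniteField p) where

  open FieldTheory F

  coordinatewise : ∀ {s} (c : Fin s → ℤ) (y : Fin s → Carrier) → (∀ l → sumℤ (λ i → c i ℤ.* + coord (y i) l) ≡ 0ℤ) →
      sum (λ i → ι (c i) * y i) ≡ 0#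
  coordinatewise {s} c y zero-coords = begin
    sum (λ i → ι (c i) * y i)
      ≡⟨ sum-cong-≗ {s} (λ i → trans (cong (ι (c i) *_) (expand (y i))) (*-distribˡ-sum {dim} (ι (c i)) _)) ⟩
    sum (λ i → sum (λ l → ι (c i) * (ι (+ coord (y i) l) * basis l)))
      ≡⟨ ∑-comm {s} {dim} (λ i l → ι (c i) * (ι (+ coord (y i) l) * basis l)) ⟩
    sum (λ l → sum (λ i → ι (c i) * (ι (+ coord (y i) l) * basis l)))
      ≡⟨ sum-zero {dim} coordinate≡0 ⟩
    0# ∎
    where
    open ≡-Reasoning
    coordinate≡0 : ∀ l → sum (λ i → ι (c i) * (ι (+ coord (y i) l) * basis l)) ≡ 0#
    coordinate≡0 l = begin
      sum (λ i → ι (c i) * (ι (+ coord (y i) l) * basis l))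
        ≡⟨ sum-cong-≗ {s} (λ i → trans (sym (*-assoc _ _ _)) (cong (_* basis l) (sym (ι-* (c i) (+ coord (y i) l))))) ⟩
      sum (λ i → ι (c i ℤ.* + coord (y i) l) * basis l)
        ≡⟨ *-distribʳ-sum {s} (basis l) (λ i → ι (c i ℤ.* + coord (y i) l)) ⟨
      sum (λ i → ι (c i ℤ.* + coord (y i) l)) * basis l
        ≡⟨ cong (_* basis l) (trans (sym (ι-sum (λ i → c i ℤ.* + coord (y i) l)))
            (trans (cong ι (zero-coords l)) ι-0)) ⟩
      0# * basis l
        ≡⟨ zeroˡ _ ⟩
      0# ∎

  coord-injective : ∀ {x y} → (∀ l → coord x l ≡ coord y l) → x ≡ y
  coord-injective {x} {y} eq = trans (expand x)
      (trans (sum-cong-≗ {dim} (λ l → cong (λ a → ι (+ a) * basis l) (eq l))) (sym (expand y)))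

-- For S < p this makes a block sum that vanishes in K vanish in the integers.
∣blockSum∣≤ : ∀ {s} (L : TranslationInvariantForm s) 𝒯 j → ℤ.∣ blockSum L 𝒯 j ∣ ℕ.≤ sumℕ (λ i → ℤ.∣ c L i ∣)
∣blockSum∣≤ L 𝒯 j = ℕ.≤-trans (∣sum∣≤sum∣∣ (λ i → if does (Partition._~?_ 𝒯 i j) then c L i else 0ℤ))
    (sumℕ-mono (λ i → bound i (does (Partition._~?_ 𝒯 i j))))
  where
  bound : ∀ i b → ℤ.∣ if b then c L i else 0ℤ ∣ ℕ.≤ ℤ.∣ c L i ∣
  bound i true  = ℕ.≤-refl
  bound i false = z≤n

-- The set of integers built from words

module Construction {r : ℕ} (r≥1 : 1 ℕ.≤ r) (L : TranslationInvariantForm (suc (suc r))) (L-primitive : Primitive L)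
  {p : ℕ} (2<p : 2 ℕ.< p) (r<p : r ℕ.< p) (S<p : sumℕ (λ i → ℤ.∣ c L i ∣) ℕ.< p) where

  open TranslationInvariantForm L using (c≢0; sum≡0; ⟦_⟧)

  S = sumℕ (λ i → ℤ.∣ c L i ∣)

  ∣c∣<p : ∀ i → ℤ.∣ c L i ∣ ℕ.< p
  ∣c∣<p i = ℕ.≤-<-trans (≤sumℕ (λ i → ℤ.∣ c L i ∣) i) S<p

  S≥1 : 1 ℕ.≤ S
  S≥1 = ℕ.≤-trans (ℕ.n≢0⇒n>0 (c≢0 Fin.zero ∘ ℤ.∣i∣≡0⇒i≡0)) (≤sumℕ (λ i → ℤ.∣ c L i ∣) Fin.zero)

  module _ {F : FiniteField p} (E : QuadraticExtension F) (saturated : Tower.Saturated 2<p r r<p (c L) c≢0 ∣c∣<p E)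
      where

    private
      s = suc (suc r)
      module k = FieldTheory F
      module K where
        open FieldTheory (QuadraticExtension.K E) public
        open Coordinates (QuadraticExtension.K E) public
      open Curve 2<p r r≥1 r<p (c L) c≢0 ∣c∣<p sum≡0 E saturated using (norm; blockSumsVanish)

      instance
        b≢0 : ℕ.NonZero (S ℕ.* p)
        b≢0 = ℕ.>-nonZero (ℕ.*-mono-≤ S≥1 (ℕ.<⇒≤ (ℕ.<-trans ℕ.≤-refl 2<p)))

    -- The digits stay below p; the factor S leaves room for the coefficients. A letter takes r
    -- coordinates in K for its powers and one in k for the form.
    base = S ℕ.* p
    width = r ℕ.* K.dim ℕ.+ k.dim

    private
      open Digits base

      p≤base : p ℕ.≤ base
      p≤base = ℕ.≤-trans (ℕ.≤-reflexive (sym (ℕ.*-identityˡ p))) (ℕ.*-monoˡ-≤ p S≥1)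

      digit : K.Carrier → Fin width → ℕ
      digit x d = [ (λ jl → K.coord (x K.^ suc (toℕ (proj₁ (Fin.remQuot {r} K.dim jl))))
          (proj₂ (Fin.remQuot {r} K.dim jl))) , k.coord (norm x) ]′ (Fin.splitAt (r ℕ.* K.dim) d)

      digit< : ∀ x d → digit x d ℕ.< p
      digit< x d with Fin.splitAt (r ℕ.* K.dim) d
      ... | inj₁ _ = K.coord< _ _
      ... | inj₂ _ = k.coord< _ _

      digit-power : ∀ x j l → digit x (Fin.combine j l Fin.↑ˡ k.dim) ≡ K.coord (x K.^ suc (toℕ j)) l
      digit-power x j l = trans (cong [ (λ jl → K.coord (x K.^ suc (toℕ (proj₁ (Fin.remQuot {r} K.dim jl))))
          (proj₂ (Fin.remQuot {r} K.dim jl))) , k.coord (norm x) ]′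
          (Fin.splitAt-↑ˡ (r ℕ.* K.dim) (Fin.combine j l) k.dim))
        (cong (λ jl → K.coord (x K.^ suc (toℕ (proj₁ jl))) (proj₂ jl)) (Fin.remQuot-combine {r} j l))

      digit-norm : ∀ x l → digit x ((r ℕ.* K.dim) Fin.↑ʳ l) ≡ k.coord (norm x) l
      digit-norm x l = cong [ (λ jl → K.coord (x K.^ suc (toℕ (proj₁ (Fin.remQuot {r} K.dim jl))))
          (proj₂ (Fin.remQuot {r} K.dim jl))) , k.coord (norm x) ]′ (Fin.splitAt-↑ʳ (r ℕ.* K.dim) k.dim l)

      -- The first power, present because r ≥ 1, already determines x.
      digit-injective : ∀ {x y} → (∀ d → digit x d ≡ digit y d) → x ≡ y
      digit-injective {x} {y} eq = trans (sym (K.*-identityʳ x))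
          (trans (K.coord-injective (λ l → trans (coord-x x l) (trans (eq _) (sym (coord-x y l)))))
          (K.*-identityʳ y))
        where
        j₀ : Fin r
        j₀ = Fin.fromℕ< r≥1
        coord-x : ∀ x l → K.coord (x K.^ 1) l ≡ digit x (Fin.combine j₀ l Fin.↑ˡ k.dim)
        coord-x x l = sym (trans (digit-power x j₀ l) (cong (λ n → K.coord (x K.^ suc n) l) (Fin.toℕ-fromℕ< r≥1)))

    module _ (n : ℕ) where

      private
        Word = Fin (K.size ℕ.^ n)

        letter : Word → Fin n → K.Carrier
        letter w m = K.element (Fin.finToFun w m)

        wordDigit : Word → Fin (n ℕ.* width) → ℕ
        wordDigit w d = digit (letter w (proj₁ (Fin.remQuot {n} width d))) (proj₂ (Fin.remQuot {n} width d))

        wordDigit-combine : ∀ w m d → wordDigit w (Fin.combine m d) ≡ digit (letter w m) d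
        wordDigit-combine w m d = cong (λ md → digit (letter w (proj₁ md)) (proj₂ md)) (Fin.remQuot-combine {n} m d)

        wordDigit< : ∀ w d → wordDigit w d ℕ.< p
        wordDigit< w d = digit< _ _

        number : Word → ℕ
        number w = value (wordDigit w)

        number-injective : Injective _≡_ _≡_ number
        number-injective {v} {w} eq = finToFun-injective {n} {K.size} (λ m → K.element-injective (digit-injective (λ d →
          trans (sym (wordDigit-combine v m d)) (trans
            (value-injective (λ d → ℕ.<-≤-trans (wordDigit< v d) p≤base) (λ d → ℕ.<-≤-trans (wordDigit< w d) p≤base)
                eq (Fin.combine m d))
            (wordDigit-combine w m d)))))

        letterPartition : (Fin s → Word) → Fin n → Partition s
        letterPartition w m = record { _~_ = λ i j → letter (w i) m ≡ letter (w j) m ; isDec = On.isDecEquivalence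
            (λ i → letter (w i) m) (≡.isDecEquivalence K._≟_) }

        -- Without carries the relation holds digit by digit, hence for the powers and the form at
        -- position m. The block sums then vanish in K, and in the integers because they are smaller
        -- than p.
        letter-balanced : ∀ w → sumℤ (λ i → c L i ℤ.* + number (w i)) ≡ 0ℤ → ∀ m → Balanced L (letterPartition w m)
        letter-balanced w Lw≡0 m j = decide (blockSum L (letterPartition w m) j ℤ.≟ 0ℤ)
          where
          digits≡0 : ∀ d → sumℤ (λ i → c L i ℤ.* + digit (letter (w i) m) d) ≡ 0ℤ
          digits≡0 d = trans (ℤ-sum.sum-cong-≗ {s}
              (λ i → cong (λ u → c L i ℤ.* + u) (sym (wordDigit-combine (w i) m d))))
            (noCarry (c L) S≥1 ℕ.≤-refl (λ i → wordDigit (w i)) (λ i → wordDigit< (w i)) Lw≡0 (Fin.combine m d))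
          powers : ∀ (j : Fin r) → K.sum (λ i → K.ι (c L i) K.* letter (w i) m K.^ suc (toℕ j)) ≡ K.0#
          powers j = K.coordinatewise (c L) (λ i → letter (w i) m K.^ suc (toℕ j)) (λ l →
            trans (ℤ-sum.sum-cong-≗ {s} (λ i → cong (λ u → c L i ℤ.* + u) (sym (digit-power (letter (w i) m) j l))))
                (digits≡0 (Fin.combine j l Fin.↑ˡ k.dim)))
          norms : k.sum (λ i → k.ι (c L i) k.* norm (letter (w i) m)) ≡ k.0#
          norms = Coordinates.coordinatewise F (c L) (λ i → norm (letter (w i) m)) (λ l →
            trans (ℤ-sum.sum-cong-≗ {s} (λ i → cong (λ u → c L i ℤ.* + u) (sym (digit-norm (letter (w i) m) l))))
                (digits≡0 ((r ℕ.* K.dim) Fin.↑ʳ l)))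
          ι-if : ∀ b z → K.ι (if b then z else 0ℤ) ≡ (if b then K.ι z else K.0#)
          ι-if true  z = refl
          ι-if false z = K.ι-0
          decide : Dec (blockSum L (letterPartition w m) j ≡ 0ℤ) → blockSum L (letterPartition w m) j ≡ 0ℤ
          decide (yes eq) = eq
          decide (no neq) = contradiction (trans
              (K.ι-sum {s} (λ i → if does (letter (w i) m K.≟ letter (w j) m) then c L i else 0ℤ))
              (trans (K.sum-cong-≗ {s} (λ i → ι-if (does (letter (w i) m K.≟ letter (w j) m)) (c L i)))
              (blockSumsVanish (λ i → letter (w i) m) powers norms j)))
            (K.ι≢0 neq (ℕ.≤-<-trans (∣blockSum∣≤ L (letterPartition w m) j) S<p))

      lowerBound : ∀ {N} → base ℕ.^ (n ℕ.* width) ℕ.≤ N → K.size ℕ.^ n ℕ.≤ Defs.r L N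
      lowerBound {N} base≤N = ℕ.≤-trans (proj₁ (proj₂ image)) (r-upper L (proj₁ image) free)
        where
        number<N : ∀ w → number w ℕ.< N
        number<N w = ℕ.<-≤-trans (value< (λ d → ℕ.<-≤-trans (wordDigit< w d) p≤base)) base≤N
        place : Word → Fin N
        place w = Fin.fromℕ< (number<N w)
        toℕ-place : ∀ w → toℕ (place w) ≡ number w
        toℕ-place w = Fin.toℕ-fromℕ< (number<N w)
        image = imageSubset place (λ {v} {w} eq → number-injective
            (trans (sym (toℕ-place v)) (trans (cong toℕ eq) (toℕ-place w))))
        free : Free L ⟪ proj₁ image ⟫
        free x x∈ Lx≡0 = balanced-coarsen L (proj₁ L-primitive) (levelPartition x)
            (proj₁ (proj₁ (proj₂ L-primitive))) ℱ⊑
          where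
          w : Fin s → Word
          w i = proj₁ (proj₂ (proj₂ image) (proj₁ (proj₂ (x∈ i))))
          x≡ : ∀ i → x i ≡ + suc (number (w i))
          x≡ i = trans (sym (proj₂ (proj₂ (x∈ i))))
              (cong (λ u → + suc u) (trans (cong toℕ (sym (proj₂ (proj₂ (proj₂ image) (proj₁ (proj₂ (x∈ i)))))))
              (toℕ-place (w i))))
          -- The integers are the numbers of the words plus 1; translation invariance removes the
          -- shift.
          Lw≡0 : sumℤ (λ i → c L i ℤ.* + number (w i)) ≡ 0ℤ
          Lw≡0 = begin
            sumℤ (λ i → c L i ℤ.* + number (w i))
              ≡⟨ ℤ.+-identityˡ _ ⟨
            0ℤ ℤ.+ sumℤ (λ i → c L i ℤ.* + number (w i))
              ≡⟨ cong (ℤ._+ sumℤ (λ i → c L i ℤ.* + number (w i))) (sym sum≡0) ⟩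
            sumℤ (c L) ℤ.+ sumℤ (λ i → c L i ℤ.* + number (w i))
              ≡⟨ ℤ-sum.∑-distrib-+ {s} (c L) (λ i → c L i ℤ.* + number (w i)) ⟨
            sumℤ (λ i → c L i ℤ.+ c L i ℤ.* + number (w i))
              ≡⟨ ℤ-sum.sum-cong-≗ {s} (λ i → trans (sym (ℤ.*-suc (c L i) (+ number (w i))))
                  (cong (c L i ℤ.*_) (sym (x≡ i)))) ⟩
            ⟦ x ⟧
              ≡⟨ Lx≡0 ⟩
            0ℤ ∎
            where open ≡-Reasoning
          -- Indices in one block of ℱ carry equal letters at each position, hence equal integers.
          ℱ⊑ : proj₁ L-primitive ⊑ levelPartition x
          ℱ⊑ {i} {j} i~j = trans (x≡ i) (trans (cong (λ u → + suc u) (value-cong (λ d →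
            cong (λ u → digit u (proj₂ (Fin.remQuot {n} width d)))
                (finest-refines L L-primitive (letterPartition w (proj₁ (Fin.remQuot {n} width d)))
              (letter-balanced w Lw≡0 (proj₁ (Fin.remQuot {n} width d))) i~j)))) (sym (x≡ j)))

-- Choice of parameters and exponents

primeDivisor : ∀ n → 2 ℕ.≤ n → ∃ λ p → Prime p × p ℕ.∣ n
primeDivisor n@(suc _) 2≤n with factorise n
... | record { factors = []     ; isFactorisation = n≡1 } = contradiction 2≤n (ℕ.<⇒≱ (s≤s (ℕ.≤-reflexive n≡1)))
... | record { factors = p ∷ ps ; isFactorisation = n≡ ; factorsPrime = p-prime ∷ _ } = p , p-prime , ℕ.divides
    (product ps) (trans n≡ (ℕ.*-comm p (product ps)))

-- Euclid: a prime divisor of B! + 1 cannot be at most B.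
primeAbove : ∀ B → ∃ λ p → Prime p × B ℕ.< p
primeAbove B with p , p-prime , p∣1+B! ← primeDivisor (suc (B !)) (s≤s (ℕ.1≤n! B)) = p , p-prime , ℕ.≰⇒> p≰B
  where
  p≰B : ¬ p ℕ.≤ B
  p≰B p≤B = ℕ.<⇒≢ (ℕ.nonTrivial⇒n>1 p {{prime⇒nonTrivial p-prime}})
      (sym (ℕ.∣1⇒≡1 (ℕ.∣m+n∣m⇒∣n (subst (p ℕ.∣_) (ℕ.+-comm 1 (B !)) p∣1+B!) (p∣B! p p≤B))))
    where
    p∣B! : ∀ q {{_ : ℕ.NonZero q}} → q ℕ.≤ B → q ℕ.∣ B !
    p∣B! (suc q) q≤B = ℕ.∣-trans (ℕ.m∣m*n (q !)) (ℕ.m≤n⇒m!∣n! q≤B)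
    instance p≢0 = prime⇒nonZero p-prime

*-^-distrib : ∀ m n o → (m ℕ.* n) ℕ.^ o ≡ m ℕ.^ o ℕ.* n ℕ.^ o
*-^-distrib m n zero    = refl
*-^-distrib m n (suc o) = trans (cong (m ℕ.* n ℕ.*_) (*-^-distrib m n o))
    (ℕ.[m*n]*[o*p]≡[m*o]*[n*p] m n (m ℕ.^ o) (n ℕ.^ o))

bernoulli : ∀ Q T → Q ℕ.^ suc T ℕ.+ suc T ℕ.* Q ℕ.^ T ℕ.≤ suc Q ℕ.^ suc T
bernoulli Q zero    = ℕ.≤-reflexive (trans (ℕ.+-comm (Q ℕ.* 1) 1) refl)
bernoulli Q (suc T) = begin
  Q ℕ.* q ℕ.+ (q ℕ.+ suc T ℕ.* q)                       ≤⟨ ℕ.m≤m+n _ (suc T ℕ.* Q ℕ.^ T) ⟩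
  Q ℕ.* q ℕ.+ (q ℕ.+ suc T ℕ.* q) ℕ.+ suc T ℕ.* Q ℕ.^ T
      ≡⟨ solve 4 (λ Q q T t → Q :* q :+ (q :+ T :* (Q :* t)) :+ T :* t := (con 1 :+ Q) :* (T :* t) :+ (Q :* q :+ q))
      refl Q q (suc T) (Q ℕ.^ T) ⟩
  suc Q ℕ.* (suc T ℕ.* Q ℕ.^ T) ℕ.+ (Q ℕ.* q ℕ.+ q)
      ≡⟨ solve 3 (λ Q q u → (con 1 :+ Q) :* u :+ (Q :* q :+ q) := (con 1 :+ Q) :* (q :+ u)) refl Q q
      (suc T ℕ.* Q ℕ.^ T) ⟩
  suc Q ℕ.* (q ℕ.+ suc T ℕ.* Q ℕ.^ T)                   ≤⟨ ℕ.*-monoʳ-≤ (suc Q) (bernoulli Q T) ⟩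
  suc Q ℕ.* suc Q ℕ.^ suc T                             ∎
  where
  open ℕ.≤-Reasoning
  open ℕ-Solver
  q = Q ℕ.^ suc T

-- For integers Q < M means Q + 1 ≤ M. With T = Q² Bernoulli gives (Q + 1)^(T+1) ≥ (T + 1) Q^T ≥
-- Q^(T+2), so the strict inequality becomes M ≥ Q^((T+2)/(T+1)) without logarithms.
power-gain : ∀ Q M → Q ℕ.< M → Q ℕ.^ suc (suc (Q ℕ.* Q)) ℕ.≤ M ℕ.^ suc (Q ℕ.* Q)
power-gain Q M Q<M = begin
  Q ℕ.* (Q ℕ.* Q ℕ.^ T)                    ≡⟨ ℕ.*-assoc Q Q (Q ℕ.^ T) ⟨
  T ℕ.* Q ℕ.^ T                            ≤⟨ ℕ.*-monoˡ-≤ (Q ℕ.^ T) (ℕ.n≤1+n T) ⟩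
  suc T ℕ.* Q ℕ.^ T                        ≤⟨ ℕ.m≤n+m _ (Q ℕ.^ suc T) ⟩
  Q ℕ.^ suc T ℕ.+ suc T ℕ.* Q ℕ.^ T        ≤⟨ bernoulli Q T ⟩
  suc Q ℕ.^ suc T                          ≤⟨ ℕ.^-monoˡ-≤ (suc T) Q<M ⟩
  M ℕ.^ suc T                              ∎
  where
  open ℕ.≤-Reasoning
  T = Q ℕ.* Q

logarithm : ∀ Q → 2 ℕ.≤ Q → ∀ N → 1 ℕ.≤ N → ∃ λ n → Q ℕ.^ n ℕ.≤ N × N ℕ.< Q ℕ.^ suc n
logarithm Q 2≤Q N N≥1 = search N (n<Q^n N)
  where
  n<Q^n : ∀ n → n ℕ.< Q ℕ.^ n
  n<Q^n zero    = s≤s z≤n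
  n<Q^n (suc n) = begin-strict
    suc n              ≤⟨ n<Q^n n ⟩
    Q ℕ.^ n            <⟨ ℕ.m<m*n (Q ℕ.^ n) Q {{ℕ.>-nonZero (ℕ.≤-<-trans z≤n (n<Q^n n))}} 2≤Q ⟩
    Q ℕ.^ n ℕ.* Q      ≡⟨ ℕ.*-comm (Q ℕ.^ n) Q ⟩
    Q ℕ.^ suc n        ∎
    where open ℕ.≤-Reasoning
  search : ∀ k → N ℕ.< Q ℕ.^ k → ∃ λ n → Q ℕ.^ n ℕ.≤ N × N ℕ.< Q ℕ.^ suc n
  search zero    N<1 = contradiction N≥1 (ℕ.<⇒≱ N<1)
  search (suc k) N< with Q ℕ.^ k ℕ.≤? N
  ... | yes Q^k≤N = k , Q^k≤N , N<
  ... | no  Q^k≰N = search k (ℕ.≰⇒> Q^k≰N)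

numerator-^ : ∀ a b n → ℚᵘ.↥ (mkℚᵘ (+ a) b ^ℚ n) ≡ + (a ℕ.^ n)
denominator-^ : ∀ a b n → ℚᵘ.↧ₙ (mkℚᵘ (+ a) b ^ℚ n) ≡ suc b ℕ.^ n

private
  ↥-* : ∀ x y → ℚᵘ.↥ (x ℚᵘ.* y) ≡ ℚᵘ.↥ x ℤ.* ℚᵘ.↥ y
  ↥-* (mkℚᵘ _ _) (mkℚᵘ _ _) = refl

  ↧ₙ-* : ∀ x y → ℚᵘ.↧ₙ (x ℚᵘ.* y) ≡ ℚᵘ.↧ₙ x ℕ.* ℚᵘ.↧ₙ y
  ↧ₙ-* (mkℚᵘ _ _) (mkℚᵘ _ _) = refl

numerator-^ a b zero    = refl
numerator-^ a b (suc n) = trans (↥-* (mkℚᵘ (+ a) b) (mkℚᵘ (+ a) b ^ℚ n))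
    (trans (cong (λ u → + a ℤ.* u) (numerator-^ a b n)) (sym (ℤ.pos-* a (a ℕ.^ n))))
denominator-^ a b zero    = refl
denominator-^ a b (suc n) = trans (↧ₙ-* (mkℚᵘ (+ a) b) (mkℚᵘ (+ a) b ^ℚ n)) (cong (suc b ℕ.*_) (denominator-^ a b n))

rational-bound : ∀ W P q N M → N ℕ.^ P ℕ.≤ M ℕ.^ q ℕ.* suc W ℕ.^ q →
  (mkℚᵘ (+ 1) W ^ℚ q) ℚᵘ.* (fromℕ N ^ℚ P) ℚᵘ.≤ fromℕ M ^ℚ q
rational-bound W P q N M bound = ℚᵘ.*≤* (subst₂ ℤ._≤_ (sym left) (sym right) (ℤ.+≤+ bound))
  where
  x = mkℚᵘ (+ 1) W ^ℚ q
  y = fromℕ N ^ℚ P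
  z = fromℕ M ^ℚ q
  ↧z≡1 : ℚᵘ.↧ₙ z ≡ 1
  ↧z≡1 = trans (denominator-^ M 0 q) (ℕ.^-zeroˡ q)
  left : ℚᵘ.↥ (x ℚᵘ.* y) ℤ.* + ℚᵘ.↧ₙ z ≡ + (N ℕ.^ P)
  left = begin
    ℚᵘ.↥ (x ℚᵘ.* y) ℤ.* + ℚᵘ.↧ₙ z     ≡⟨ cong₂ (λ u v → u ℤ.* + v) (↥-* x y) ↧z≡1 ⟩
    ℚᵘ.↥ x ℤ.* ℚᵘ.↥ y ℤ.* + 1         ≡⟨ ℤ.*-identityʳ _ ⟩
    ℚᵘ.↥ x ℤ.* ℚᵘ.↥ y                 ≡⟨ cong₂ ℤ._*_ (trans (numerator-^ 1 W q) (cong +_ (ℕ.^-zeroˡ q)))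
        (numerator-^ N 0 P) ⟩
    1ℤ ℤ.* + (N ℕ.^ P)                ≡⟨ ℤ.*-identityˡ _ ⟩
    + (N ℕ.^ P)                       ∎
    where open ≡-Reasoning
  right : ℚᵘ.↥ z ℤ.* + ℚᵘ.↧ₙ (x ℚᵘ.* y) ≡ + (M ℕ.^ q ℕ.* suc W ℕ.^ q)
  right = trans (cong₂ (λ u v → u ℤ.* + v) (numerator-^ M 0 q)
      (trans (↧ₙ-* x y) (trans (cong₂ ℕ._*_ (denominator-^ 1 W q) (trans (denominator-^ N 0 P) (ℕ.^-zeroˡ P)))
      (ℕ.*-identityʳ _))))
    (sym (ℤ.pos-* (M ℕ.^ q) (suc W ℕ.^ q)))

-- With d = t + 1 the gain reads m ≥ Q^(1/d + ε) for ε = 1/(d(T + 1)). Powers of Q give the claim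
-- for N = Q^n, and the constant covers the N up to Q^(n+1).
exponent-gain : ∀ t Q m (f : ℕ → ℕ) → 2 ℕ.≤ Q → Q ℕ.< m ℕ.^ suc t → (∀ n N → Q ℕ.^ n ℕ.≤ N → m ℕ.^ n ℕ.≤ f N) →
  ∃ λ ε → 0ℚᵘ ℚᵘ.< ε × ∃ λ C → 0ℚᵘ ℚᵘ.< C × (∀ N → 1 ℕ.≤ N → f N ≥[ C · N ^ (mkℚᵘ (+ 1) t ℚᵘ.+ ε) ])
exponent-gain t Q m f 2≤Q Q<m^d growth =
  mkℚᵘ (+ 1) e , ℚᵘ.*<* (ℤ.+<+ (s≤s z≤n)) , mkℚᵘ (+ 1) W , ℚᵘ.*<* (ℤ.+<+ (s≤s z≤n)) ,
  λ N N≥1 → rational-bound W P q N (f N) (bound N (logarithm Q 2≤Q N N≥1))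
  where
  d = suc t
  T = Q ℕ.* Q
  e = ℕ.pred (d ℕ.* suc T)
  -- P/q is the unreduced sum 1/(t + 1) + 1/(e + 1), in the form to which rational addition
  -- computes.
  P = suc (e ℕ.+ 0) ℕ.+ suc (t ℕ.+ 0)
  q = suc t ℕ.* suc e
  -- C = Q^(-P). Rounding N up to Q^(n+1) costs Q^P after clearing the root, and C^q provides the
  -- q-th power of that.
  W = ℕ.pred (Q ℕ.^ P)
  P≡ : P ≡ d ℕ.* suc (suc T)
  P≡ = trans (cong₂ (λ u v → suc u ℕ.+ suc v) (ℕ.+-identityʳ e) (ℕ.+-identityʳ t))
      (trans (ℕ.+-comm (suc e) d) (sym (ℕ.*-suc d (suc T))))
  instance
    Q≢0 : ℕ.NonZero Q
    Q≢0 = ℕ.>-nonZero (ℕ.<-trans (s≤s z≤n) 2≤Q)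
  Q^P≡ : suc W ≡ Q ℕ.^ P
  Q^P≡ = ℕ.suc-pred (Q ℕ.^ P) {{ℕ.m^n≢0 Q P}}
  Q^P≤m^q : Q ℕ.^ P ℕ.≤ m ℕ.^ q
  Q^P≤m^q = begin
    Q ℕ.^ P                           ≡⟨ cong (Q ℕ.^_) (trans P≡ (ℕ.*-comm d (suc (suc T)))) ⟩
    Q ℕ.^ (suc (suc T) ℕ.* d)         ≡⟨ ℕ.^-*-assoc Q (suc (suc T)) d ⟨
    (Q ℕ.^ suc (suc T)) ℕ.^ d         ≤⟨ ℕ.^-monoˡ-≤ d (power-gain Q (m ℕ.^ d) Q<m^d) ⟩
    ((m ℕ.^ d) ℕ.^ suc T) ℕ.^ d       ≡⟨ cong (ℕ._^ d) (ℕ.^-*-assoc m d (suc T)) ⟩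
    (m ℕ.^ (d ℕ.* suc T)) ℕ.^ d       ≡⟨ ℕ.^-*-assoc m (d ℕ.* suc T) d ⟩
    m ℕ.^ (d ℕ.* suc T ℕ.* d)         ≡⟨ cong (m ℕ.^_) (ℕ.*-comm (d ℕ.* suc T) d) ⟩
    m ℕ.^ q                           ∎
    where open ℕ.≤-Reasoning
  bound : ∀ N → (∃ λ n → Q ℕ.^ n ℕ.≤ N × N ℕ.< Q ℕ.^ suc n) → N ℕ.^ P ℕ.≤ f N ℕ.^ q ℕ.* suc W ℕ.^ q
  bound N (n , Q^n≤N , N<Q^sn) = begin
    N ℕ.^ P                                  ≤⟨ ℕ.^-monoˡ-≤ P (ℕ.<⇒≤ N<Q^sn) ⟩
    (Q ℕ.^ suc n) ℕ.^ P                      ≡⟨ ℕ.^-*-assoc Q (suc n) P ⟩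
    Q ℕ.^ (P ℕ.+ n ℕ.* P)                    ≡⟨ ℕ.^-distribˡ-+-* Q P (n ℕ.* P) ⟩
    Q ℕ.^ P ℕ.* Q ℕ.^ (n ℕ.* P)              ≡⟨ ℕ.*-comm (Q ℕ.^ P) _ ⟩
    Q ℕ.^ (n ℕ.* P) ℕ.* Q ℕ.^ P              ≡⟨ cong₂ ℕ._*_ (cong (Q ℕ.^_) (ℕ.*-comm n P)) (sym Q^P≡) ⟩
    Q ℕ.^ (P ℕ.* n) ℕ.* suc W                ≡⟨ cong (ℕ._* suc W) (ℕ.^-*-assoc Q P n) ⟨
    (Q ℕ.^ P) ℕ.^ n ℕ.* suc W                ≤⟨ ℕ.*-mono-≤ (ℕ.^-monoˡ-≤ n Q^P≤m^q) (W≤ (suc W)) ⟩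
    (m ℕ.^ q) ℕ.^ n ℕ.* suc W ℕ.^ q          ≡⟨ cong (ℕ._* suc W ℕ.^ q)
        (trans (ℕ.^-*-assoc m q n) (trans (cong (m ℕ.^_) (ℕ.*-comm q n)) (sym (ℕ.^-*-assoc m n q)))) ⟩
    (m ℕ.^ n) ℕ.^ q ℕ.* suc W ℕ.^ q          ≤⟨ ℕ.*-monoˡ-≤ (suc W ℕ.^ q) (ℕ.^-monoˡ-≤ q (growth n N Q^n≤N)) ⟩
    f N ℕ.^ q ℕ.* suc W ℕ.^ q                ∎
    where
    open ℕ.≤-Reasoning
    W≤ : ∀ w .{{_ : ℕ.NonZero w}} → w ℕ.≤ w ℕ.^ q
    W≤ w = ℕ.≤-trans (ℕ.≤-reflexive (sym (ℕ.^-identityʳ w))) (ℕ.^-monoʳ-≤ w {1} {q} (s≤s z≤n))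

module Parameters (r S : ℕ) where

  -- N exceeds the bound (1 + r²)ʳ on the number of shapes; A makes the degree comparison in few strict.
  N A E : ℕ
  N = suc ((1 ℕ.+ r ℕ.* r) ℕ.^ r)
  A = suc N
  E = suc (N ℕ.+ (r ℕ.* A ℕ.+ r ℕ.* (A ℕ.* r)))

  -- As A = 1 + N, the base on the left is (1 + r²)A; the powers of A cancel and (1 + r²)^r < N
  -- remains.
  few : suc (N ℕ.+ r ℕ.* (A ℕ.* r)) ℕ.^ r ℕ.< N ℕ.* A ℕ.^ r
  few = begin-strict
    (A ℕ.+ r ℕ.* (A ℕ.* r)) ℕ.^ r
        ≡⟨ cong (ℕ._^ r) (solve 2 (λ a r → a :+ r :* (a :* r) := (con 1 :+ r :* r) :* a) refl A r) ⟩
    ((1 ℕ.+ r ℕ.* r) ℕ.* A) ℕ.^ r                  ≡⟨ *-^-distrib (1 ℕ.+ r ℕ.* r) A r ⟩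
    (1 ℕ.+ r ℕ.* r) ℕ.^ r ℕ.* A ℕ.^ r
        <⟨ ℕ.*-monoˡ-< (A ℕ.^ r) {{ℕ.m^n≢0 A r}} {(1 ℕ.+ r ℕ.* r) ℕ.^ r} {N} ℕ.≤-refl ⟩
    N ℕ.* A ℕ.^ r                                  ∎
    where
    open ℕ.≤-Reasoning
    open ℕ-Solver

  bounds : ℕ
  bounds = 2 ℕ.+ (r ℕ.+ (S ℕ.+ (A ℕ.+ (E ℕ.+ S ℕ.^ suc (r ℕ.+ r)))))

  module _ {p : ℕ} (bounds<p : bounds ℕ.< p) where

    private
      _≤-then_ : ∀ {a b c} → a ℕ.≤ b → b ℕ.< c → a ℕ.< c
      _≤-then_ = ℕ.≤-<-trans

      tail₁ = ℕ.m≤n+m (r ℕ.+ (S ℕ.+ (A ℕ.+ (E ℕ.+ S ℕ.^ suc (r ℕ.+ r))))) 2 ≤-then bounds<p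
      tail₂ = ℕ.m≤n+m (S ℕ.+ (A ℕ.+ (E ℕ.+ S ℕ.^ suc (r ℕ.+ r)))) r ≤-then tail₁
      tail₃ = ℕ.m≤n+m (A ℕ.+ (E ℕ.+ S ℕ.^ suc (r ℕ.+ r))) S ≤-then tail₂
      tail₄ = ℕ.m≤n+m (E ℕ.+ S ℕ.^ suc (r ℕ.+ r)) A ≤-then tail₃

    2<p : 2 ℕ.< p
    2<p = ℕ.m≤m+n 2 _ ≤-then bounds<p

    r<p : r ℕ.< p
    r<p = ℕ.m≤m+n r _ ≤-then tail₁

    S<p : S ℕ.< p
    S<p = ℕ.m≤m+n S _ ≤-then tail₂

    A<p : A ℕ.< p
    A<p = ℕ.m≤m+n A _ ≤-then tail₃

    E<p : E ℕ.< p
    E<p = ℕ.m≤m+n E _ ≤-then tail₄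

    S^<p : S ℕ.^ suc (r ℕ.+ r) ℕ.< p
    S^<p = ℕ.m≤n+m _ E ≤-then tail₄

    -- The width is (2r + 1)f, while |K|^(r+1) = p^((2r+2)f). The spare p^f exceeds the loss
    -- S^((2r+1)f) because p > S^(2r+1).
    base^width<size^ : ∀ f → 1 ℕ.≤ f → (S ℕ.* p) ℕ.^ (r ℕ.* (f ℕ.+ f) ℕ.+ f) ℕ.< (p ℕ.^ (f ℕ.+ f)) ℕ.^ suc r
    base^width<size^ f f≥1 = begin-strict
      (S ℕ.* p) ℕ.^ w                               ≡⟨ *-^-distrib S p w ⟩
      S ℕ.^ w ℕ.* p ℕ.^ w                           <⟨ ℕ.*-monoˡ-< (p ℕ.^ w) {{ℕ.m^n≢0 p w}} S^w<p^f ⟩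
      p ℕ.^ f ℕ.* p ℕ.^ w                           ≡⟨ ℕ.^-distribˡ-+-* p f w ⟨
      p ℕ.^ (f ℕ.+ w)
          ≡⟨ cong (p ℕ.^_) (solve 2 (λ f r → f :+ (r :* (f :+ f) :+ f) := (f :+ f) :* (con 1 :+ r)) refl f r) ⟩
      p ℕ.^ ((f ℕ.+ f) ℕ.* suc r)                   ≡⟨ ℕ.^-*-assoc p (f ℕ.+ f) (suc r) ⟨
      (p ℕ.^ (f ℕ.+ f)) ℕ.^ suc r                   ∎
      where
      open ℕ.≤-Reasoning
      open ℕ-Solver
      w = r ℕ.* (f ℕ.+ f) ℕ.+ f
      instance
        p≢0 : ℕ.NonZero p
        p≢0 = ℕ.>-nonZero (ℕ.≤-<-trans z≤n 2<p)
        f≢0 : ℕ.NonZero f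
        f≢0 = ℕ.>-nonZero f≥1
      S^w<p^f : S ℕ.^ w ℕ.< p ℕ.^ f
      S^w<p^f = begin-strict
        S ℕ.^ w                              ≡⟨ cong (S ℕ.^_)
            (solve 2 (λ f r → r :* (f :+ f) :+ f := (con 1 :+ (r :+ r)) :* f) refl f r) ⟩
        S ℕ.^ (suc (r ℕ.+ r) ℕ.* f)          ≡⟨ ℕ.^-*-assoc S (suc (r ℕ.+ r)) f ⟨
        (S ℕ.^ suc (r ℕ.+ r)) ℕ.^ f          <⟨ ℕ.^-monoˡ-< f S^<p ⟩
        p ℕ.^ f                              ∎

module _ {r : ℕ} (r≥1 : 1 ℕ.≤ r) (L : TranslationInvariantForm (suc (suc r))) (L-primitive : Primitive L) where

  open TranslationInvariantForm L using (c≢0)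
  open Parameters r (sumℕ (λ i → ℤ.∣ c L i ∣))

  PowerGrowth : Set
  PowerGrowth = ∃₂ λ Q m → 2 ℕ.≤ Q × Q ℕ.< m ℕ.^ suc r × (∀ n N → Q ℕ.^ n ℕ.≤ N → m ℕ.^ n ℕ.≤ Defs.r L N)

  module _ {p : ℕ} (bounds<p : bounds ℕ.< p) where

    open Construction r≥1 L L-primitive (2<p bounds<p) (r<p bounds<p) (S<p bounds<p)

    powerGrowthFrom : ∀ {F} (E : QuadraticExtension F) → Tower.Saturated (2<p bounds<p) r (r<p bounds<p) (c L) c≢0
        ∣c∣<p E → PowerGrowth
    powerGrowthFrom {F} E saturated = base E saturated ℕ.^ width E saturated , K.size , 2≤Q , Q<m^ , growth
      where
      module k = FieldTheory F
      module K = FieldTheory (QuadraticExtension.K E)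
      f = k.dim
      size≡ : K.size ≡ p ℕ.^ (f ℕ.+ f)
      size≡ = trans K.size≡p^dim (cong (p ℕ.^_) (QuadraticExtension.dim-K E))
      width≡ : width E saturated ≡ r ℕ.* (f ℕ.+ f) ℕ.+ f
      width≡ = cong (λ d → r ℕ.* d ℕ.+ f) (QuadraticExtension.dim-K E)
      -- A field has at least two elements, so its dimension is positive; for f = 0 there would be
      -- no spare factor.
      f≥1 : 1 ℕ.≤ f
      f≥1 = positive f (ℕ.≤-trans (LinearAlgebra.2≤size (ℕ.<-trans ℕ.≤-refl (2<p bounds<p)) F)
          (ℕ.≤-reflexive k.size≡p^dim))
        where
        positive : ∀ d → 2 ℕ.≤ p ℕ.^ d → 1 ℕ.≤ d
        positive zero    (s≤s ())
        positive (suc d) _ = s≤s z≤n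
      Q<m^ : base E saturated ℕ.^ width E saturated ℕ.< K.size ℕ.^ suc r
      Q<m^ = subst₂ (λ w m → base E saturated ℕ.^ w ℕ.< m ℕ.^ suc r) (sym width≡) (sym size≡)
          (base^width<size^ bounds<p f f≥1)
      2≤base : 2 ℕ.≤ base E saturated
      2≤base = ℕ.≤-trans (ℕ.<⇒≤ (2<p bounds<p)) (ℕ.≤-trans (ℕ.≤-reflexive (sym (ℕ.*-identityˡ p))) (ℕ.*-monoˡ-≤ p S≥1))
      2≤Q : 2 ℕ.≤ base E saturated ℕ.^ width E saturated
      2≤Q = ℕ.≤-trans 2≤base (ℕ.≤-trans (ℕ.≤-reflexive (sym (ℕ.^-identityʳ _)))
        (ℕ.^-monoʳ-≤ (base E saturated) {{ℕ.>-nonZero (ℕ.<⇒≤ 2≤base)}} {1} {width E saturated}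
            (ℕ.≤-trans f≥1 (ℕ.m≤n+m f _))))
      growth : ∀ n N → (base E saturated ℕ.^ width E saturated) ℕ.^ n ℕ.≤ N → K.size ℕ.^ n ℕ.≤ Defs.r L N
      growth n N Q^n≤N = lowerBound E saturated n (ℕ.≤-trans (ℕ.≤-reflexive
        (trans (cong (base E saturated ℕ.^_) (ℕ.*-comm n (width E saturated)))
            (sym (ℕ.^-*-assoc (base E saturated) (width E saturated) n)))) Q^n≤N)

    powerGrowthOver : Prime p → PowerGrowth
    powerGrowthOver p-prime = finish (Tower.saturatedPair (2<p bounds<p) r (r<p bounds<p) (c L) c≢0 ∣c∣<p
        (PrimeField.primeField p p-prime) N A (A<p bounds<p) (E<p bounds<p) few)
      where
      finish : Tower.SaturatedPair (2<p bounds<p) r (r<p bounds<p) (c L) c≢0 ∣c∣<p → PowerGrowth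
      finish (F , E , saturated) = powerGrowthFrom E saturated

  powerGrowth : PowerGrowth
  powerGrowth = finish (primeAbove bounds)
    where
    finish : (∃ λ p → Prime p × bounds ℕ.< p) → PowerGrowth
    finish (p , p-prime , bounds<p) = powerGrowthOver bounds<p p-prime

open import Defs using (r)
open import Data.Nat.Base using (_≤_)
open import Data.Product using (∃-syntax)
open import Data.Rational.Unnormalised.Base using (0ℚᵘ; _<_; _+_)

theorem3 : (s : ℕ) (s≥3 : 3 ≤ s) (L : TranslationInvariantForm s) → Primitive L →
    ∃[ ε ] (0ℚᵘ < ε × (∃[ C ] (0ℚᵘ < C × ((N : ℕ) → 1 ≤ N → r L N ≥[ C · N ^ (1/[s-1] s s≥3 + ε) ]))))
theorem3 (suc (suc t)) (s≤s (s≤s t≥1)) L L-primitive = conclude (powerGrowth t≥1 L L-primitive)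
  where
  conclude : PowerGrowth t≥1 L L-primitive → _
  conclude (Q , m , 2≤Q , Q<m^ , growth) = exponent-gain t Q m (r L) 2≤Q Q<m^ growth
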